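{- For any $\varepsilon>0$ and any integer $d\geq 2$ there exist positive constants $c_1$ and $c_2$, depending only on $d$ and $\varepsilon$, such that for every prime $p$ the following holds. Let $f\in\mathbb{F}_p[X]$ be of degree $d$, let $u\in\mathbb{F}_p$, let $N$ be an integer, and let $\mathcal{G}$ be a subgroup of $\mathbb{F}_p^*$ with $$ N^{\varepsilon}<\#\mathcal{G}<\min\{N^{2-\varepsilon},\, p^{1-\varepsilon}\}. $$ If $2\leq N<\min\{d^{c_1\mathscr{P}_0},\, T_u\}$, then $$ \rho(N)<c_2\,\frac{1}{\log N}. $$
   Context: Let $p$ be a prime, $\mathbb{F}_p$ the field of $p$ elements and $f\in\mathbb{F}_p[X]$. For $u\in\mathbb{F}_p$ let $(u_n)_{n\ge0}$ be the sequence $u_0=u$, $u_{n+1}=f(u_n)$ for $n=0,1,2,\ldots$. The trajectory length $T_u$ is the smallest integer $t$ for which there is an integer $s$ with $0\leq s<t$ and $u_s=u_t$. For $v\in\mathbb{F}_p$, $\mathscr{P}_v$ is the period length of the sequence with starting point $v$: the minimal integer $m>0$ such that $u_n=u_{n+m}$ for all $n=0,1,\ldots$ (where $u_0=v$), with $\mathscr{P}_v=\infty$ if the sequence is not purely periodic (only eventually periodic). In particular $\mathscr{P}_0$ is this quantity for the starting point $v=0$; if $\mathscr{P}_0=\infty$ then $d^{c_1\mathscr{P}_0}=\infty$. Put $\mathcal{V}_u(N)=\{u_n:\ 0\leq n\leq N\}$. For a subgroup $\mathcal{G}\subseteq\mathbb{F}_p^*$, $$\rho(N)=\frac{\#(\mathcal{V}_u(N)\cap\mathcal{G})}{\#\mathcal{V}_u(N)}.$$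 -}

module Defs where

open import Algebra.Definitions.RawSemiring as RawSemiringDefs using ()
open import Data.Empty using (⊥)
open import Data.Fin.Base using (Fin; toℕ)
open import Data.Fin.Subset using (Subset; _∈_; _∩_; ⋃; ⁅_⁆; ∣_∣)
open import Data.Fin.Subset.Properties using (∣⁅x⁆∣≡1; ∣p∣≤∣p∪q∣)
open import Data.Integer.Base as ℤ using (ℤ; +_; -[1+_])
open import Data.List.Base using (List; []; _∷_; foldr; map; upTo)
open import Data.Nat.Base as ℕ using (ℕ; zero; suc; NonZero)
open import Data.Nat.DivMod using (_mod_)
open import Data.Nat.Properties as ℕ using ()
open import Data.Product.Base using (∃-syntax; _×_)
open import Data.Rational.Base as ℚ using (ℚ; 0ℚ; 1ℚ)
open import Data.Sum.Base using (_⊎_)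
open import Data.Unit.Base using (⊤)
open import Relation.Binary.PropositionalEquality using (_≡_; _≢_; subst)
open import Relation.Nullary.Construct.Add.Supremum using (_⁺; [_]; ⊤⁺)
open import Relation.Nullary.Negation.Core using (¬_)

open RawSemiringDefs ℚ.+-*-rawSemiring using () renaming (_^_ to _^ℚ_)

fromℕℚ : ℕ → ℚ
fromℕℚ n = (+ n) ℚ./ 1

------------------------------------------------------------------------
-- Real numbers

-- A Cut x is given by the two predicates "q < x" and "x < q" on rationals.
-- The Dedekind axioms are imposed separately (in ℝ), so that ∞ is also a Cut
-- and the operations below need not carry proofs. On (representatives of)
-- real numbers within the stated domains they are the usual operations.
record Cut : Set₁ where
  field
    Lower : ℚ → Set
    Upper : ℚ → Set

open Cut public

record IsDedekind (x : Cut) : Set where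
  field
    lower-inhabited : ∃[ q ] Lower x q
    upper-inhabited : ∃[ q ] Upper x q
    lower-closed    : ∀ {q r} → q ℚ.< r → Lower x r → Lower x q
    upper-closed    : ∀ {q r} → q ℚ.< r → Upper x q → Upper x r
    lower-open      : ∀ {q} → Lower x q → ∃[ r ] (q ℚ.< r × Lower x r)
    upper-open      : ∀ {r} → Upper x r → ∃[ q ] (q ℚ.< r × Upper x q)
    disjoint        : ∀ {q} → ¬ (Lower x q × Upper x q)
    located         : ∀ {q r} → q ℚ.< r → Lower x q ⊎ Upper x r

record ℝ : Set₁ where
  field
    cut        : Cut
    isDedekind : IsDedekind cut

open ℝ public

infix  4 _<ᶜ_
infixl 6 _+ᶜ_ _-ᶜ_
infixl 7 _*ᶜ_ _⊓ᶜ_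
infixr 8 _^ᶜ_
infix  9 -ᶜ_

_<ᶜ_ : Cut → Cut → Set
x <ᶜ y = ∃[ q ] (Upper x q × Lower y q)

fromℚ : ℚ → Cut
fromℚ a .Lower q = q ℚ.< a
fromℚ a .Upper q = a ℚ.< q

fromℕ : ℕ → Cut
fromℕ n = fromℚ (fromℕℚ n)

∞ᶜ : Cut
∞ᶜ .Lower _ = ⊤
∞ᶜ .Upper _ = ⊥

_⊓ᶜ_ : Cut → Cut → Cut
(x ⊓ᶜ y) .Lower q = Lower x q × Lower y q
(x ⊓ᶜ y) .Upper q = Upper x q ⊎ Upper y q

-ᶜ_ : Cut → Cut
(-ᶜ x) .Lower q = Upper x (ℚ.- q)
(-ᶜ x) .Upper q = Lower x (ℚ.- q)

_+ᶜ_ : Cut → Cut → Cut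
(x +ᶜ y) .Lower q = ∃[ a ] (Lower x a × Lower y (q ℚ.- a))
(x +ᶜ y) .Upper q = ∃[ a ] (Upper x a × Upper y (q ℚ.- a))

_-ᶜ_ : Cut → Cut → Cut
x -ᶜ y = x +ᶜ (-ᶜ y)

-- If a < x < b and c < y < e, then x y lies strictly between the least and
-- the greatest of the four products of endpoints.
_*ᶜ_ : Cut → Cut → Cut
(x *ᶜ y) .Lower q = ∃[ a ] ∃[ b ] ∃[ c ] ∃[ e ]
  ((Lower x a × Upper x b) × (Lower y c × Upper y e) ×
   q ℚ.< a ℚ.* c × q ℚ.< a ℚ.* e × q ℚ.< b ℚ.* c × q ℚ.< b ℚ.* e)
(x *ᶜ y) .Upper q = ∃[ a ] ∃[ b ] ∃[ c ] ∃[ e ]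
  ((Lower x a × Upper x b) × (Lower y c × Upper y e) ×
   a ℚ.* c ℚ.< q × a ℚ.* e ℚ.< q × b ℚ.* c ℚ.< q × b ℚ.* e ℚ.< q)

-- 1 / x, for x > 0 only.
recip⁺ : Cut → Cut
recip⁺ x .Lower q = ∃[ r ] (Upper x r × q ℚ.* r ℚ.< 1ℚ)
recip⁺ x .Upper q = ∃[ r ] (0ℚ ℚ.< r × Lower x r × 1ℚ ℚ.< q ℚ.* r)

posPart negPart : ℤ → ℕ
posPart (+ n)    = n
posPart -[1+ n ] = 0
negPart (+ n)    = 0
negPart -[1+ n ] = suc n

-- q < n ^ a and n ^ a < q for n ≥ 1 and a = s / t in lowest terms, obtained by
-- comparing q ^ t with n ^ s and clearing the denominator when s < 0.
BelowPower AbovePower : ℕ → ℚ → ℚ → Set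
BelowPower n a q = q ℚ.≤ 0ℚ ⊎
  (q ^ℚ ℚ.denominatorℕ a) ℚ.* (fromℕℚ n ^ℚ negPart (ℚ.numerator a))
    ℚ.< fromℕℚ n ^ℚ posPart (ℚ.numerator a)
AbovePower n a q = 0ℚ ℚ.< q ×
  fromℕℚ n ^ℚ posPart (ℚ.numerator a)
    ℚ.< (q ^ℚ ℚ.denominatorℕ a) ℚ.* (fromℕℚ n ^ℚ negPart (ℚ.numerator a))

-- n ^ x for n ≥ 1: the supremum of n ^ a over rationals a < x, and the infimum
-- over rationals a > x.
_^ᶜ_ : ℕ → Cut → Cut
(n ^ᶜ x) .Lower q = ∃[ a ] (Lower x a × BelowPower n a q)
(n ^ᶜ x) .Upper q = ∃[ a ] (Upper x a × AbovePower n a q)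

-- The natural logarithm of n ≥ 1. For rational q and m > ∣q∣,
--   (1 + q/m) ^ m  ≤  e ^ q  ≤  (1 - q/m) ^ (- m),
-- and both bounds tend to e ^ q; thus q < log n iff the right-hand bound is < n
-- for some such m, and log n < q iff n is < the left-hand bound for some such m.
log : ℕ → Cut
log n .Lower q = ∃[ k ] (ℚ.∣ q ∣ ℚ.< fromℕℚ (suc k) ×
  1ℚ ℚ.< fromℕℚ n ℚ.* (1ℚ ℚ.- q ℚ.* ((+ 1) ℚ./ suc k)) ^ℚ suc k)
log n .Upper q = ∃[ k ] (ℚ.∣ q ∣ ℚ.< fromℕℚ (suc k) ×
  fromℕℚ n ℚ.< (1ℚ ℚ.+ q ℚ.* ((+ 1) ℚ./ suc k)) ^ℚ suc k)

-- d ^ (c P) for P ∈ ℕ ∪ {∞}, with the convention d ^ (c ∞) = ∞.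
_^[_·_] : ℕ → Cut → ℕ ⁺ → Cut
d ^[ c · [ m ] ] = d ^ᶜ (c *ᶜ fromℕ m)
d ^[ c · ⊤⁺ ]    = ∞ᶜ

------------------------------------------------------------------------
-- The field with p elements (for p prime) and its polynomials

Least : (ℕ → Set) → ℕ → Set
Least P n = P n × (∀ m → P m → n ℕ.≤ m)

module _ {p : ℕ} .{{_ : NonZero p}} where

  infixl 6 _+ₚ_
  infixl 7 _*ₚ_

  0ₚ 1ₚ : Fin p
  0ₚ = 0 mod p
  1ₚ = 1 mod p

  _+ₚ_ _*ₚ_ : Fin p → Fin p → Fin p
  a +ₚ b = (toℕ a ℕ.+ toℕ b) mod p
  a *ₚ b = (toℕ a ℕ.* toℕ b) mod p

  -- Coefficient lists, constant term first; trailing zeros are allowed.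
  coeff : List (Fin p) → ℕ → Fin p
  coeff []      _       = 0ₚ
  coeff (a ∷ f) zero    = a
  coeff (a ∷ f) (suc i) = coeff f i

  HasDegree : List (Fin p) → ℕ → Set
  HasDegree f d = coeff f d ≢ 0ₚ × (∀ i → d ℕ.< i → coeff f i ≡ 0ₚ)

  eval : List (Fin p) → Fin p → Fin p
  eval f x = foldr (λ a y → a +ₚ x *ₚ y) 0ₚ f

  record IsSubgroup (G : Subset p) : Set where
    field
      nonzero   : ∀ {x} → x ∈ G → x ≢ 0ₚ
      1-closed  : 1ₚ ∈ G
      *-closed  : ∀ {x y} → x ∈ G → y ∈ G → x *ₚ y ∈ G
      ⁻¹-closed : ∀ {x} → x ∈ G → ∃[ y ] (y ∈ G × x *ₚ y ≡ 1ₚ)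

  module _ (f : List (Fin p)) where

    orbit : Fin p → ℕ → Fin p
    orbit u zero    = u
    orbit u (suc n) = eval f (orbit u n)

    IsTrajectoryLength : Fin p → ℕ → Set
    IsTrajectoryLength u =
      Least (λ t → ∃[ s ] (s ℕ.< t × orbit u s ≡ orbit u t))

    IsPeriod : Fin p → ℕ → Set
    IsPeriod v m = 0 ℕ.< m × (∀ n → orbit v n ≡ orbit v (n ℕ.+ m))

    IsPeriodLength : Fin p → ℕ ⁺ → Set
    IsPeriodLength v [ m ] = Least (IsPeriod v) m
    IsPeriodLength v ⊤⁺    = ∀ m → ¬ IsPeriod v m

    values : Fin p → ℕ → Subset p
    values u N = ⋃ (map (λ n → ⁅ orbit u n ⁆) (upTo (suc N)))

    values-nonZero : ∀ u N → NonZero ∣ values u N ∣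
    values-nonZero u N = ℕ.>-nonZero
      (subst (ℕ._≤ ∣ values u N ∣) (∣⁅x⁆∣≡1 u) (∣p∣≤∣p∪q∣ ⁅ u ⁆ _))

    ρ : Fin p → Subset p → ℕ → ℚ
    ρ u G N = ((+ ∣ values u N ∩ G ∣) ℚ./ ∣ values u N ∣) {{values-nonZero u N}}

{-# OPTIONS --safe #-}
-- Cut the orbit into blocks of length L, a small multiple of log N. Blocks with at most J
-- terms in G contribute O(N / L) terms. Every other block has one of 2ᴸ patterns, and for a
-- fixed pattern the first term x of the block in G satisfies f⁽ᵏ⁾(x) ∈ G for J fixed shifts
-- k < L. So it suffices to bound the number of such x by N to a power below 1.
--
-- This is done by Stepanov's method. Since N < d ^ P₀, the iterates f⁽ᵐ⁾(0), 0 < m < L, do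
-- not vanish, and f⁽ⁱ⁺ᵐ⁾ ≡ f⁽ᵐ⁾(0) mod f⁽ⁱ⁾ makes the iterates comaximal. With t = ∣G∣, all
-- y ∈ G satisfy yᵗ = 1, so by counting coefficients there are P_b, not all zero and of degree
-- below A, such that Ψ = Σ_b P_b Πᵢ (f⁽ᵏⁱ⁾)^(t bᵢ) vanishes to order M at all x, hence
-- M #{x} ≤ deg Ψ provided that Ψ ≠ 0.
--
-- If a shortest such combination Ψ were 0, choose (again by counting) an operator Σ qₗ Dˡ,
-- where D = g X d/dX with g the product of the iterates, that kills all terms of Ψ but two.
-- What it makes of these two has low degree coefficients, so by comaximality both are killed.
-- But the lowest exponents of the polynomials of degree below p killed by an operator of
-- order below m are roots of its indicial polynomial, so these span less than m dimensions,
-- whereas the terms of Ψ other than the first are m linearly independent ones.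

module Submission where

open import Defs
open import Data.Fin.Base using (Fin)
open import Data.Fin.Subset using (Subset; ∣_∣)
open import Data.List.Base using (List)
open import Data.Nat.Base using (ℕ; NonZero; _≤_)
open import Data.Nat.Primality using (Prime)
open import Data.Product.Base using (Σ-syntax; _×_)
open import Relation.Nullary.Construct.Add.Supremum using (_⁺)

open import Algebra.Bundles using (CommutativeRing; CommutativeSemiring)
open import Algebra.Core using (Op₁; Op₂)
open import Algebra.Structures using (IsCommutativeRing)
open import Data.Bool.Base using (true; false; if_then_else_)
open import Data.Empty using (⊥; ⊥-elim)
open import Data.Fin.Base as Fin using (zero; suc; toℕ; fromℕ<; punchIn; combine; remQuot; finToFun; funToFin)
open import Data.Fin.Permutation using (permutation)
import Data.Fin.Properties as Fin
open import Data.List.Base as List using ([]; _∷_; length)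
import Data.List.Membership.Propositional as List
open import Data.List.Membership.Propositional.Properties using (∈-filter⁺; ∈-filter⁻; ∈-upTo⁺; ∈-map⁻)
open import Data.List.Properties using (length-map)
open import Data.List.Relation.Unary.All as All using (All; []; _∷_)
import Data.List.Relation.Unary.All.Properties as All
open import Data.List.Relation.Unary.AllPairs using ([]; _∷_)
import Data.List.Relation.Unary.AllPairs.Properties as AllPairs
open import Data.List.Relation.Unary.Any using (index; here; there)
import Data.List.Relation.Unary.Any.Properties as Any
open import Data.List.Relation.Unary.Unique.Propositional using (Unique)
open import Data.Nat.Base as ℕ using (zero; suc; _<_; z≤n; s≤s)
open import Data.Nat.GeneralisedArithmetic using (iterate)
import Data.Nat.Properties as ℕ
open import Data.Product.Base using (∃-syntax; ∃₂; _,_; proj₁; proj₂; uncurry)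
open import Data.Sum.Base using (_⊎_; inj₁; inj₂)
open import Data.Vec.Properties using ([]=⇒lookup; lookup⇒[]=)
open import Function.Base using (_∘_; id; case_of_)
open import Function.Definitions using (Injective)
open import Level using (0ℓ)
open import Relation.Binary.Definitions using (DecidableEquality; tri<; tri≈; tri>)
open import Relation.Binary.PropositionalEquality hiding (setoid; J)
open import Relation.Nullary using (¬_; yes; no; Dec; ¬?)
open import Relation.Nullary.Construct.Add.Supremum using ([_]; ⊤⁺)
open import Relation.Nullary.Decidable using (decidable-stable; from-yes)

-- The hypotheses on t = ∣G∣ come from balancing sizes. With s = J + 1 iterates (X included) and
-- exponents t bᵢ, 0 ≤ bᵢ < B, there are K = B ^ s monomials, each of degree only about t B up to
-- powers of Y. Vanishing to order M costs M (A + M W) conditions against K A unknowns, so M is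
-- proportional to K and about t B / K points survive. Linear independence asks for roughly K² < t.
-- Taking K near √t leaves about √t points up to powers of Y, fewer than N because t < N ^ (2 - ε).
-- Many iterates are used so that B = K ^ (1 / s) is a negligible power of N although K is not. The
-- lower bound on t gives room for powers of Y below t, and t < p ^ (1 - ε) keeps the degree of Ψ
-- below p, so that D still sees multiplicities and lowest exponents in characteristic p.
--
-- Of ε only an integer r with 1 / r < ε is used, through N < t ^ r, t ^ r < N ^ (2 r - 1) and t ^ r
-- < p ^ (r - 1). This keeps the whole argument in ℕ; the real numbers appear only at its two ends.

-- Polynomials over a commutative ring

module Polynomials {F : Set} {_+_ _*_ : Op₂ F} { -_ : Op₁ F} {0# 1# : F}
  (isCommutativeRing : IsCommutativeRing _≡_ _+_ _*_ -_ 0# 1#) where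

  infixl 7 _⊗_ _⊛_
  infixl 6 _⊕_
  infix  4 _≈_

  baseRing : CommutativeRing 0ℓ 0ℓ
  baseRing = record { isCommutativeRing = isCommutativeRing }

  open CommutativeRing baseRing using (commutativeSemiring)
  open IsCommutativeRing isCommutativeRing
    hiding (refl; sym; trans; reflexive; isEquivalence)
  open import Algebra.Solver.Ring.NaturalCoefficients.Default commutativeSemiring
    using (solve; _:+_; _:*_; _:=_)

  Series : Set
  Series = ℕ → F

  -- The Cauchy product, by splitting off the head of the left factor: (a₀ + X a′) b = a₀ b + X a′
  -- b. The ring laws become inductions without finite sums.
  _⊛_ : Series → Series → Series
  (a ⊛ b) zero    = a 0 * b 0
  (a ⊛ b) (suc n) = (a 0 * b (suc n)) + ((a ∘ suc) ⊛ b) n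

  ⊛-cong : ∀ {a a′ b b′} → a ≗ a′ → b ≗ b′ → a ⊛ b ≗ a′ ⊛ b′
  ⊛-cong p q zero    = cong₂ _*_ (p 0) (q 0)
  ⊛-cong p q (suc n) = cong₂ _+_ (cong₂ _*_ (p 0) (q (suc n))) (⊛-cong (p ∘ suc) q n)

  ⊛-zeroˡ : ∀ a b → (∀ i → a i ≡ 0#) → ∀ n → (a ⊛ b) n ≡ 0#
  ⊛-zeroˡ a b a≡0 zero    = trans (cong (_* b 0) (a≡0 0)) (zeroˡ (b 0))
  ⊛-zeroˡ a b a≡0 (suc n) = trans
    (cong₂ _+_ (trans (cong (_* b (suc n)) (a≡0 0)) (zeroˡ _)) (⊛-zeroˡ (a ∘ suc) b (a≡0 ∘ suc) n))
    (+-identityˡ 0#)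

  ⊛-distribʳ : ∀ c a b n → ((λ i → a i + b i) ⊛ c) n ≡ (a ⊛ c) n + (b ⊛ c) n
  ⊛-distribʳ c a b zero    = distribʳ (c 0) (a 0) (b 0)
  ⊛-distribʳ c a b (suc n) = trans
    (cong (((a 0 + b 0) * c (suc n)) +_) (⊛-distribʳ c (a ∘ suc) (b ∘ suc) n))
    (solve 5 (λ x y z u v → (x :+ y) :* z :+ (u :+ v)
       := (x :* z :+ u) :+ (y :* z :+ v)) refl _ _ _ _ _)

  ⊛-scaleˡ : ∀ c a b n → ((λ i → c * a i) ⊛ b) n ≡ c * (a ⊛ b) n
  ⊛-scaleˡ c a b zero    = *-assoc c (a 0) (b 0)
  ⊛-scaleˡ c a b (suc n) = trans
    (cong₂ _+_ (*-assoc c (a 0) (b (suc n))) (⊛-scaleˡ c (a ∘ suc) b n))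
    (sym (distribˡ c _ _))

  ⊛-sucʳ : ∀ a b n → (a ⊛ b) (suc n) ≡ (a (suc n) * b 0) + (a ⊛ (b ∘ suc)) n
  ⊛-sucʳ a b zero    = +-comm _ _
  ⊛-sucʳ a b (suc n) = trans (cong ((a 0 * b (suc (suc n))) +_) (⊛-sucʳ (a ∘ suc) b n))
    (solve 3 (λ x y z → x :+ (y :+ z) := y :+ (x :+ z)) refl _ _ _)

  ⊛-comm : ∀ a b → a ⊛ b ≗ b ⊛ a
  ⊛-comm a b zero    = *-comm (a 0) (b 0)
  ⊛-comm a b (suc n) = trans
    (cong₂ _+_ (*-comm (a 0) (b (suc n))) (⊛-comm (a ∘ suc) b n))
    (sym (⊛-sucʳ b a n))

  ⊛-assoc : ∀ a b c → (a ⊛ b) ⊛ c ≗ a ⊛ (b ⊛ c)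
  ⊛-assoc a b c zero    = *-assoc (a 0) (b 0) (c 0)
  ⊛-assoc a b c (suc n) = begin
    ((a 0 * b 0) * c (suc n)) + ((λ i → (a 0 * b (suc i)) + ((a ∘ suc) ⊛ b) i) ⊛ c) n
      ≡⟨ cong (((a 0 * b 0) * c (suc n)) +_) (⊛-distribʳ c (λ i → a 0 * b (suc i)) ((a ∘ suc) ⊛ b) n) ⟩
    ((a 0 * b 0) * c (suc n)) + (((λ i → a 0 * b (suc i)) ⊛ c) n + (((a ∘ suc) ⊛ b) ⊛ c) n)
      ≡⟨ cong (((a 0 * b 0) * c (suc n)) +_)
           (cong₂ _+_ (⊛-scaleˡ (a 0) (b ∘ suc) c n) (⊛-assoc (a ∘ suc) b c n)) ⟩
    ((a 0 * b 0) * c (suc n)) + ((a 0 * ((b ∘ suc) ⊛ c) n) + ((a ∘ suc) ⊛ (b ⊛ c)) n)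
      ≡⟨ solve 5 (λ x y z u v → x :* y :* z :+ (x :* u :+ v)
           := x :* (y :* z :+ u) :+ v) refl _ _ _ _ _ ⟩
    (a ⊛ (b ⊛ c)) (suc n) ∎
    where open ≡-Reasoning

  constant : F → Series
  constant c zero    = c
  constant c (suc n) = 0#

  ⊛-constantˡ : ∀ c b n → (constant c ⊛ b) n ≡ c * b n
  ⊛-constantˡ c b zero    = refl
  ⊛-constantˡ c b (suc n) =
    trans (cong ((c * b (suc n)) +_) (⊛-zeroˡ _ b (λ _ → refl) n)) (+-identityʳ _)

  BelowS : ℕ → Series → Set
  BelowS n a = ∀ i → n ≤ i → a i ≡ 0#

  -- The degree is below n on the left but at most m on the right: in this form the bound needs no
  -- truncated subtraction and covers n = 0, where the left factor is zero.
  ⊛-below : ∀ n m {a b} → BelowS n a → BelowS (suc m) b → BelowS (n ℕ.+ m) (a ⊛ b)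
  ⊛-below zero    m {a} {b} pa pb i h = ⊛-zeroˡ a b (λ j → pa j z≤n) i
  ⊛-below (suc n) m {a} {b} pa pb (suc i) (s≤s h) = trans
    (cong₂ _+_
      (trans (cong (a 0 *_) (pb (suc i) (s≤s (ℕ.≤-trans (ℕ.m≤n+m m n) h)))) (zeroʳ _))
      (⊛-below n m {a ∘ suc} (λ j q → pa (suc j) (s≤s q)) pb i h))
    (+-identityˡ 0#)

  -- The bound need not be tight, so equality of polynomials is that of coefficients.
  record Poly : Set where
    no-eta-equality
    field
      coef   : Series
      bound  : ℕ
      finite : BelowS bound coef
  open Poly public

  record _≈_ (a b : Poly) : Set where
    constructor mk≈
    field at : ∀ n → coef a n ≡ coef b n
  open _≈_ public

  Below : ℕ → Poly → Set
  Below n a = BelowS n (coef a)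

  below-mono : ∀ {m n} (a : Poly) → m ≤ n → Below m a → Below n a
  below-mono a m≤n h i n≤i = h i (ℕ.≤-trans m≤n n≤i)

  C : F → Poly
  C c .coef   = constant c
  C c .bound  = 1
  C c .finite (suc i) _ = refl

  𝟘 𝟙 X : Poly
  𝟘 .coef _     = 0#
  𝟘 .bound      = 0
  𝟘 .finite _ _ = refl
  𝟙 = C 1#
  X .coef zero            = 0#
  X .coef (suc n)         = constant 1# n
  X .bound                = 2
  X .finite (suc zero) (s≤s ())
  X .finite (suc (suc i)) _ = refl

  _⊕_ _⊗_ : Poly → Poly → Poly
  (a ⊕ b) .coef i = coef a i + coef b i
  (a ⊕ b) .bound  = bound a ℕ.+ bound b
  (a ⊕ b) .finite i h = trans
    (cong₂ _+_ (finite a i (ℕ.≤-trans (ℕ.m≤m+n _ _) h))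
               (finite b i (ℕ.≤-trans (ℕ.m≤n+m (bound b) (bound a)) h)))
    (+-identityˡ 0#)
  (a ⊗ b) .coef   = coef a ⊛ coef b
  (a ⊗ b) .bound  = bound a ℕ.+ bound b
  (a ⊗ b) .finite = ⊛-below (bound a) (bound b) {coef a} {coef b} (finite a)
    (λ i h → finite b i (ℕ.≤-trans (ℕ.n≤1+n _) h))

  ⊝_ : Poly → Poly
  (⊝ a) .coef i = - coef a i
  (⊝ a) .bound  = bound a
  (⊝ a) .finite i h = trans (cong -_ (finite a i h)) -0#≈0#
    where
    open import Algebra.Properties.Ring (CommutativeRing.ring baseRing) using (-0#≈0#)

  polyRing : CommutativeRing 0ℓ 0ℓ
  polyRing = record
    { Carrier = Poly ; _≈_ = _≈_ ; _+_ = _⊕_ ; _*_ = _⊗_ ; -_ = ⊝_ ; 0# = 𝟘 ; 1# = 𝟙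
    ; isCommutativeRing = record
      { isRing = record
        { +-isAbelianGroup = record
          { isGroup = record
            { isMonoid = record
              { isSemigroup = record
                { isMagma = record
                  { isEquivalence = record
                    { refl  = mk≈ λ _ → refl
                    ; sym   = λ p → mk≈ λ n → sym (at p n)
                    ; trans = λ p q → mk≈ λ n → trans (at p n) (at q n)
                    }
                  ; ∙-cong = λ p q → mk≈ λ n → cong₂ _+_ (at p n) (at q n)
                  }
                ; assoc = λ a b c → mk≈ λ n → +-assoc _ _ _
                }
              ; identity = (λ a → mk≈ λ n → +-identityˡ _) , (λ a → mk≈ λ n → +-identityʳ _)
              }
            ; inverse = (λ a → mk≈ λ n → -‿inverseˡ _) , (λ a → mk≈ λ n → -‿inverseʳ _)
            ; ⁻¹-cong = λ p → mk≈ λ n → cong -_ (at p n)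
            }
          ; comm = λ a b → mk≈ λ n → +-comm _ _
          }
        ; *-cong = λ p q → mk≈ (⊛-cong (at p) (at q))
        ; *-assoc = λ a b c → mk≈ (⊛-assoc (coef a) (coef b) (coef c))
        ; *-identity = (λ a → mk≈ λ n → trans (⊛-constantˡ 1# (coef a) n) (*-identityˡ _))
                     , (λ a → mk≈ λ n → trans (⊛-comm (coef a) _ n)
                          (trans (⊛-constantˡ 1# (coef a) n) (*-identityˡ _)))
        ; distrib = (λ a b c → mk≈ λ n → trans (⊛-comm (coef a) _ n)
                        (trans (⊛-distribʳ (coef a) (coef b) (coef c) n)
                          (cong₂ _+_ (⊛-comm (coef b) (coef a) n) (⊛-comm (coef c) (coef a) n))))
                  , (λ a b c → mk≈ (⊛-distribʳ (coef a) (coef b) (coef c)))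
        }
      ; *-comm = λ a b → mk≈ (⊛-comm (coef a) (coef b))
      }
    }

-- Comaximal elements of a commutative ring

module Comaximality {c ℓ} (R : CommutativeRing c ℓ) where
  open CommutativeRing R hiding (zero) renaming (refl to ≈-refl; trans to ≈-trans)
  open import Algebra.Properties.Semiring.Exp semiring using (_^_)
  open import Algebra.Definitions.RawSemiring (CommutativeSemiring.rawSemiring commutativeSemiring) using (_∣_; product)
  open import Algebra.Definitions.RawMagma (CommutativeSemiring.*-rawMagma commutativeSemiring) using (_,_)
  open import Relation.Binary.Reasoning.Setoid setoid
  open import Algebra.Solver.Ring.NaturalCoefficients.Default commutativeSemiring
    using (solve; _:+_; _:*_; _:=_)

  Comaximal : Carrier → Carrier → Set _
  Comaximal a b = ∃[ u ] ∃[ v ] u * a + v * b ≈ 1#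

  comaximal-sym : ∀ {a b} → Comaximal a b → Comaximal b a
  comaximal-sym (u , v , eq) = v , u , ≈-trans (+-comm _ _) eq

  comaximal-1 : ∀ a → Comaximal a 1#
  comaximal-1 a = 0# , 1# , ≈-trans (+-cong (zeroˡ a) (*-identityˡ 1#)) (+-identityˡ 1#)

  -- Multiply the two Bézout identities: every term of the product contains `a`, except
  -- `v * v′ * (b * c)`.
  comaximal-* : ∀ {a b c} → Comaximal a b → Comaximal a c → Comaximal a (b * c)
  comaximal-* {a} {b} {c} (u , v , eq) (u′ , v′ , eq′) =
    u * (u′ * a + v′ * c) + v * b * u′ , v * v′ , (begin
      (u * (u′ * a + v′ * c) + v * b * u′) * a + v * v′ * (b * c)
        ≈⟨ solve 7 (λ a b c u v u′ v′ →
             (u :* (u′ :* a :+ v′ :* c) :+ v :* b :* u′) :* a :+ v :* v′ :* (b :* c)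
             := (u :* a :+ v :* b) :* (u′ :* a :+ v′ :* c)) ≈-refl a b c u v u′ v′ ⟩
      (u * a + v * b) * (u′ * a + v′ * c)
        ≈⟨ *-cong eq eq′ ⟩
      1# * 1#
        ≈⟨ *-identityˡ 1# ⟩
      1# ∎)

  comaximal-^ : ∀ {a b} → Comaximal a b → ∀ n → Comaximal a (b ^ n)
  comaximal-^ h zero    = comaximal-1 _
  comaximal-^ h (suc n) = comaximal-* h (comaximal-^ h n)

  comaximal-^^ : ∀ {a b} → Comaximal a b → ∀ m n → Comaximal (a ^ m) (b ^ n)
  comaximal-^^ h m n = comaximal-sym (comaximal-^ (comaximal-sym (comaximal-^ h n)) m)

  comaximal-product : ∀ {a n} (b : Fin n → Carrier) → (∀ i → Comaximal a (b i)) →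
                      Comaximal a (product b)
  comaximal-product {n = zero}  b h = comaximal-1 _
  comaximal-product {n = suc n} b h =
    comaximal-* (h zero) (comaximal-product (b ∘ suc) (h ∘ suc))

  -- Euclid's lemma without factorisation: multiply the Bézout identity by `c`.
  comaximal-∣ : ∀ {a b c} → Comaximal a b → a ∣ c * b → a ∣ c
  comaximal-∣ {a} {b} {c} (u , v , eq) (q , qa≈cb) = (c * u + v * q) , (begin
    (c * u + v * q) * a
      ≈⟨ solve 5 (λ a c u v q → (c :* u :+ v :* q) :* a := c :* (u :* a) :+ v :* (q :* a))
           ≈-refl a c u v q ⟩
    c * (u * a) + v * (q * a)
      ≈⟨ +-congˡ (*-congˡ qa≈cb) ⟩
    c * (u * a) + v * (c * b)
      ≈⟨ solve 5 (λ a b c u v → c :* (u :* a) :+ v :* (c :* b) := (u :* a :+ v :* b) :* c)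
           ≈-refl a b c u v ⟩
    (u * a + v * b) * c
      ≈⟨ *-congʳ eq ⟩
    1# * c
      ≈⟨ *-identityˡ c ⟩
    c ∎)

-- Polynomials over a field: degree, evaluation, roots, the derivation X d/dX

module FieldPolynomials {F : Set} {_+_ _*_ : Op₂ F} { -_ : Op₁ F} {0# 1# : F}
  (isCommutativeRing : IsCommutativeRing _≡_ _+_ _*_ -_ 0# 1#)
  (_≟_ : DecidableEquality F) (0≢1 : 0# ≢ 1#)
  (inverse : ∀ x → x ≢ 0# → ∃[ y ] x * y ≡ 1#) where

  open Polynomials isCommutativeRing public
  open IsCommutativeRing isCommutativeRing
    hiding (refl; sym; trans; reflexive; isEquivalence; setoid; zero)
  open CommutativeRing polyRing public
    using ()
    renaming (refl to ≈-refl; sym to ≈-sym; trans to ≈-trans; reflexive to ≈-reflexive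
             ; +-cong to ⊕-cong; *-cong to ⊗-cong; +-congˡ to ⊕-congˡ; +-congʳ to ⊕-congʳ
             ; *-congˡ to ⊗-congˡ; *-congʳ to ⊗-congʳ; *-comm to ⊗-comm
             ; *-assoc to ⊗-assoc; zeroˡ to ⊗-zeroˡ; zeroʳ to ⊗-zeroʳ
             ; *-identityˡ to ⊗-identityˡ; *-identityʳ to ⊗-identityʳ
             ; +-identityˡ to ⊕-identityˡ; +-identityʳ to ⊕-identityʳ
             ; distribˡ to ⊗-distribˡ; distribʳ to ⊗-distribʳ
             ; -‿inverseˡ to ⊝-inverseˡ; -‿inverseʳ to ⊝-inverseʳ; setoid to polySetoid
             ; semiring to polySemiring; commutativeSemiring to polyCommutativeSemiring
             ; ring to polyRing′)
  open import Algebra.Properties.Ring polyRing′ public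
    using () renaming (-‿distribʳ-* to ⊝-distribʳ-⊗)
  open import Algebra.Properties.Ring (CommutativeRing.ring baseRing)
    using () renaming (x∙y⁻¹≈ε⇒x≈y to x-y≡0⇒x≡y)
  open import Algebra.Properties.Ring polyRing′
    using () renaming (x∙y⁻¹≈ε⇒x≈y to x⊝y≈0⇒x≈y; x≈y⇒x∙y⁻¹≈ε to x≈y⇒x⊝y≈0)
  open import Algebra.Properties.Semiring.Exp polySemiring public
    using (_^_; ^-homo-*; ^-assocʳ)
  open import Algebra.Definitions.RawSemiring (CommutativeSemiring.rawSemiring polyCommutativeSemiring) public
    using (_∣_; product)
  open import Algebra.Definitions.RawMagma (CommutativeSemiring.*-rawMagma polyCommutativeSemiring) public using (_,_)
  open import Algebra.Properties.Semiring.Mult polySemiring public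
    using () renaming (_×_ to _·_)
  open import Algebra.Properties.Semiring.Mult (CommutativeRing.semiring baseRing) public
    using (×-assoc-*; ×-comm-*; ×-congʳ) renaming (_×_ to _×ᶠ_)
  open import Algebra.Properties.CommutativeMonoid.Mult
    (CommutativeRing.+-commutativeMonoid baseRing) using (×-distrib-+)
  open Comaximality polyRing public
  open import Algebra.Solver.Ring.NaturalCoefficients.Default polyCommutativeSemiring public
    using (solve; _:+_; _:*_; _:=_)
  open import Algebra.Solver.Ring.NaturalCoefficients.Default
    (CommutativeRing.commutativeSemiring baseRing) public
    using () renaming (solve to solveᶠ; _:+_ to _:+ᶠ_; _:*_ to _:*ᶠ_; _:=_ to _:=ᶠ_)

  module PR where
    open import Relation.Binary.Reasoning.Setoid polySetoid public

  *-nonzero : ∀ {x y} → x ≢ 0# → y ≢ 0# → x * y ≢ 0#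
  *-nonzero {x} {y} x≢0 y≢0 xy≡0 with inverse x x≢0
  ... | x⁻¹ , eq = y≢0 (begin
    y ≡⟨ *-identityˡ y ⟨
    1# * y ≡⟨ cong (_* y) eq ⟨
    (x * x⁻¹) * y ≡⟨ solveᶠ 3 (λ x z y → x :*ᶠ z :*ᶠ y :=ᶠ z :*ᶠ (x :*ᶠ y)) refl x x⁻¹ y ⟩
    x⁻¹ * (x * y) ≡⟨ cong (x⁻¹ *_) xy≡0 ⟩
    x⁻¹ * 0# ≡⟨ zeroʳ x⁻¹ ⟩
    0# ∎)
    where open ≡-Reasoning

  HasDeg : ℕ → Poly → Set
  HasDeg n a = coef a n ≢ 0# × Below (suc n) a

  ⊛-leading : ∀ n m {a b} → BelowS (suc n) a → BelowS (suc m) b →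
              (a ⊛ b) (n ℕ.+ m) ≡ a n * b m
  ⊛-leading zero    zero    pa pb = refl
  ⊛-leading zero    (suc m) {a} {b} pa pb =
    trans (cong (_ +_) (⊛-zeroˡ (a ∘ suc) b (λ j → pa (suc j) (s≤s z≤n)) m)) (+-identityʳ _)
  ⊛-leading (suc n) m {a} {b} pa pb = trans
    (cong₂ _+_ (trans (cong (a 0 *_) (pb (suc (n ℕ.+ m)) (s≤s (ℕ.m≤n+m m n)))) (zeroʳ _))
               (⊛-leading n m (λ j q → pa (suc j) (s≤s q)) pb))
    (+-identityˡ _)

  ⊗-below : ∀ n m {a b} → Below n a → Below (suc m) b → Below (n ℕ.+ m) (a ⊗ b)
  ⊗-below n m {a} {b} = ⊛-below n m {coef a} {coef b}

  ⊕-below : ∀ n {a b} → Below n a → Below n b → Below n (a ⊕ b)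
  ⊕-below n pa pb i h = trans (cong₂ _+_ (pa i h) (pb i h)) (+-identityˡ 0#)

  hasDeg-⊗ : ∀ {n m a b} → HasDeg n a → HasDeg m b → HasDeg (n ℕ.+ m) (a ⊗ b)
  hasDeg-⊗ {n} {m} {a} {b} (an , pa) (bm , pb) =
    (λ eq → *-nonzero an bm (trans (sym (⊛-leading n m {coef a} {coef b} pa pb)) eq)) ,
    ⊗-below (suc n) m {a} {b} pa pb

  hasDeg-^ : ∀ {n a} → HasDeg n a → ∀ k → HasDeg (k ℕ.* n) (a ^ k)
  hasDeg-^ h zero    = (λ eq → 0≢1 (sym eq)) , λ { (suc i) _ → refl }
  hasDeg-^ {a = a} h (suc k) = hasDeg-⊗ {a = a} {b = a ^ k} h (hasDeg-^ {a = a} h k)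

  hasDeg-≈ : ∀ {n a b} → a ≈ b → HasDeg n a → HasDeg n b
  hasDeg-≈ {n} p (an , pa) = (λ eq → an (trans (at p n) eq)) , λ i h → trans (sym (at p i)) (pa i h)

  below-≈ : ∀ {n a b} → a ≈ b → Below n a → Below n b
  below-≈ p pa i h = trans (sym (at p i)) (pa i h)

  hasDeg-below : ∀ {n m a} → HasDeg n a → Below m a → n < m
  hasDeg-below {n} {m} (an , _) pm with n ℕ.<? m
  ... | yes n<m = n<m
  ... | no n≮m  = ⊥-elim (an (pm n (ℕ.≮⇒≥ n≮m)))

  hasDeg≉𝟘 : ∀ {n a} → HasDeg n a → ¬ a ≈ 𝟘
  hasDeg≉𝟘 {n} (an , _) a≈0 = an (at a≈0 n)

  abstract
    -- A downward search from the bound, by decidable equality of coefficients. It makes equality to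
    -- zero decidable, which licenses the later arguments by contradiction.
    degree : ∀ a → a ≈ 𝟘 ⊎ ∃[ n ] HasDeg n a
    degree a = go (bound a) (finite a)
      where
      go : ∀ n → Below n a → a ≈ 𝟘 ⊎ ∃[ n ] HasDeg n a
      go zero    h = inj₁ (mk≈ λ n → h n z≤n)
      go (suc n) h with coef a n ≟ 0#
      ... | no an≢0  = inj₂ (n , an≢0 , h)
      ... | yes an≡0 = go n h′
        where
        h′ : Below n a
        h′ i n≤i with ℕ.m≤n⇒m<n∨m≡n n≤i
        ... | inj₁ n<i  = h i n<i
        ... | inj₂ refl = an≡0

  abstract
    ≈𝟘? : ∀ a → Dec (a ≈ 𝟘)
    ≈𝟘? a with degree a
    ... | inj₁ a≈0     = yes a≈0
    ... | inj₂ (n , h) = no (hasDeg≉𝟘 {a = a} h)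

  ⊗-nonzero : ∀ {a b} → ¬ a ≈ 𝟘 → ¬ b ≈ 𝟘 → ¬ a ⊗ b ≈ 𝟘
  ⊗-nonzero {a} {b} a≉0 b≉0 with degree a | degree b
  ... | inj₁ a≈0     | _            = λ _ → a≉0 a≈0
  ... | inj₂ _       | inj₁ b≈0     = λ _ → b≉0 b≈0
  ... | inj₂ (n , h) | inj₂ (m , k) = hasDeg≉𝟘 {a = a ⊗ b} (hasDeg-⊗ {a = a} {b} h k)

  ^-nonzero : ∀ {a} → ¬ a ≈ 𝟘 → ∀ n → ¬ a ^ n ≈ 𝟘
  ^-nonzero {a} a≉0 zero    eq = 0≢1 (sym (at eq 0))
  ^-nonzero {a} a≉0 (suc n) = ⊗-nonzero {a} {a ^ n} a≉0 (^-nonzero a≉0 n)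

  product-nonzero : ∀ {n} (a : Fin n → Poly) → (∀ i → ¬ a i ≈ 𝟘) → ¬ product a ≈ 𝟘
  product-nonzero {zero}  a h eq = 0≢1 (sym (at eq 0))
  product-nonzero {suc n} a h = ⊗-nonzero {a zero} (h zero) (product-nonzero (a ∘ suc) (h ∘ suc))

  ⊗-cancelˡ : ∀ {a b c} → ¬ a ≈ 𝟘 → a ⊗ b ≈ a ⊗ c → b ≈ c
  ⊗-cancelˡ {a} {b} {c} a≉0 eq with ≈𝟘? (b ⊕ ⊝ c)
  ... | yes b-c≈0 = x⊝y≈0⇒x≈y b c b-c≈0
  ... | no  b-c≉0 = ⊥-elim (⊗-nonzero {a} {b ⊕ ⊝ c} a≉0 b-c≉0
    (≈-trans (⊗-distribˡ a b (⊝ c))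
      (≈-trans (⊕-congˡ (≈-sym (⊝-distribʳ-⊗ a c))) (x≈y⇒x⊝y≈0 eq))))

  product-below : ∀ {n} m (a : Fin n → Poly) → (∀ i → Below (suc m) (a i)) →
                  Below (suc (n ℕ.* m)) (product a)
  product-below {zero}  m a h = λ { (suc i) _ → refl }
  product-below {suc n} m a h = subst (λ k → Below (suc k) (product a)) (ℕ.+-comm (n ℕ.* m) m)
    (below-≈ {suc (n ℕ.* m ℕ.+ m)} (⊗-comm (product (a ∘ suc)) (a zero))
      (⊗-below (suc (n ℕ.* m)) m {product (a ∘ suc)} {a zero}
        (product-below m (a ∘ suc) (h ∘ suc)) (h zero)))

  ^-below : ∀ {m a} → Below (suc m) a → ∀ k → Below (suc (k ℕ.* m)) (a ^ k)
  ^-below h zero    = λ { (suc i) _ → refl }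
  ^-below {m} {a} h (suc k) = subst (λ j → Below (suc j) (a ^ suc k)) (ℕ.+-comm (k ℕ.* m) m)
    (below-≈ {suc (k ℕ.* m ℕ.+ m)} (⊗-comm (a ^ k) a)
      (⊗-below (suc (k ℕ.* m)) m {a ^ k} {a} (^-below {a = a} h k) h))

  evS : ℕ → Series → F → F
  evS zero    a x = 0#
  evS (suc n) a x = a 0 + (x * evS n (a ∘ suc) x)

  ⟦_⟧ : Poly → F → F
  ⟦ a ⟧ = evS (bound a) (coef a)

  evS-cong : ∀ n {a b} → a ≗ b → ∀ x → evS n a x ≡ evS n b x
  evS-cong zero    p x = refl
  evS-cong (suc n) p x = cong₂ _+_ (p 0) (cong (x *_) (evS-cong n (p ∘ suc) x))

  evS-zero : ∀ n {a} → (∀ i → a i ≡ 0#) → ∀ x → evS n a x ≡ 0#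
  evS-zero zero    h x = refl
  evS-zero (suc n) h x = trans
    (cong₂ _+_ (h 0) (trans (cong (x *_) (evS-zero n (h ∘ suc) x)) (zeroʳ x))) (+-identityˡ 0#)

  evS-stable : ∀ {n m a} → BelowS n a → n ≤ m → ∀ x → evS m a x ≡ evS n a x
  evS-stable {m = m} h z≤n       x = evS-zero m (λ i → h i z≤n) x
  evS-stable         h (s≤s n≤m) x =
    cong (λ v → _ + (x * v)) (evS-stable (λ i q → h (suc i) (s≤s q)) n≤m x)

  -- Evaluation refers to the bound, which equal polynomials need not share; padding both
  -- truncations to a common length removes the dependence.
  ⟦⟧-below : ∀ n a → Below n a → ∀ x → ⟦ a ⟧ x ≡ evS n (coef a) x
  ⟦⟧-below n a h x = trans
    (sym (evS-stable (finite a) (ℕ.m≤m+n (bound a) n) x))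
    (evS-stable h (ℕ.m≤n+m n (bound a)) x)

  ⟦⟧-cong : ∀ {a b} → a ≈ b → ∀ x → ⟦ a ⟧ x ≡ ⟦ b ⟧ x
  ⟦⟧-cong {a} {b} p x = trans (evS-cong (bound a) (at p) x)
    (sym (⟦⟧-below (bound a) b (below-≈ {b = b} p (finite a)) x))

  evS-+ : ∀ n a b x → evS n (λ i → a i + b i) x ≡ evS n a x + evS n b x
  evS-+ zero    a b x = sym (+-identityˡ 0#)
  evS-+ (suc n) a b x = trans
    (cong (λ v → _ + (x * v)) (evS-+ n (a ∘ suc) (b ∘ suc) x))
    (solveᶠ 5 (λ a b x u v → (a :+ᶠ b) :+ᶠ x :*ᶠ (u :+ᶠ v)
       :=ᶠ (a :+ᶠ x :*ᶠ u) :+ᶠ (b :+ᶠ x :*ᶠ v)) refl _ _ x _ _)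

  evS-scale : ∀ n c a x → evS n (λ i → c * a i) x ≡ c * evS n a x
  evS-scale zero    c a x = sym (zeroʳ c)
  evS-scale (suc n) c a x = trans
    (cong (λ v → _ + (x * v)) (evS-scale n c (a ∘ suc) x))
    (solveᶠ 4 (λ c a x u → c :*ᶠ a :+ᶠ x :*ᶠ (c :*ᶠ u)
       :=ᶠ c :*ᶠ (a :+ᶠ x :*ᶠ u)) refl c _ x _)

  evS-⊛ : ∀ n m {a b} → BelowS n a → BelowS m b → ∀ x →
          evS (n ℕ.+ m) (a ⊛ b) x ≡ evS n a x * evS m b x
  evS-⊛ zero    m {a} {b} pa pb x = trans
    (evS-zero m (⊛-zeroˡ a b (λ i → pa i z≤n)) x) (sym (zeroˡ _))
  evS-⊛ (suc n) m {a} {b} pa pb x = begin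
    (a 0 * b 0) + (x * evS (n ℕ.+ m) (λ i → (a 0 * b (suc i)) + ((a ∘ suc) ⊛ b) i) x)
      ≡⟨ cong (λ v → (a 0 * b 0) + (x * v)) (evS-+ (n ℕ.+ m) (λ i → a 0 * b (suc i)) ((a ∘ suc) ⊛ b) x) ⟩
    (a 0 * b 0) + (x * (evS (n ℕ.+ m) (λ i → a 0 * b (suc i)) x + evS (n ℕ.+ m) ((a ∘ suc) ⊛ b) x))
      ≡⟨ cong₂ (λ u v → (a 0 * b 0) + (x * (u + v)))
           (evS-scale (n ℕ.+ m) (a 0) (b ∘ suc) x)
           (evS-⊛ n m (λ i q → pa (suc i) (s≤s q)) pb x) ⟩
    (a 0 * b 0) + (x * ((a 0 * evS (n ℕ.+ m) (b ∘ suc) x) + (evS n (a ∘ suc) x * evS m b x)))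
      ≡⟨ solveᶠ 6 (λ a b x u v w → a :*ᶠ b :+ᶠ x :*ᶠ (a :*ᶠ u :+ᶠ v :*ᶠ w)
           :=ᶠ a :*ᶠ (b :+ᶠ x :*ᶠ u) :+ᶠ x :*ᶠ v :*ᶠ w) refl (a 0) (b 0) x _ _ _ ⟩
    (a 0 * evS (suc n ℕ.+ m) b x) + ((x * evS n (a ∘ suc) x) * evS m b x)
      ≡⟨ cong (λ v → (a 0 * v) + ((x * evS n (a ∘ suc) x) * evS m b x)) (evS-stable pb (ℕ.m≤n+m m (suc n)) x) ⟩
    (a 0 * evS m b x) + ((x * evS n (a ∘ suc) x) * evS m b x)
      ≡⟨ distribʳ _ _ _ ⟨
    (a 0 + (x * evS n (a ∘ suc) x)) * evS m b x ∎
    where open ≡-Reasoning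

  ⟦⊗⟧ : ∀ a b x → ⟦ a ⊗ b ⟧ x ≡ ⟦ a ⟧ x * ⟦ b ⟧ x
  ⟦⊗⟧ a b = evS-⊛ (bound a) (bound b) (finite a) (finite b)

  ⟦⊕⟧ : ∀ a b x → ⟦ a ⊕ b ⟧ x ≡ ⟦ a ⟧ x + ⟦ b ⟧ x
  ⟦⊕⟧ a b x = trans (evS-+ (bound a ℕ.+ bound b) (coef a) (coef b) x)
    (cong₂ _+_ (evS-stable (finite a) (ℕ.m≤m+n _ _) x)
               (evS-stable (finite b) (ℕ.m≤n+m (bound b) (bound a)) x))

  ⟦C⟧ : ∀ c x → ⟦ C c ⟧ x ≡ c
  ⟦C⟧ c x = trans (cong (c +_) (zeroʳ x)) (+-identityʳ c)

  ⟦X⟧ : ∀ x → ⟦ X ⟧ x ≡ x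
  ⟦X⟧ x = trans (+-identityˡ _) (trans (cong (x *_) (⟦C⟧ 1# x)) (*-identityʳ x))

  ⟦^⟧ : ∀ {a x} → ⟦ a ⟧ x ≡ 1# → ∀ n → ⟦ a ^ n ⟧ x ≡ 1#
  ⟦^⟧ {a} {x} h zero    = ⟦C⟧ 1# x
  ⟦^⟧ {a} {x} h (suc n) = trans (⟦⊗⟧ a (a ^ n) x)
    (trans (cong₂ _*_ h (⟦^⟧ {a} h n)) (*-identityˡ 1#))

  ⟦product⟧ : ∀ {n x} (a : Fin n → Poly) → (∀ i → ⟦ a i ⟧ x ≡ 1#) → ⟦ product a ⟧ x ≡ 1#
  ⟦product⟧ {zero}  {x} a h = ⟦C⟧ 1# x
  ⟦product⟧ {suc n} {x} a h = trans (⟦⊗⟧ (a zero) (product (a ∘ suc)) x)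
    (trans (cong₂ _*_ (h zero) (⟦product⟧ (a ∘ suc) (h ∘ suc))) (*-identityˡ 1#))

  ⟦product⟧-nonzero : ∀ {n x} (a : Fin n → Poly) → (∀ i → ⟦ a i ⟧ x ≢ 0#) → ⟦ product a ⟧ x ≢ 0#
  ⟦product⟧-nonzero {zero}  {x} a h eq = 0≢1 (sym (trans (sym (⟦C⟧ 1# x)) eq))
  ⟦product⟧-nonzero {suc n} {x} a h eq =
    *-nonzero (h zero) (⟦product⟧-nonzero (a ∘ suc) (h ∘ suc))
      (trans (sym (⟦⊗⟧ (a zero) (product (a ∘ suc)) x)) eq)

  X-_ : F → Poly
  X- x = X ⊕ C (- x)

  ⟦X-⟧ : ∀ x y → ⟦ X- x ⟧ y ≡ y + (- x)
  ⟦X-⟧ x y = trans (⟦⊕⟧ X (C (- x)) y) (cong₂ _+_ (⟦X⟧ y) (⟦C⟧ (- x) y))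

  X-hasDeg : ∀ x → HasDeg 1 (X- x)
  X-hasDeg x = (λ eq → 0≢1 (sym (trans (sym (+-identityʳ 1#)) eq))) ,
    λ { (suc zero) (s≤s ()) ; (suc (suc i)) _ → +-identityˡ 0# }

  X-≉𝟘 : ∀ x → ¬ (X- x) ≈ 𝟘
  X-≉𝟘 x = hasDeg≉𝟘 {a = X- x} (X-hasDeg x)

  C-⊕ : ∀ a b → C (a + b) ≈ C a ⊕ C b
  C-⊕ a b = mk≈ λ { zero → refl ; (suc n) → sym (+-identityˡ 0#) }

  C-⊗ : ∀ a b → C (a * b) ≈ C a ⊗ C b
  C-⊗ a b = mk≈ λ { zero → refl ; (suc n) → sym (trans (⊛-constantˡ a (constant b) (suc n)) (zeroʳ a)) }

  C-cong : ∀ {a b} → a ≡ b → C a ≈ C b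
  C-cong refl = ≈-refl

  tailᵖ : Poly → Poly
  tailᵖ a .coef i     = coef a (suc i)
  tailᵖ a .bound      = bound a
  tailᵖ a .finite i h = finite a (suc i) (ℕ.≤-trans h (ℕ.n≤1+n i))

  head+X⊗tail : ∀ a → a ≈ C (coef a 0) ⊕ X ⊗ tailᵖ a
  head+X⊗tail a = mk≈ λ
    { zero    → sym (trans (cong (_ +_) (zeroˡ _)) (+-identityʳ _))
    ; (suc n) → sym (trans (+-identityˡ _) (trans (cong₂ _+_ (zeroˡ _)
        (trans (⊛-constantˡ 1# (coef a ∘ suc) n) (*-identityˡ _))) (+-identityˡ _)))
    }

  abstract
    -- Synthetic division: divide the tail by X - x, then write the factor X in front of its
    -- remainder as (X - x) + x.
    remainder : ∀ n a → Below n a → ∀ x → ∃[ q ] a ≈ (X- x) ⊗ q ⊕ C (evS n (coef a) x)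
    remainder zero    a h x = 𝟘 , mk≈ λ i → trans (h i z≤n) (sym (at zeros i))
      where
      zeros : (X- x) ⊗ 𝟘 ⊕ C 0# ≈ 𝟘
      zeros = ≈-trans (⊕-cong (⊗-zeroʳ (X- x)) (mk≈ λ { zero → refl ; (suc _) → refl })) (⊕-identityˡ 𝟘)
    remainder (suc n) a h x with remainder n (tailᵖ a) (λ i q → h (suc i) (s≤s q)) x
    ... | q , a′≈ = X ⊗ q ⊕ C r , (begin
      a ≈⟨ head+X⊗tail a ⟩
      C (coef a 0) ⊕ X ⊗ a′ ≈⟨ ⊕-congˡ (⊗-congˡ {X} a′≈) ⟩
      C (coef a 0) ⊕ X ⊗ ((X- x) ⊗ q ⊕ C r)
        ≈⟨ solve 5 (λ A X L Q R → A :+ X :* (L :* Q :+ R)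
             := L :* (X :* Q) :+ X :* R :+ A) ≈-refl (C (coef a 0)) X (X- x) q (C r) ⟩
      (X- x) ⊗ (X ⊗ q) ⊕ X ⊗ C r ⊕ C (coef a 0)
        ≈⟨ ⊕-congʳ (⊕-congˡ {(X- x) ⊗ (X ⊗ q)} (⊗-congʳ {C r} X≈)) ⟩
      (X- x) ⊗ (X ⊗ q) ⊕ ((X- x) ⊕ C x) ⊗ C r ⊕ C (coef a 0)
        ≈⟨ solve 6 (λ A X L Q R x → L :* (X :* Q) :+ (L :+ x) :* R :+ A
             := L :* (X :* Q :+ R) :+ (A :+ x :* R)) ≈-refl
             (C (coef a 0)) X (X- x) q (C r) (C x) ⟩
      (X- x) ⊗ (X ⊗ q ⊕ C r) ⊕ (C (coef a 0) ⊕ C x ⊗ C r)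
        ≈⟨ ⊕-congˡ {(X- x) ⊗ (X ⊗ q ⊕ C r)} (≈-sym (≈-trans (C-⊕ _ _) (⊕-congˡ (C-⊗ x r)))) ⟩
      (X- x) ⊗ (X ⊗ q ⊕ C r) ⊕ C (coef a 0 + (x * r)) ∎)
      where
      open PR
      a′ : Poly
      a′ = tailᵖ a
      r : F
      r = evS n (coef a′) x
      X≈ : X ≈ (X- x) ⊕ C x
      X≈ = ≈-sym (≈-trans (mk≈ λ n → +-assoc _ _ _)
        (≈-trans (⊕-congˡ {X} (≈-trans (≈-sym (C-⊕ (- x) x))
          (mk≈ λ { zero → -‿inverseˡ x ; (suc _) → refl }))) (⊕-identityʳ X)))

  abstract
    root⇒factor : ∀ a x → ⟦ a ⟧ x ≡ 0# → ∃[ q ] a ≈ (X- x) ⊗ q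
    root⇒factor a x h with remainder (bound a) a (finite a) x
    ... | q , a≈ = q , ≈-trans a≈ (≈-trans
      (⊕-congˡ {(X- x) ⊗ q} (≈-trans (C-cong h) (mk≈ λ { zero → refl ; (suc _) → refl }))) (⊕-identityʳ _))

  -- The difference of the two linear polynomials is the nonzero constant y - x, and `z` is its
  -- inverse.
  X-comaximal : ∀ {x y} → x ≢ y → Comaximal (X- x) (X- y)
  X-comaximal {x} {y} x≢y with inverse (y + (- x)) (λ eq → x≢y (sym (x-y≡0⇒x≡y y x eq)))
  ... | z , eq = C z , ⊝ C z , (begin
    C z ⊗ (X ⊕ C (- x)) ⊕ (⊝ C z) ⊗ (X ⊕ C (- y))
      ≈⟨ solve 5 (λ z -z X -x -y → z :* (X :+ -x) :+ -z :* (X :+ -y)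
           := (z :+ -z) :* X :+ (-z :* -y :+ -x :* z)) ≈-refl
           (C z) (⊝ C z) X (C (- x)) (C (- y)) ⟩
    (C z ⊕ ⊝ C z) ⊗ X ⊕ ((⊝ C z) ⊗ C (- y) ⊕ C (- x) ⊗ C z)
      ≈⟨ ⊕-cong (≈-trans (⊗-congʳ {X} (⊝-inverseʳ (C z))) (⊗-zeroˡ X))
           (≈-trans (⊕-cong (≈-trans (⊗-congʳ {C (- y)} ⊝C) (≈-sym (C-⊗ _ _))) (≈-sym (C-⊗ _ _))) (≈-sym (C-⊕ _ _))) ⟩
    𝟘 ⊕ C (((- z) * (- y)) + ((- x) * z))
      ≈⟨ ⊕-identityˡ _ ⟩
    C (((- z) * (- y)) + ((- x) * z))
      ≈⟨ C-cong (trans (trans (cong (_+ ((- x) * z)) (trans (-x*-y≡x*y z y) (*-comm z y)))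
           (sym (distribʳ z y (- x)))) eq) ⟩
    𝟙 ∎)
    where
    open PR
    open import Algebra.Properties.Ring (CommutativeRing.ring baseRing)
      using (-‿distribˡ-*; -‿distribʳ-*; -‿involutive; -0#≈0#)
    -x*-y≡x*y : ∀ x y → (- x) * (- y) ≡ x * y
    -x*-y≡x*y x y = trans (sym (-‿distribˡ-* x (- y))) (trans (cong -_ (sym (-‿distribʳ-* x y))) (-‿involutive _))
    ⊝C : ⊝ C z ≈ C (- z)
    ⊝C = mk≈ λ { zero → refl ; (suc _) → -0#≈0# }

  -- X d/dX; unlike d/dX it fixes exponents, so lowest terms can be tracked.
  θ : Series → Series
  θ a n = n ×ᶠ a n

  -- On each term this is n = i + (n - i). Passing to the tail a′ lowers exponents by one, so the
  -- tail of θ a is a′ + θ a′; this absorbs the additional summand in the induction.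
  θ-⊛ : ∀ a b n → n ×ᶠ (a ⊛ b) n ≡ (θ a ⊛ b) n + (a ⊛ θ b) n
  θ-⊛ a b zero    = sym (trans (cong₂ _+_ (zeroˡ _) (zeroʳ _)) (+-identityˡ 0#))
  θ-⊛ a b (suc n) = begin
    suc n ×ᶠ ((a 0 * b (suc n)) + (a′ ⊛ b) n)
      ≡⟨ ×-distrib-+ _ _ (suc n) ⟩
    (suc n ×ᶠ (a 0 * b (suc n))) + ((a′ ⊛ b) n + (n ×ᶠ (a′ ⊛ b) n))
      ≡⟨ cong₂ (λ u v → u + ((a′ ⊛ b) n + v)) (sym (×-comm-* (suc n) (a 0) (b (suc n)))) (θ-⊛ a′ b n) ⟩
    (a 0 * θ b (suc n)) + ((a′ ⊛ b) n + ((θ a′ ⊛ b) n + (a′ ⊛ θ b) n))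
      ≡⟨ solveᶠ 4 (λ x y u v → x :+ᶠ (y :+ᶠ (u :+ᶠ v))
           :=ᶠ (y :+ᶠ u) :+ᶠ (x :+ᶠ v)) refl (a 0 * θ b (suc n)) ((a′ ⊛ b) n) _ _ ⟩
    ((a′ ⊛ b) n + (θ a′ ⊛ b) n) + ((a 0 * θ b (suc n)) + (a′ ⊛ θ b) n)
      ≡⟨ cong (_+ ((a 0 * θ b (suc n)) + (a′ ⊛ θ b) n)) (trans (sym (⊛-distribʳ b a′ (θ a′) n))
           (sym (trans (cong (_+ (((λ i → a′ i + θ a′ i)) ⊛ b) n) (zeroˡ (b (suc n)))) (+-identityˡ _)))) ⟩
    (θ a ⊛ b) (suc n) + (a ⊛ θ b) (suc n) ∎
    where
    open ≡-Reasoning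
    a′ : Series
    a′ = a ∘ suc

  ×ᶠ-zeroʳ : ∀ n → n ×ᶠ 0# ≡ 0#
  ×ᶠ-zeroʳ zero    = refl
  ×ᶠ-zeroʳ (suc n) = trans (+-identityˡ _) (×ᶠ-zeroʳ n)

  θ-below : ∀ n {a} → BelowS n a → BelowS n (θ a)
  θ-below n h i n≤i = trans (cong (i ×ᶠ_) (h i n≤i)) (×ᶠ-zeroʳ i)

  Θ : Poly → Poly
  Θ a .coef   = θ (coef a)
  Θ a .bound  = bound a
  Θ a .finite = θ-below (bound a) (finite a)

  Θ-cong : ∀ {a b} → a ≈ b → Θ a ≈ Θ b
  Θ-cong p = mk≈ λ n → cong (n ×ᶠ_) (at p n)

  Θ-⊗ : ∀ a b → Θ (a ⊗ b) ≈ Θ a ⊗ b ⊕ a ⊗ Θ b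
  Θ-⊗ a b = mk≈ (θ-⊛ (coef a) (coef b))

  Θ-⊕ : ∀ a b → Θ (a ⊕ b) ≈ Θ a ⊕ Θ b
  Θ-⊕ a b = mk≈ λ n → ×-distrib-+ (coef a n) (coef b n) n

  Θ-C : ∀ c → Θ (C c) ≈ 𝟘
  Θ-C c = mk≈ λ { zero → refl ; (suc n) → ×ᶠ-zeroʳ (suc n) }

  Θ-X : Θ X ≈ X
  Θ-X = mk≈ λ { zero → refl ; (suc zero) → +-identityʳ 1# ; (suc (suc n)) → ×ᶠ-zeroʳ (suc (suc n)) }

  Θ-^ : ∀ a n → Θ (a ^ suc n) ≈ (suc n · Θ a) ⊗ a ^ n
  Θ-^ a zero    = begin
    Θ (a ⊗ 𝟙) ≈⟨ Θ-cong (⊗-identityʳ a) ⟩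
    Θ a ≈⟨ ⊕-identityʳ (Θ a) ⟨
    Θ a ⊕ 𝟘 ≈⟨ ⊗-identityʳ _ ⟨
    (Θ a ⊕ 𝟘) ⊗ 𝟙 ∎
    where open PR
  Θ-^ a (suc n) = begin
    Θ (a ⊗ a ^ suc n) ≈⟨ Θ-⊗ a (a ^ suc n) ⟩
    Θ a ⊗ a ^ suc n ⊕ a ⊗ Θ (a ^ suc n) ≈⟨ ⊕-congˡ {Θ a ⊗ a ^ suc n} (⊗-congˡ {a} (Θ-^ a n)) ⟩
    Θ a ⊗ a ^ suc n ⊕ a ⊗ ((suc n · Θ a) ⊗ a ^ n)
      ≈⟨ solve 4 (λ T A N B → T :* (A :* B) :+ A :* (N :* B)
           := (T :+ N) :* (A :* B)) ≈-refl (Θ a) a (suc n · Θ a) (a ^ n) ⟩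
    (Θ a ⊕ suc n · Θ a) ⊗ a ^ suc n ∎
    where open PR

-- The pigeonhole principle for vectors and the least number principle

funToFin-cong : ∀ {m n} {f g : Fin m → Fin n} → f ≗ g → funToFin f ≡ funToFin g
funToFin-cong {zero}  h = refl
funToFin-cong {suc m} h = cong₂ combine (h zero) (funToFin-cong (h ∘ suc))

finToFun-injective : ∀ {m n} (k l : Fin (m ℕ.^ n)) → k ≢ l → ∃[ i ] finToFun {m} {n} k i ≢ finToFun l i
finToFun-injective {m} {n} k l k≢l =
  Fin.¬∀⟶∃¬ n _ (λ i → finToFun {m} {n} k i Fin.≟ finToFun l i) λ same →
    k≢l (trans (sym (Fin.funToFin-finToFin {n} {m} k))
          (trans (funToFin-cong same) (Fin.funToFin-finToFin {n} {m} l)))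

-- There are more vectors in the domain, q ^ (a b), than in the codomain, q ^ (c e).
collision : ∀ {q a b c e} → 1 < q → c ℕ.* e < a ℕ.* b →
  (φ : (Fin a → Fin b → Fin q) → Fin c → Fin e → Fin q) →
  ∃₂ λ v w → (∃₂ λ i j → v i j ≢ w i j) × (∀ i j → φ v i j ≡ φ w i j)
collision {q} {a} {b} {c} {e} 1<q ce<ab φ
  with Fin.pigeonhole (ℕ.^-monoʳ-< q 1<q ce<ab) (λ k → encode (φ (decode k)))
  where
  decode : Fin (q ℕ.^ (a ℕ.* b)) → Fin a → Fin b → Fin q
  decode k i j = finToFun k (combine i j)
  encode : (Fin c → Fin e → Fin q) → Fin (q ℕ.^ (c ℕ.* e))
  encode v = funToFin (λ l → uncurry v (remQuot e l))
... | k , l , k<l , eq with finToFun-injective {q} {a ℕ.* b} k l (Fin.<⇒≢ k<l)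
... | ij , differ = _ , _ , (proj₁ (remQuot {a} b ij) , proj₂ (remQuot {a} b ij) , differ′) , same
  where
  differ′ : _ ≢ _
  differ′ = subst (λ ij → finToFun {q} {a ℕ.* b} k ij ≢ finToFun l ij) (sym (Fin.combine-remQuot {a} b ij)) differ
  same : ∀ i j → _
  same i j = begin
    φ _ i j
      ≡⟨ cong (uncurry (φ _)) (Fin.remQuot-combine i j) ⟨
    uncurry (φ _) (remQuot e (combine i j))
      ≡⟨ Fin.finToFun-funToFin (λ l → uncurry (φ _) (remQuot e l)) (combine i j) ⟨
    finToFun (funToFin (λ l → uncurry (φ _) (remQuot e l))) (combine i j)
      ≡⟨ cong (λ x → finToFun {q} {c ℕ.* e} x (combine i j)) eq ⟩
    finToFun (funToFin (λ l → uncurry (φ _) (remQuot e l))) (combine i j)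
      ≡⟨ Fin.finToFun-funToFin (λ l → uncurry (φ _) (remQuot e l)) (combine i j) ⟩
    uncurry (φ _) (remQuot e (combine i j))
      ≡⟨ cong (uncurry (φ _)) (Fin.remQuot-combine i j) ⟩
    φ _ i j ∎
    where open ≡-Reasoning

abstract
  least : {P : ℕ → Set} → (∀ n → Dec (P n)) → ∀ n → P n → ∃[ m ] P m × (∀ i → i < m → ¬ P i)
  least P? zero    h = 0 , h , λ _ ()
  least {P} P? (suc n) h with P? 0
  ... | yes p0 = 0 , p0 , λ _ ()
  ... | no ¬p0 with least (P? ∘ suc) n h
  ... | m , pm , below = suc m , pm , λ { zero _ → ¬p0 ; (suc i) (s≤s i<m) → below i i<m }

-- Siegel's lemma and the number of multiple roots

module FinitePolynomials {p : ℕ} {_+_ _*_ : Op₂ (Fin p)} { -_ : Op₁ (Fin p)} {0# 1# : Fin p}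
  (isCommutativeRing : IsCommutativeRing _≡_ _+_ _*_ -_ 0# 1#)
  (0≢1 : 0# ≢ 1#) (inverse : ∀ x → x ≢ 0# → ∃[ y ] x * y ≡ 1#) where

  open FieldPolynomials isCommutativeRing Fin._≟_ 0≢1 inverse public
  open import Algebra.Properties.Semiring.Sum polySemiring public
    using (sum; sum-cong-≋; *-distribˡ-sum; *-distribʳ-sum; ∑-comm; sum-remove; sum-replicate-zero)
  open IsCommutativeRing isCommutativeRing
    using (-‿inverseʳ)
  open import Algebra.Properties.Ring (CommutativeRing.ring baseRing)
    using () renaming (x∙y⁻¹≈ε⇒x≈y to x-y≡0⇒x≡y; -0#≈0# to -0≡0)
  open import Algebra.Properties.AbelianGroup (CommutativeRing.+-abelianGroup polyRing)
    using () renaming (⁻¹-∙-comm to ⊝-⊕-comm; ε⁻¹≈ε to ⊝𝟘≈𝟘)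

  1<p : 1 < p
  1<p = lem 0# 1# 0≢1
    where
    lem : ∀ {p} (x y : Fin p) → x ≢ y → 1 < p
    lem {suc zero}    zero zero x≢y = ⊥-elim (x≢y refl)
    lem {suc (suc p)} _    _    _   = s≤s (s≤s z≤n)

  below-zero : ∀ n {a} → Below n a → (∀ i → i < n → coef a i ≡ 0#) → a ≈ 𝟘
  below-zero n h low = mk≈ λ i → go i (i ℕ.<? n)
    where
    go : ∀ i → Dec (i < n) → _
    go i (yes i<n) = low i i<n
    go i (no i≮n)  = h i (ℕ.≮⇒≥ i≮n)

  extend : ∀ {n} → (Fin n → Fin p) → Series
  extend {zero}  v i       = 0#
  extend {suc n} v zero    = v zero
  extend {suc n} v (suc i) = extend (v ∘ suc) i

  extend-below : ∀ {n} (v : Fin n → Fin p) → BelowS n (extend v)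
  extend-below {zero}  v i       h       = refl
  extend-below {suc n} v (suc i) (s≤s h) = extend-below (v ∘ suc) i h

  extend-toℕ : ∀ {n} (v : Fin n → Fin p) i → extend v (toℕ i) ≡ v i
  extend-toℕ v zero    = refl
  extend-toℕ v (suc i) = extend-toℕ (v ∘ suc) i

  fromCoefs : ∀ {n} → (Fin n → Fin p) → Poly
  fromCoefs v .coef       = extend v
  fromCoefs {n} v .bound  = n
  fromCoefs v .finite     = extend-below v

  sum-below : ∀ {n} m (a : Fin n → Poly) → (∀ i → Below m (a i)) → Below m (sum a)
  sum-below {zero}  m a h = λ _ _ → refl
  sum-below {suc n} m a h = ⊕-below m {a zero} {sum (a ∘ suc)} (h zero) (sum-below m (a ∘ suc) (h ∘ suc))

  ⊝-below : ∀ n {a} → Below n a → Below n (⊝ a)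
  ⊝-below n h i n≤i = trans (cong -_ (h i n≤i)) -0≡0

  sum-⊝ : ∀ {n} (a b : Fin n → Poly) → sum (λ i → a i ⊕ ⊝ b i) ≈ sum a ⊕ ⊝ sum b
  sum-⊝ {zero}  a b = ≈-sym (≈-trans (⊕-identityˡ (⊝ 𝟘)) ⊝𝟘≈𝟘)
  sum-⊝ {suc n} a b = begin
    a zero ⊕ ⊝ b zero ⊕ sum (λ i → a (suc i) ⊕ ⊝ b (suc i))
      ≈⟨ ⊕-congˡ {a zero ⊕ ⊝ b zero} (sum-⊝ (a ∘ suc) (b ∘ suc)) ⟩
    a zero ⊕ ⊝ b zero ⊕ (sum (a ∘ suc) ⊕ ⊝ sum (b ∘ suc))
      ≈⟨ solve 4 (λ x y z u → (x :+ y) :+ (z :+ u) := (x :+ z) :+ (y :+ u))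
           ≈-refl (a zero) (⊝ b zero) (sum (a ∘ suc)) (⊝ sum (b ∘ suc)) ⟩
    a zero ⊕ sum (a ∘ suc) ⊕ (⊝ b zero ⊕ ⊝ sum (b ∘ suc))
      ≈⟨ ⊕-congˡ {sum a} (⊝-⊕-comm (b zero) (sum (b ∘ suc))) ⟩
    sum a ⊕ ⊝ sum b ∎
    where open PR

  abstract
    -- Over a finite field the pigeonhole principle replaces elimination: two coefficient vectors
    -- with the same image differ by a solution. Hence only compatibility of `T` with differences is
    -- assumed. There are a polynomials with b free coefficients each, against c conditions on e
    -- coefficients each.
    siegel : ∀ {a c} b e → c ℕ.* e < a ℕ.* b → (T : Fin a → Fin c → Poly → Poly) →
      (∀ k i x y → T k i (x ⊕ ⊝ y) ≈ T k i x ⊕ ⊝ T k i y) →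
      Σ[ P ∈ (Fin a → Poly) ] (∀ k → Below b (P k)) × (Σ[ k ∈ Fin a ] ¬ P k ≈ 𝟘) ×
        (∀ i j → j < e → coef (sum (λ k → T k i (P k))) j ≡ 0#)
    siegel {a} {c} b e ce<ab T T-sub
      with collision 1<p ce<ab (λ v i j → coef (sum (λ k → T k i (fromCoefs (v k)))) (toℕ j))
    ... | v , w , (k , l , differ) , same = P , below , (k , nonzero) , vanish
      where
      P : Fin a → Poly
      P k = fromCoefs (v k) ⊕ ⊝ fromCoefs (w k)
      below : ∀ k → Below b (P k)
      below k = ⊕-below b {fromCoefs (v k)} {⊝ fromCoefs (w k)} (extend-below (v k))
        (⊝-below b {fromCoefs (w k)} (extend-below (w k)))
      nonzero : ¬ P k ≈ 𝟘
      nonzero eq = differ (trans (sym (extend-toℕ (v k) l)) (trans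
        (x-y≡0⇒x≡y _ _ (at eq (toℕ l))) (extend-toℕ (w k) l)))
      vanish : ∀ i j → j < e → coef (sum (λ k → T k i (P k))) j ≡ 0#
      vanish i j j<e = begin
        coef (sum (λ k → T k i (P k))) j
          ≡⟨ at (≈-trans (sum-cong-≋ (λ k → T-sub k i (fromCoefs (v k)) (fromCoefs (w k))))
               (sum-⊝ (λ k → T k i (fromCoefs (v k))) (λ k → T k i (fromCoefs (w k))))) j ⟩
        coef (sum (λ k → T k i (fromCoefs (v k)))) j + (- coef (sum (λ k → T k i (fromCoefs (w k)))) j)
          ≡⟨ cong (λ n → coef (sum (λ k → T k i (fromCoefs (v k)))) n + (- coef (sum (λ k → T k i (fromCoefs (w k)))) n))
               (Fin.toℕ-fromℕ< j<e) ⟨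
        _ + (- coef (sum (λ k → T k i (fromCoefs (w k)))) (toℕ (fromℕ< j<e)))
          ≡⟨ cong (_+ (- coef (sum (λ k → T k i (fromCoefs (w k)))) (toℕ (fromℕ< j<e)))) (same i (fromℕ< j<e)) ⟩
        _ + (- _)
          ≡⟨ -‿inverseʳ _ ⟩
        0# ∎
        where open ≡-Reasoning

  abstract
    -- Dividing out `(X- x) ^ M` preserves divisibility by the powers belonging to the other points,
    -- because these are comaximal to it. So each point consumes M from the degree.
    roots-bound : ∀ M n xs a → Unique xs → (∀ {x} → x List.∈ xs → (X- x) ^ M ∣ a) →
                  ¬ a ≈ 𝟘 → Below n a → M ℕ.* length xs < n
    roots-bound M n [] a uniq h a≉0 a-below with degree a
    ... | inj₁ a≈0     = ⊥-elim (a≉0 a≈0)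
    ... | inj₂ (k , d) = subst (_< n) (sym (ℕ.*-zeroʳ M))
      (ℕ.≤-<-trans z≤n (hasDeg-below {a = a} d a-below))
    roots-bound M n (x ∷ xs) a (x∉xs ∷ uniq) h a≉0 a-below with h (here refl)
    ... | q , q⊗≈a with degree q
    ... | inj₁ q≈0     = ⊥-elim (a≉0 (≈-trans (≈-sym q⊗≈a) (≈-trans (⊗-congʳ {(X- x) ^ M} q≈0) (⊗-zeroˡ ((X- x) ^ M)))))
    ... | inj₂ (k , d) = begin-strict
      M ℕ.* suc (length xs) ≡⟨ ℕ.*-suc M (length xs) ⟩
      M ℕ.+ M ℕ.* length xs ≤⟨ ℕ.+-monoʳ-≤ M (ℕ.s≤s⁻¹ ih) ⟩
      M ℕ.+ k ≡⟨ ℕ.+-comm M k ⟩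
      k ℕ.+ M ≡⟨ cong (k ℕ.+_) (ℕ.*-identityʳ M) ⟨
      k ℕ.+ M ℕ.* 1 <⟨ hasDeg-below {a = a} a-deg a-below ⟩
      n ∎
      where
      open ℕ.≤-Reasoning
      a-deg : HasDeg (k ℕ.+ M ℕ.* 1) a
      a-deg = hasDeg-≈ {a = q ⊗ (X- x) ^ M} q⊗≈a
        (hasDeg-⊗ {a = q} {(X- x) ^ M} d (hasDeg-^ {a = X- x} (X-hasDeg x) M))
      ih : M ℕ.* length xs < suc k
      ih = roots-bound M (suc k) xs q uniq
        (λ {y} y∈xs → comaximal-∣ (comaximal-^^ (X-comaximal (λ y≡x → All.lookup x∉xs y∈xs (sym y≡x))) M M)
          (let (r , eq) = h (there y∈xs) in r , ≈-trans eq (≈-sym q⊗≈a)))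
        (hasDeg≉𝟘 {a = q} d) (proj₂ d)

-- Differential operators: conjugation, indicial polynomial, multiplicities

module Stepanov {p : ℕ} {_+_ _*_ : Op₂ (Fin p)} { -_ : Op₁ (Fin p)} {0# 1# : Fin p}
  (isCommutativeRing : IsCommutativeRing _≡_ _+_ _*_ -_ 0# 1#)
  (0≢1 : 0# ≢ 1#) (inverse : ∀ x → x ≢ 0# → ∃[ y ] x * y ≡ 1#) where

  open FinitePolynomials isCommutativeRing 0≢1 inverse public
  open IsCommutativeRing isCommutativeRing
    hiding (refl; sym; trans; reflexive; isEquivalence; setoid; zero)
  open import Algebra.Properties.Semiring.Mult (CommutativeRing.semiring baseRing)
    using () renaming (×-homo-+ to ×ᶠ-homo-+)
  open import Algebra.Properties.Ring polyRing′
    using () renaming (-‿distribˡ-* to ⊝-distribˡ-⊗)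
  open import Algebra.Properties.Group (CommutativeRing.+-group polyRing)
    using () renaming (inverseˡ-unique to ⊝-unique)

  module Derivation (g : Poly) where

    -- The conjugate of D by a solution `h` of D h = e h: formally δ e a is D (a h) / h. The factor
    -- `g` clears the denominator of Θ h / h, so everything stays polynomial.
    δ : Poly → Poly → Poly
    δ e a = g ⊗ Θ a ⊕ e ⊗ a

    D : Poly → Poly
    D a = g ⊗ Θ a

    D-cong : ∀ {a b} → a ≈ b → D a ≈ D b
    D-cong a≈b = ⊗-congˡ {g} (Θ-cong a≈b)

    D-⊕ : ∀ a b → D (a ⊕ b) ≈ D a ⊕ D b
    D-⊕ a b = ≈-trans (⊗-congˡ {g} (Θ-⊕ a b)) (⊗-distribˡ g (Θ a) (Θ b))

    D-C⊗ : ∀ c a → D (C c ⊗ a) ≈ C c ⊗ D a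
    D-C⊗ c a = begin
      g ⊗ Θ (C c ⊗ a) ≈⟨ ⊗-congˡ {g} (Θ-⊗ (C c) a) ⟩
      g ⊗ (Θ (C c) ⊗ a ⊕ C c ⊗ Θ a) ≈⟨ ⊗-congˡ {g} (⊕-congʳ {C c ⊗ Θ a} (≈-trans (⊗-congʳ {a} (Θ-C c)) (⊗-zeroˡ a))) ⟩
      g ⊗ (𝟘 ⊕ C c ⊗ Θ a) ≈⟨ ⊗-congˡ {g} (⊕-identityˡ (C c ⊗ Θ a)) ⟩
      g ⊗ (C c ⊗ Θ a) ≈⟨ solve 3 (λ x y z → x :* (y :* z) := y :* (x :* z)) ≈-refl g (C c) (Θ a) ⟩
      C c ⊗ D a ∎
      where open PR

    iterD-cong : ∀ n {a b} → a ≈ b → iterate D a n ≈ iterate D b n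
    iterD-cong zero    h = h
    iterD-cong (suc n) h = iterD-cong n (D-cong h)

    iterD-⊕ : ∀ n a b → iterate D (a ⊕ b) n ≈ iterate D a n ⊕ iterate D b n
    iterD-⊕ zero    a b = ≈-refl
    iterD-⊕ (suc n) a b = ≈-trans (iterD-cong n (D-⊕ a b)) (iterD-⊕ n (D a) (D b))

    iterD-C⊗ : ∀ n c a → iterate D (C c ⊗ a) n ≈ C c ⊗ iterate D a n
    iterD-C⊗ zero    c a = ≈-refl
    iterD-C⊗ (suc n) c a = ≈-trans (iterD-cong n (D-C⊗ c a)) (iterD-C⊗ n c (D a))

    D-𝟘 : D 𝟘 ≈ 𝟘
    D-𝟘 = ≈-trans (⊗-congˡ {g} (mk≈ ×ᶠ-zeroʳ)) (⊗-zeroʳ g)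

    iterD-𝟘 : ∀ n → iterate D 𝟘 n ≈ 𝟘
    iterD-𝟘 zero    = ≈-refl
    iterD-𝟘 (suc n) = ≈-trans (iterD-cong n D-𝟘) (iterD-𝟘 n)

    iterD-sum : ∀ {m} n (a : Fin m → Poly) → iterate D (sum a) n ≈ sum (λ k → iterate D (a k) n)
    iterD-sum {zero}  n a = iterD-𝟘 n
    iterD-sum {suc m} n a = ≈-trans (iterD-⊕ n (a zero) (sum (a ∘ suc)))
      (⊕-congˡ {iterate D (a zero) n} (iterD-sum n (a ∘ suc)))

    δ-cong : ∀ e {a b} → a ≈ b → δ e a ≈ δ e b
    δ-cong e a≈b = ⊕-cong (D-cong a≈b) (⊗-congˡ {e} a≈b)

    δ-⊕ : ∀ e a b → δ e (a ⊕ b) ≈ δ e a ⊕ δ e b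
    δ-⊕ e a b = ≈-trans (⊕-cong (D-⊕ a b) (⊗-distribˡ e a b))
      (solve 4 (λ x y u v → (x :+ y) :+ (u :+ v) := (x :+ u) :+ (y :+ v))
        ≈-refl (D a) (D b) (e ⊗ a) (e ⊗ b))

    iterδ-cong : ∀ e n {a b} → a ≈ b → iterate (δ e) a n ≈ iterate (δ e) b n
    iterδ-cong e zero    h = h
    iterδ-cong e (suc n) h = iterδ-cong e n (δ-cong e h)

    iterδ-⊕ : ∀ e n a b → iterate (δ e) (a ⊕ b) n ≈ iterate (δ e) a n ⊕ iterate (δ e) b n
    iterδ-⊕ e zero    a b = ≈-refl
    iterδ-⊕ e (suc n) a b = ≈-trans (iterδ-cong e n (δ-⊕ e a b)) (iterδ-⊕ e n (δ e a) (δ e b))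

    iterδ-𝟘 : ∀ e n → iterate (δ e) 𝟘 n ≈ 𝟘
    iterδ-𝟘 e zero    = ≈-refl
    iterδ-𝟘 e (suc n) = ≈-trans (iterδ-cong e n
      (≈-trans (⊕-cong D-𝟘 (⊗-zeroʳ e)) (⊕-identityˡ 𝟘))) (iterδ-𝟘 e n)

    iterδ-⊝ : ∀ e n a b → iterate (δ e) (a ⊕ ⊝ b) n ≈ iterate (δ e) a n ⊕ ⊝ iterate (δ e) b n
    iterδ-⊝ e n a b = ≈-trans (iterδ-⊕ e n a (⊝ b)) (⊕-congˡ {iterate (δ e) a n}
      (⊝-unique (iterate (δ e) (⊝ b) n) (iterate (δ e) b n)
        (≈-trans (≈-sym (iterδ-⊕ e n (⊝ b) b))
          (≈-trans (iterδ-cong e n (⊝-inverseˡ b)) (iterδ-𝟘 e n)))))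

    δ-below : ∀ {d n e a} → Below (suc d) g → Below (suc d) e → Below n a → Below (n ℕ.+ d) (δ e a)
    δ-below {d} {n} {e} {a} hg he ha = ⊕-below (n ℕ.+ d) {g ⊗ Θ a} {e ⊗ a}
      (below-≈ {n ℕ.+ d} (⊗-comm (Θ a) g) (⊗-below n d {Θ a} {g} (θ-below n ha) hg))
      (below-≈ {n ℕ.+ d} (⊗-comm a e) (⊗-below n d {a} {e} ha he))

    iterδ-below : ∀ {d n e} → Below (suc d) g → Below (suc d) e → ∀ k {a} → Below n a →
                  Below (n ℕ.+ k ℕ.* d) (iterate (δ e) a k)
    iterδ-below {n = n} hg he zero    {a} ha = subst (λ m → Below m a) (sym (ℕ.+-identityʳ n)) ha
    iterδ-below {d} {n} {e} hg he (suc k) {a} ha = subst (λ m → Below m (iterate (δ e) a (suc k)))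
      (ℕ.+-assoc n d (k ℕ.* d)) (iterδ-below {n = n ℕ.+ d} hg he k {δ e a} (δ-below {n = n} {e = e} {a = a} hg he ha))

    D-⊗ : ∀ {e h} → D h ≈ e ⊗ h → ∀ a → D (a ⊗ h) ≈ δ e a ⊗ h
    D-⊗ {e} {h} eig a = begin
      g ⊗ Θ (a ⊗ h) ≈⟨ ⊗-congˡ {g} (Θ-⊗ a h) ⟩
      g ⊗ (Θ a ⊗ h ⊕ a ⊗ Θ h) ≈⟨ solve 5 (λ g ta h a th → g :* (ta :* h :+ a :* th)
                                          := g :* ta :* h :+ a :* (g :* th)) ≈-refl g (Θ a) h a (Θ h) ⟩
      g ⊗ Θ a ⊗ h ⊕ a ⊗ (g ⊗ Θ h) ≈⟨ ⊕-congˡ {g ⊗ Θ a ⊗ h} (⊗-congˡ {a} eig) ⟩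
      g ⊗ Θ a ⊗ h ⊕ a ⊗ (e ⊗ h) ≈⟨ solve 4 (λ x h a e → x :* h :+ a :* (e :* h)
                                          := (x :+ e :* a) :* h) ≈-refl (g ⊗ Θ a) h a e ⟩
      δ e a ⊗ h ∎
      where open PR

    iterD-⊗ : ∀ {e h} → D h ≈ e ⊗ h → ∀ n a → iterate D (a ⊗ h) n ≈ iterate (δ e) a n ⊗ h
    iterD-⊗ eig zero    a = ≈-refl
    iterD-⊗ {e} eig (suc n) a = ≈-trans (iterD-cong n (D-⊗ eig a)) (iterD-⊗ eig n (δ e a))

    module _ {m : ℕ} (q : Fin m → Poly) where

      operator : Poly → Poly
      operator a = sum (λ l → q l ⊗ iterate D a (toℕ l))

      operator-cong : ∀ {a b} → a ≈ b → operator a ≈ operator b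
      operator-cong h = sum-cong-≋ (λ l → ⊗-congˡ {q l} (iterD-cong (toℕ l) h))

      operator-𝟘 : operator 𝟘 ≈ 𝟘
      operator-𝟘 = ≈-trans (sum-cong-≋ (λ l → ≈-trans (⊗-congˡ {q l} (iterD-𝟘 (toℕ l))) (⊗-zeroʳ (q l))))
        (sum-replicate-zero m)

      operator-sum : ∀ {n} (a : Fin n → Poly) → operator (sum a) ≈ sum (operator ∘ a)
      operator-sum {n} a = ≈-trans (sum-cong-≋ (λ l → ≈-trans (⊗-congˡ {q l} (iterD-sum (toℕ l) a))
          (*-distribˡ-sum (q l) (λ k → iterate D (a k) (toℕ l)))))
        (∑-comm {m} {n} (λ l k → q l ⊗ iterate D (a k) (toℕ l)))

      operator-C⊗ : ∀ c a → operator (C c ⊗ a) ≈ C c ⊗ operator a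
      operator-C⊗ c a = ≈-trans (sum-cong-≋ (λ l → ≈-trans (⊗-congˡ {q l} (iterD-C⊗ (toℕ l) c a))
          (solve 3 (λ x y z → x :* (y :* z) := y :* (x :* z)) ≈-refl (q l) (C c) (iterate D a (toℕ l)))))
        (≈-sym (*-distribˡ-sum (C c) (λ l → q l ⊗ iterate D a (toℕ l))))

      operator-⊗ : ∀ {e h} → D h ≈ e ⊗ h → ∀ a →
                   operator (a ⊗ h) ≈ sum (λ l → q l ⊗ iterate (δ e) a (toℕ l)) ⊗ h
      operator-⊗ {e} {h} eig a = ≈-trans (sum-cong-≋ (λ l → ≈-trans (⊗-congˡ {q l} (iterD-⊗ eig (toℕ l) a))
          (≈-sym (⊗-assoc (q l) (iterate (δ e) a (toℕ l)) h))))
        (≈-sym (*-distribʳ-sum h (λ l → q l ⊗ iterate (δ e) a (toℕ l))))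

  C⊗-below : ∀ n c {a} → Below n a → Below n (C c ⊗ a)
  C⊗-below n c {a} h i n≤i = trans (⊛-constantˡ c (coef a) i) (trans (cong (c *_) (h i n≤i)) (zeroʳ c))

  -- Fewer linear conditions than scalars. Taking b = e = 1 in `siegel` makes the unknown
  -- polynomials constants, and each condition is packed into a constant polynomial.
  vanishing-combination : ∀ {m} (ns : List ℕ) → length ns < m → (w : Fin m → Poly) →
    Σ[ c ∈ (Fin m → Fin p) ] (Σ[ k ∈ Fin m ] c k ≢ 0#) × (∀ {n} → n List.∈ ns → coef (sum (λ k → C (c k) ⊗ w k)) n ≡ 0#)
  vanishing-combination {m} ns few w = c , (k₀ , c≢0) , W-vanish
    where
    T : Fin m → Fin (length ns) → Poly → Poly
    T k i a = C (coef (a ⊗ w k) (List.lookup ns i))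
    T-sub : ∀ k i x y → T k i (x ⊕ ⊝ y) ≈ T k i x ⊕ ⊝ T k i y
    T-sub k i x y = mk≈ λ
      { zero    → at (≈-trans (⊗-distribʳ (w k) x (⊝ y)) (⊕-congˡ {x ⊗ w k} (≈-sym (⊝-distribˡ-⊗ y (w k))))) (List.lookup ns i)
      ; (suc _) → sym (-‿inverseʳ 0#) }
    solution = siegel 1 1 (subst₂ _<_ (sym (ℕ.*-identityʳ _)) (sym (ℕ.*-identityʳ _)) few) T T-sub
    P : Fin m → Poly
    P = proj₁ solution
    k₀ : Fin m
    k₀ = proj₁ (proj₁ (proj₂ (proj₂ solution)))
    c : Fin m → Fin p
    c k = coef (P k) 0
    P≈C : ∀ k → P k ≈ C (c k)
    P≈C k = mk≈ λ { zero → refl ; (suc i) → proj₁ (proj₂ solution) k (suc i) (s≤s z≤n) }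
    c≢0 : c k₀ ≢ 0#
    c≢0 eq = proj₂ (proj₁ (proj₂ (proj₂ solution))) (≈-trans (P≈C k₀) (≈-trans (C-cong eq) (mk≈ λ { zero → refl ; (suc _) → refl })))
    coef-sum-C : ∀ {n} (a : Fin n → Poly) j →
                 coef (sum (λ k → C (coef (a k) j))) 0 ≡ coef (sum a) j
    coef-sum-C {zero}  a j = refl
    coef-sum-C {suc n} a j = cong (coef (a zero) j +_) (coef-sum-C (a ∘ suc) j)
    W-vanish : ∀ {n} → n List.∈ ns → coef (sum (λ k → C (c k) ⊗ w k)) n ≡ 0#
    W-vanish {n} n∈ = begin
      coef (sum (λ k → C (c k) ⊗ w k)) n
        ≡⟨ at (sum-cong-≋ (λ k → ⊗-congʳ {w k} (P≈C k))) n ⟨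
      coef (sum (λ k → P k ⊗ w k)) n
        ≡⟨ coef-sum-C (λ k → P k ⊗ w k) n ⟨
      coef (sum (λ k → C (coef (P k ⊗ w k) n))) 0
        ≡⟨ cong (λ j → coef (sum (λ k → C (coef (P k ⊗ w k) j))) 0) (Any.lookup-index n∈) ⟩
      coef (sum (λ k → C (coef (P k ⊗ w k) (List.lookup ns (index n∈))))) 0
        ≡⟨ proj₂ (proj₂ (proj₂ solution)) (index n∈) 0 (s≤s z≤n) ⟩
      0# ∎
      where open ≡-Reasoning

  LowVanish : ℕ → Series → Set
  LowVanish n a = ∀ i → i < n → a i ≡ 0#

  abstract
    -- `s` is the least X-adic order among the coefficients of the operator. Their coefficients at X
    -- ^ s make up the indicial polynomial, which is therefore not zero.
    common-order : ∀ {m} (q : Fin m → Poly) → ∃[ l ] ¬ q l ≈ 𝟘 →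
      Σ[ s ∈ ℕ ] (Σ[ l ∈ Fin m ] coef (q l) s ≢ 0#) × (∀ l → LowVanish s (coef (q l)))
    common-order {m} q (l₀ , q≉0) with degree (q l₀)
    ... | inj₁ q≈0 = ⊥-elim (q≉0 q≈0)
    ... | inj₂ (n₀ , qn₀≢0 , _) =
      let (s , nonzero , lower) = least (λ n → Fin.any? (λ l → ¬? (coef (q l) n Fin.≟ 0#))) n₀ (l₀ , qn₀≢0)
      in s , nonzero , λ l i i<s → decidable-stable (coef (q l) i Fin.≟ 0#) (λ ne → lower i i<s (l , ne))

  ⊛-low : ∀ n a b → LowVanish n b → LowVanish n (a ⊛ b)
  ⊛-low n       a b h zero    0<n = trans (cong (a 0 *_) (h 0 0<n)) (zeroʳ _)
  ⊛-low n       a b h (suc i) i<n = trans (cong₂ _+_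
    (trans (cong (a 0 *_) (h (suc i) i<n)) (zeroʳ _)) (⊛-low n (a ∘ suc) b h i (ℕ.<-trans (ℕ.n<1+n i) i<n)))
    (+-identityˡ 0#)

  ⊛-lowest : ∀ s n a b → LowVanish s a → LowVanish n b → (a ⊛ b) (s ℕ.+ n) ≡ a s * b n
  ⊛-lowest zero    zero    a b ha hb = refl
  ⊛-lowest zero    (suc n) a b ha hb = trans
    (cong ((a 0 * b (suc n)) +_) (⊛-low (suc n) (a ∘ suc) b hb n (ℕ.n<1+n n))) (+-identityʳ _)
  ⊛-lowest (suc s) n a b ha hb = trans (cong₂ _+_
    (trans (cong (_* b (suc (s ℕ.+ n))) (ha 0 (s≤s z≤n))) (zeroˡ _))
    (⊛-lowest s n (a ∘ suc) b (λ i i<s → ha (suc i) (s≤s i<s)) hb)) (+-identityˡ _)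

  -- `iterate (y *_) c l` is y ^ l c, so the sum is, in Horner form, the polynomial with
  -- coefficients `v` evaluated at `y`, times `c`. This is how the indicial polynomial arises.
  coef-sum : ∀ {m} (a : Fin m → Poly) (v : Fin m → Fin p) n → ∀ y c →
    (∀ l → coef (a l) n ≡ v l * iterate (y *_) c (toℕ l)) →
    coef (sum a) n ≡ evS m (extend v) y * c
  coef-sum {zero}  a v n y c h = sym (zeroˡ c)
  coef-sum {suc m} a v n y c h = trans
    (cong₂ _+_ (h zero) (coef-sum (a ∘ suc) (v ∘ suc) n y (y * c) (h ∘ suc)))
    (solveᶠ 4 (λ v c y e → v :*ᶠ c :+ᶠ e :*ᶠ (y :*ᶠ c) :=ᶠ (v :+ᶠ y :*ᶠ e) :*ᶠ c)
      refl (v zero) c y (evS m (extend (v ∘ suc)) y))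

  module Characteristic (char : ∀ n → 0 < n → n < p → n ×ᶠ 1# ≢ 0#) where

    ×1-distinct : ∀ {m n} → m < n → n < p → m ×ᶠ 1# ≢ n ×ᶠ 1#
    ×1-distinct {m} {n} m<n n<p eq = char (n ℕ.∸ m) (ℕ.m<n⇒0<n∸m m<n) (ℕ.≤-<-trans (ℕ.m∸n≤m n m) n<p) (begin
      d ×ᶠ 1#
        ≡⟨ +-identityʳ _ ⟨
      (d ×ᶠ 1#) + 0#
        ≡⟨ cong ((d ×ᶠ 1#) +_) (-‿inverseʳ (m ×ᶠ 1#)) ⟨
      (d ×ᶠ 1#) + ((m ×ᶠ 1#) + (- (m ×ᶠ 1#)))
        ≡⟨ +-assoc _ _ _ ⟨
      ((d ×ᶠ 1#) + (m ×ᶠ 1#)) + (- (m ×ᶠ 1#))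
        ≡⟨ cong (_+ (- (m ×ᶠ 1#))) (×ᶠ-homo-+ 1# d m) ⟨
      ((d ℕ.+ m) ×ᶠ 1#) + (- (m ×ᶠ 1#))
        ≡⟨ cong (λ k → (k ×ᶠ 1#) + (- (m ×ᶠ 1#))) (ℕ.m∸n+n≡m (ℕ.<⇒≤ m<n)) ⟩
      (n ×ᶠ 1#) + (- (m ×ᶠ 1#))
        ≡⟨ cong (_+ (- (m ×ᶠ 1#))) eq ⟨
      (m ×ᶠ 1#) + (- (m ×ᶠ 1#))
        ≡⟨ -‿inverseʳ _ ⟩
      0# ∎)
      where
      open ≡-Reasoning
      d : ℕ
      d = n ℕ.∸ m

    ×-nonzero : ∀ n {x} → 0 < n → n < p → x ≢ 0# → n ×ᶠ x ≢ 0#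
    ×-nonzero n {x} 0<n n<p x≢0 eq = *-nonzero (char n 0<n n<p) x≢0
      (trans (×-assoc-* n 1# x) (trans (×-congʳ n (*-identityˡ x)) eq))

    ⟦·⟧ : ∀ n a x → ⟦ n · a ⟧ x ≡ n ×ᶠ ⟦ a ⟧ x
    ⟦·⟧ zero    a x = refl
    ⟦·⟧ (suc n) a x = trans (⟦⊕⟧ a (n · a) x) (cong (⟦ a ⟧ x +_) (⟦·⟧ n a x))

    module _ (g : Poly) where
      open Derivation g

      -- The lowest coefficient of a solution w of Σ qₗ Dˡ w = 0, at exponent n, is killed
      -- by the indicial polynomial evaluated at y = g(0) n.
      module _ (g₀≢0 : coef g 0 ≢ 0#) where

        indicial-root : ℕ → Fin p
        indicial-root n = coef g 0 * (n ×ᶠ 1#)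

        D-low : ∀ n a → LowVanish n (coef a) → LowVanish n (coef (D a))
        D-low n a h = ⊛-low n (coef g) (θ (coef a)) (λ i i<n → trans (×-congʳ i (h i i<n)) (×ᶠ-zeroʳ i))

        D-lowest : ∀ n a → LowVanish n (coef a) → coef (D a) n ≡ indicial-root n * coef a n
        D-lowest n a h = trans (⊛-lowest 0 n (coef g) (θ (coef a)) (λ _ ())
            (λ i i<n → trans (×-congʳ i (h i i<n)) (×ᶠ-zeroʳ i)))
          (trans (cong (coef g 0 *_) (sym (trans (×-assoc-* n 1# (coef a n)) (×-congʳ n (*-identityˡ _)))))
            (sym (*-assoc _ _ _)))

        iterD-low : ∀ n k a → LowVanish n (coef a) → LowVanish n (coef (iterate D a k))
        iterD-low n zero    a h = h
        iterD-low n (suc k) a h = iterD-low n k (D a) (D-low n a h)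

        iterD-lowest : ∀ n k a → LowVanish n (coef a) →
                       coef (iterate D a k) n ≡ iterate (indicial-root n *_) (coef a n) k
        iterD-lowest n zero    a h = refl
        iterD-lowest n (suc k) a h = trans (iterD-lowest n k (D a) (D-low n a h))
          (cong (λ c → iterate (indicial-root n *_) c k) (D-lowest n a h))

        abstract
          -- The map n ↦ g(0) n is injective on exponents below p, so these exponents inject into
          -- the roots of a nonzero polynomial of degree below m.
          few-roots : ∀ {m} (v : Fin m → Fin p) (l : Fin m) → v l ≢ 0# →
            Σ[ ns ∈ List ℕ ] length ns < m ×
              (∀ {n} → n < p → evS m (extend v) (indicial-root n) ≡ 0# → n List.∈ ns)
          few-roots {m} v l vl≢0 = ns , few , λ n<p → ∈-filter⁺ root? (∈-upTo⁺ n<p)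
            where
            I : Poly
            I = fromCoefs v
            root? : ∀ n → Dec (⟦ I ⟧ (indicial-root n) ≡ 0#)
            root? n = ⟦ I ⟧ (indicial-root n) Fin.≟ 0#
            ns : List ℕ
            ns = List.filter root? (List.upTo p)
            *-cancelˡ : ∀ {x y z} → x ≢ 0# → x * y ≡ x * z → y ≡ z
            *-cancelˡ {x} {y} {z} x≢0 eq with inverse x x≢0
            ... | x⁻¹ , inv = begin
              y ≡⟨ *-identityˡ y ⟨
              1# * y ≡⟨ cong (_* y) inv ⟨
              (x * x⁻¹) * y ≡⟨ solveᶠ 3 (λ x i y → x :*ᶠ i :*ᶠ y :=ᶠ i :*ᶠ (x :*ᶠ y)) refl x x⁻¹ y ⟩
              x⁻¹ * (x * y) ≡⟨ cong (x⁻¹ *_) eq ⟩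
              x⁻¹ * (x * z) ≡⟨ solveᶠ 3 (λ x i y → x :*ᶠ i :*ᶠ y :=ᶠ i :*ᶠ (x :*ᶠ y)) refl x x⁻¹ z ⟨
              (x * x⁻¹) * z ≡⟨ cong (_* z) inv ⟩
              1# * z ≡⟨ *-identityˡ z ⟩
              z ∎
              where open ≡-Reasoning
            distinct : Unique (List.map indicial-root ns)
            distinct = AllPairs.map⁺ (AllPairs.filter⁺ root? (AllPairs.applyUpTo⁺₁ (λ n → n) p
              λ {i} {j} i<j j<p eq → ×1-distinct i<j j<p (*-cancelˡ g₀≢0 eq)))
            few : length ns < m
            few = subst (_< m) (trans (ℕ.*-identityˡ _) (length-map indicial-root ns))
              (roots-bound 1 m (List.map indicial-root ns) I distinct
                (λ x∈ → let (n , n∈ , x≡) = ∈-map⁻ indicial-root x∈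
                            (Q , I≈) = root⇒factor I _ (trans (cong ⟦ I ⟧ x≡) (proj₂ (∈-filter⁻ root? {xs = List.upTo p} n∈)))
                        in Q , ≈-trans (⊗-congˡ {Q} (⊗-identityʳ (X- _))) (≈-trans (⊗-comm Q (X- _)) (≈-sym I≈)))
                (λ eq → vl≢0 (trans (sym (extend-toℕ v l)) (at eq (toℕ l)))) (extend-below v))

        -- Instead of computing dimensions, a nontrivial combination W is chosen in advance whose
        -- coefficients vanish at all exponents allowed by the indicial polynomial. It is still
        -- killed and of degree below p, so if it were not zero its lowest exponent would be one of
        -- those.
        operator-dependence : ∀ {m} (q : Fin m → Poly) → ∃[ l ] ¬ q l ≈ 𝟘 →
          (w : Fin m → Poly) → (∀ k → Below p (w k)) → (∀ k → operator q (w k) ≈ 𝟘) →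
          Σ[ c ∈ (Fin m → Fin p) ] (Σ[ k ∈ Fin m ] c k ≢ 0#) × sum (λ k → C (c k) ⊗ w k) ≈ 𝟘
        operator-dependence {m} q q≉0 w w-below killed = c , proj₁ (proj₂ combination) , W≈0
          where
          q-order = common-order q q≉0
          s : ℕ
          s = proj₁ q-order
          v : Fin m → Fin p
          v l = coef (q l) s
          roots = few-roots v (proj₁ (proj₁ (proj₂ q-order))) (proj₂ (proj₁ (proj₂ q-order)))
          combination = vanishing-combination (proj₁ roots) (proj₁ (proj₂ roots)) w
          c : Fin m → Fin p
          c = proj₁ combination
          W : Poly
          W = sum (λ k → C (c k) ⊗ w k)
          W-killed : operator q W ≈ 𝟘
          W-killed = ≈-trans (operator-sum q (λ k → C (c k) ⊗ w k)) (≈-trans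
            (sum-cong-≋ (λ k → ≈-trans (operator-C⊗ q (c k) (w k))
              (≈-trans (⊗-congˡ {C (c k)} (killed k)) (⊗-zeroʳ (C (c k))))))
            (sum-replicate-zero m))
          W-below : Below p W
          W-below = sum-below p (λ k → C (c k) ⊗ w k) λ k → C⊗-below p (c k) {w k} (w-below k)
          W≈0 : W ≈ 𝟘
          W≈0 = decidable-stable (≈𝟘? W) λ W≉0 → lowest-root (common-order {1} (λ _ → W) (zero , W≉0))
            where
            lowest-root : ¬ (∃[ n ] (∃[ l ] coef W n ≢ 0#) × ((l : Fin 1) → LowVanish n (coef W)))
            lowest-root (n , (_ , Wn≢0) , lows) = Wn≢0 (proj₂ (proj₂ combination) (proj₂ (proj₂ roots) n<p I-root))
              where
              W-low : LowVanish n (coef W)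
              W-low = lows zero
              n<p : n < p
              n<p = ℕ.≰⇒> λ p≤n → Wn≢0 (W-below n p≤n)
              -- No `q l` has terms below X ^ s and no Dˡ W has terms below X ^ n, so at s + n every
              -- summand contributes a single product.
              lowest : coef (operator q W) (s ℕ.+ n) ≡ evS m (extend v) (indicial-root n) * coef W n
              lowest = coef-sum (λ l → q l ⊗ iterate D W (toℕ l)) v (s ℕ.+ n) (indicial-root n) (coef W n)
                λ l → trans (⊛-lowest s n (coef (q l)) (coef (iterate D W (toℕ l))) (proj₂ (proj₂ q-order) l)
                              (iterD-low n (toℕ l) W W-low))
                            (cong (v l *_) (iterD-lowest n (toℕ l) W W-low))
              I-root : evS m (extend v) (indicial-root n) ≡ 0#
              I-root = decidable-stable (_ Fin.≟ 0#) λ I≢0 →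
                *-nonzero I≢0 Wn≢0 (trans (sym lowest) (at W-killed (s ℕ.+ n)))

      -- While m < p and g x ≠ 0, D lowers the multiplicity of a root x by exactly one.
      order : ∀ m a x → m ≤ p → x ≢ 0# → ⟦ g ⟧ x ≢ 0# →
              (∀ j → j < m → ⟦ iterate D a j ⟧ x ≡ 0#) → (X- x) ^ m ∣ a
      order zero          a x _   _   _   _ = a , ⊗-identityʳ a
      order (suc zero)    a x _   _   _   h with root⇒factor a x (h 0 (s≤s z≤n))
      ... | q , a≈ = q , ≈-trans (⊗-congˡ {q} (⊗-identityʳ (X- x))) (≈-trans (⊗-comm q (X- x)) (≈-sym a≈))
      order (suc (suc m)) a x m<p x≢0 gx≢0 h
        with order (suc m) a x (ℕ.<⇒≤ m<p) x≢0 gx≢0 (λ j j<m → h j (ℕ.<-trans j<m (ℕ.n<1+n _)))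
           | order (suc m) (D a) x (ℕ.<⇒≤ m<p) x≢0 gx≢0 (λ j j<m → h (suc j) (s≤s j<m))
      ... | q , q⊗≈a | r , r⊗≈Da = proj₁ factor , (let open PR in begin
          proj₁ factor ⊗ (L ⊗ L ^ suc m)
            ≈⟨ solve 3 (λ f L M → f :* (L :* M) := (L :* f) :* M) ≈-refl (proj₁ factor) L (L ^ suc m) ⟩
          (L ⊗ proj₁ factor) ⊗ L ^ suc m
            ≈⟨ ⊗-congʳ {L ^ suc m} (≈-sym (proj₂ factor)) ⟩
          q ⊗ L ^ suc m
            ≈⟨ q⊗≈a ⟩
          a ∎)
        where
        L N : Poly
        L = X- x
        N = suc m · Θ L
        ΘL≈X : Θ L ≈ X
        ΘL≈X = ≈-trans (Θ-⊕ X (C (- x))) (≈-trans (⊕-cong Θ-X (Θ-C (- x))) (⊕-identityʳ X))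
        -- Here a = q L ^ (m + 1) gives D a = L ^ m (L g Θ q + g N q), and L ^ (m + 1) divides D a
        -- as well. So g N q vanishes at x, while N takes the value (m + 1) x there, which is not
        -- zero since m + 1 < p.
        cancelled : L ⊗ (g ⊗ Θ q) ⊕ g ⊗ N ⊗ q ≈ L ⊗ r
        cancelled = ⊗-cancelˡ {L ^ m} (^-nonzero (X-≉𝟘 x) m) (let open PR in begin
          L ^ m ⊗ (L ⊗ (g ⊗ Θ q) ⊕ g ⊗ N ⊗ q)
            ≈⟨ solve 6 (λ M L g t n q → M :* (L :* (g :* t) :+ g :* n :* q)
                 := g :* (t :* (L :* M) :+ q :* (n :* M))) ≈-refl (L ^ m) L g (Θ q) N q ⟩
          g ⊗ (Θ q ⊗ L ^ suc m ⊕ q ⊗ (N ⊗ L ^ m))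
            ≈⟨ ⊗-congˡ {g} (⊕-congˡ {Θ q ⊗ L ^ suc m} (⊗-congˡ {q} (≈-sym (Θ-^ L m)))) ⟩
          g ⊗ (Θ q ⊗ L ^ suc m ⊕ q ⊗ Θ (L ^ suc m))
            ≈⟨ ⊗-congˡ {g} (≈-trans (≈-sym (Θ-⊗ q (L ^ suc m))) (Θ-cong q⊗≈a)) ⟩
          D a
            ≈⟨ r⊗≈Da ⟨
          r ⊗ L ^ suc m
            ≈⟨ solve 3 (λ r L M → r :* (L :* M) := M :* (L :* r)) ≈-refl r L (L ^ m) ⟩
          L ^ m ⊗ (L ⊗ r) ∎)
        vanishes : (⟦ g ⟧ x * (suc m ×ᶠ x)) * ⟦ q ⟧ x ≡ 0#
        vanishes = begin
          (⟦ g ⟧ x * (suc m ×ᶠ x)) * ⟦ q ⟧ x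
            ≡⟨ cong (λ y → (⟦ g ⟧ x * y) * ⟦ q ⟧ x) (trans (⟦·⟧ (suc m) (Θ L) x) (×-congʳ (suc m) (trans (⟦⟧-cong ΘL≈X x) (⟦X⟧ x)))) ⟨
          (⟦ g ⟧ x * ⟦ N ⟧ x) * ⟦ q ⟧ x
            ≡⟨ trans (⟦⊗⟧ (g ⊗ N) q x) (cong (_* ⟦ q ⟧ x) (⟦⊗⟧ g N x)) ⟨
          ⟦ g ⊗ N ⊗ q ⟧ x
            ≡⟨ trans (cong (_+ ⟦ g ⊗ N ⊗ q ⟧ x) (at-L (g ⊗ Θ q))) (+-identityˡ _) ⟨
          ⟦ L ⊗ (g ⊗ Θ q) ⟧ x + ⟦ g ⊗ N ⊗ q ⟧ x
            ≡⟨ ⟦⊕⟧ (L ⊗ (g ⊗ Θ q)) (g ⊗ N ⊗ q) x ⟨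
          ⟦ L ⊗ (g ⊗ Θ q) ⊕ g ⊗ N ⊗ q ⟧ x
            ≡⟨ ⟦⟧-cong cancelled x ⟩
          ⟦ L ⊗ r ⟧ x
            ≡⟨ at-L r ⟩
          0# ∎
          where
          open ≡-Reasoning
          at-L : ∀ b → ⟦ L ⊗ b ⟧ x ≡ 0#
          at-L b = trans (⟦⊗⟧ L b x) (trans (cong (_* ⟦ b ⟧ x) (trans (⟦X-⟧ x x) (-‿inverseʳ x))) (zeroˡ _))
        factor : ∃[ q′ ] q ≈ L ⊗ q′
        factor = root⇒factor q x (decidable-stable (⟦ q ⟧ x Fin.≟ 0#) λ qx≢0 →
          *-nonzero (*-nonzero gx≢0 (×-nonzero (suc m) (s≤s z≤n) m<p x≢0)) qx≢0 vanishes)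

-- Linear independence over low degree coefficients, and Stepanov's bound

module Exponentials {p : ℕ} {_+_ _*_ : Op₂ (Fin p)} { -_ : Op₁ (Fin p)} {0# 1# : Fin p}
  (isCommutativeRing : IsCommutativeRing _≡_ _+_ _*_ -_ 0# 1#)
  (0≢1 : 0# ≢ 1#) (inverse : ∀ x → x ≢ 0# → ∃[ y ] x * y ≡ 1#) where

  open Stepanov isCommutativeRing 0≢1 inverse public
  open IsCommutativeRing isCommutativeRing
    using (*-identityʳ)
  open import Algebra.Properties.Ring polyRing′
    using () renaming (-‿distribˡ-* to ⊝-distribˡ-⊗)
  open import Algebra.Properties.Group (CommutativeRing.+-group polyRing)
    using () renaming (inverseʳ-unique to ⊝-uniqueʳ)

  module _ (char : ∀ n → 0 < n → n < p → n ×ᶠ 1# ≢ 0#) (g : Poly) (g₀≢0 : coef g 0 ≢ 0#) where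
    open Characteristic char
    open Derivation g

    -- An abstraction of the products of powers of iterates. `e k / g` is the logarithmic derivative
    -- Θ h / h, so D maps polynomial multiples of `h k` to such multiples; `separated` says that
    -- distinct members are not proportional with coefficients of degree below τ.
    record Family (K d H τ : ℕ) : Set where
      field
        h e       : Fin K → Poly
        eigen     : ∀ k → D (h k) ≈ e k ⊗ h k
        g-below   : Below (suc d) g
        e-below   : ∀ k → Below (suc d) (e k)
        h-below   : ∀ k → Below (suc H) (h k)
        h≉𝟘       : ∀ k → ¬ h k ≈ 𝟘
        separated : ∀ {k l} → k ≢ l → ∀ R S → Below τ R → Below τ S →
                    R ⊗ h k ≈ S ⊗ h l → R ≈ 𝟘

    module _ {K d H τ : ℕ} (𝓕 : Family K d H τ) (A : ℕ)
      (K[A+Kd]<τ : K ℕ.* (A ℕ.+ K ℕ.* d) < τ) (A+H≤p : A ℕ.+ H ≤ p) where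
      open Family 𝓕

      Independent : ∀ {m} → (Fin m → Fin K) → Set
      Independent {m} ι = (P : Fin m → Poly) → (∀ k → Below A (P k)) →
        sum (λ k → P k ⊗ h (ι k)) ≈ 𝟘 → ∀ k → P k ≈ 𝟘

      -- Some Σ qₗ Dˡ kills all but two of the summands, hence by separation all but the
      -- first; but it has too few lowest exponents to kill them all.
      no-relation : ∀ {m} (ι : Fin (suc (suc m)) → Fin K) → Injective _≡_ _≡_ ι →
        Independent (ι ∘ suc) → (P : Fin (suc (suc m)) → Poly) → (∀ k → Below A (P k)) →
        (∀ k → ¬ P (suc k) ≈ 𝟘) → ¬ sum (λ k → P k ⊗ h (ι k)) ≈ 𝟘
      no-relation {m} ι ι-inj independent P P-below P≉0 relation =
        ⊗-nonzero {C (c k₁)} (λ eq → ck₁≢0 (at eq 0)) (P≉0 k₁)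
          (independent (λ k → C (c k) ⊗ P (suc k)) (λ k → C⊗-below A (c k) {P (suc k)} (P-below (suc k)))
            (≈-trans (sum-cong-≋ (λ k → ⊗-assoc (C (c k)) (P (suc k)) (h (ι (suc k))))) (proj₂ (proj₂ dependence))) k₁)
        where
        -- S bounds the degrees of the derived coefficients: A, plus d for each application of D.
        -- Killing m terms costs m (E + S) conditions on (m + 1) E unknowns, so E has to exceed m S.
        S E : ℕ
        S = A ℕ.+ suc m ℕ.* d
        E = suc (m ℕ.* S)
        m<K : suc m ≤ K
        m<K = ℕ.≤-trans (ℕ.n≤1+n _) (Fin.injective⇒≤ ι-inj)
        E+S≤τ : E ℕ.+ S ≤ τ
        E+S≤τ = begin
          suc (m ℕ.* S ℕ.+ S) ≡⟨ cong suc (ℕ.+-comm (m ℕ.* S) S) ⟩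
          suc (suc m ℕ.* S) ≤⟨ s≤s (ℕ.*-mono-≤ m<K (ℕ.+-monoʳ-≤ A (ℕ.*-monoˡ-≤ d m<K))) ⟩
          suc (K ℕ.* (A ℕ.+ K ℕ.* d)) ≤⟨ K[A+Kd]<τ ⟩
          τ ∎
          where open ℕ.≤-Reasoning
        count : m ℕ.* (E ℕ.+ S) < suc m ℕ.* E
        count = begin-strict
          m ℕ.* (E ℕ.+ S) ≡⟨ ℕ.*-distribˡ-+ m E S ⟩
          m ℕ.* E ℕ.+ m ℕ.* S <⟨ ℕ.+-monoʳ-< (m ℕ.* E) (ℕ.n<1+n _) ⟩
          m ℕ.* E ℕ.+ E ≡⟨ ℕ.+-comm (m ℕ.* E) E ⟩
          suc m ℕ.* E ∎
          where open ℕ.≤-Reasoning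
        derived : Fin (suc (suc m)) → Fin (suc m) → Poly
        derived k l = iterate (δ (e (ι k))) (P k) (toℕ l)
        solution = siegel E (E ℕ.+ S) count (λ l i q → q ⊗ derived (suc (suc i)) l)
          (λ l i x y → ≈-trans (⊗-distribʳ (derived (suc (suc i)) l) x (⊝ y))
            (⊕-congˡ {x ⊗ derived (suc (suc i)) l} (≈-sym (⊝-distribˡ-⊗ y (derived (suc (suc i)) l)))))
        q : Fin (suc m) → Poly
        q = proj₁ solution
        R : Fin (suc (suc m)) → Poly
        R k = sum (λ l → q l ⊗ derived k l)
        R-below : ∀ k → Below (E ℕ.+ S) (R k)
        R-below k = sum-below (E ℕ.+ S) (λ l → q l ⊗ derived k l) λ l →
          ⊗-below E S {q l} {derived k l} (proj₁ (proj₂ solution) l)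
            (below-mono (derived k l)
              (ℕ.m≤n⇒m≤1+n (ℕ.+-monoʳ-≤ A (ℕ.*-monoˡ-≤ d (ℕ.<⇒≤ (Fin.toℕ<n l)))))
              (iterδ-below {n = A} {e (ι k)} g-below (e-below (ι k)) (toℕ l) {P k} (P-below k)))
        R≈0 : ∀ i → R (suc (suc i)) ≈ 𝟘
        R≈0 i = below-zero (E ℕ.+ S) (R-below (suc (suc i))) (proj₂ (proj₂ (proj₂ solution)) i)
        applied : ∀ k → operator q (P k ⊗ h (ι k)) ≈ R k ⊗ h (ι k)
        applied k = operator-⊗ q (eigen (ι k)) (P k)
        total : sum (λ k → R k ⊗ h (ι k)) ≈ 𝟘
        total = ≈-trans (sum-cong-≋ (λ k → ≈-sym (applied k)))
          (≈-trans (≈-sym (operator-sum q (λ k → P k ⊗ h (ι k)))) (≈-trans (operator-cong q relation) (operator-𝟘 q)))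
        two-terms : R zero ⊗ h (ι zero) ⊕ R (suc zero) ⊗ h (ι (suc zero)) ≈ 𝟘
        two-terms = ≈-trans (⊕-congˡ {R zero ⊗ h (ι zero)} (≈-sym (≈-trans
          (⊕-congˡ {R (suc zero) ⊗ h (ι (suc zero))} (≈-trans
            (sum-cong-≋ (λ i → ≈-trans (⊗-congʳ {h (ι (suc (suc i)))} (R≈0 i)) (⊗-zeroˡ (h (ι (suc (suc i)))))))
            (sum-replicate-zero m)))
          (⊕-identityʳ (R (suc zero) ⊗ h (ι (suc zero))))))) total
        -- What remains is R₀ h₀ + R₁ h₁ = 0. Taking R₁ and - R₀ in this order, `separated` kills
        -- the coefficient of the term that belongs to the tail `w`.
        R₁≈0 : R (suc zero) ≈ 𝟘
        R₁≈0 = separated (λ eq → Fin.0≢1+n (sym (ι-inj eq))) (R (suc zero)) (⊝ R zero)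
          (below-mono (R (suc zero)) E+S≤τ (R-below (suc zero)))
          (below-mono (⊝ R zero) E+S≤τ (⊝-below (E ℕ.+ S) {R zero} (R-below zero)))
          (≈-trans (⊝-uniqueʳ (R zero ⊗ h (ι zero)) (R (suc zero) ⊗ h (ι (suc zero))) two-terms) (⊝-distribˡ-⊗ (R zero) (h (ι zero))))
        w : Fin (suc m) → Poly
        w k = P (suc k) ⊗ h (ι (suc k))
        killed : ∀ k → operator q (w k) ≈ 𝟘
        killed k = ≈-trans (applied (suc k)) (≈-trans (⊗-congʳ {h (ι (suc k))} (R-suc≈0 k)) (⊗-zeroˡ (h (ι (suc k)))))
          where
          R-suc≈0 : ∀ k → R (suc k) ≈ 𝟘
          R-suc≈0 zero    = R₁≈0
          R-suc≈0 (suc i) = R≈0 i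
        w-below : ∀ k → Below p (w k)
        w-below k = below-mono (w k) A+H≤p
          (⊗-below A H {P (suc k)} {h (ι (suc k))} (P-below (suc k)) (h-below (ι (suc k))))
        dependence = operator-dependence g g₀≢0 q (proj₁ (proj₂ (proj₂ solution))) w w-below killed
        c : Fin (suc m) → Fin p
        c = proj₁ dependence
        k₁ : Fin (suc m)
        k₁ = proj₁ (proj₁ (proj₂ dependence))
        ck₁≢0 : c k₁ ≢ 0#
        ck₁≢0 = proj₂ (proj₁ (proj₂ dependence))

      -- This is the passage to a shortest relation: a vanishing coefficient is dropped, whence the
      -- hypothesis for all subfamilies. If the dropped index is not the first, the shorter relation
      -- shows that the first coefficient vanishes, and dropping that one gives the rest.
      independent-step : ∀ {m} →
        ((ι : Fin (suc m) → Fin K) → Injective _≡_ _≡_ ι → Independent ι) →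
        (ι : Fin (suc (suc m)) → Fin K) → Injective _≡_ _≡_ ι → Independent ι
      independent-step {m} ih ι ι-inj P P-below relation =
        all-zero (≈𝟘? (P zero)) (Fin.any? (λ k → ≈𝟘? (P (suc k))))
        where
        drop : ∀ k → P k ≈ 𝟘 → sum (λ i → P (punchIn k i) ⊗ h (ι (punchIn k i))) ≈ 𝟘
        drop k Pk≈0 = ≈-trans (≈-sym (≈-trans (sum-remove {i = k} (λ i → P i ⊗ h (ι i)))
          (≈-trans (⊕-congʳ {sum (λ i → P (punchIn k i) ⊗ h (ι (punchIn k i)))}
            (≈-trans (⊗-congʳ {h (ι k)} Pk≈0) (⊗-zeroˡ (h (ι k))))) (⊕-identityˡ _)))) relation
        rest : ∀ k → P k ≈ 𝟘 → ∀ i → P (punchIn k i) ≈ 𝟘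
        rest k Pk≈0 = ih (ι ∘ punchIn k) (λ eq → Fin.punchIn-injective k _ _ (ι-inj eq))
          (P ∘ punchIn k) (P-below ∘ punchIn k) (drop k Pk≈0)
        zero-first : P zero ≈ 𝟘 → ∀ k → P k ≈ 𝟘
        zero-first P₀≈0 zero    = P₀≈0
        zero-first P₀≈0 (suc k) = rest zero P₀≈0 k
        all-zero : Dec (P zero ≈ 𝟘) → Dec (∃[ k ] P (suc k) ≈ 𝟘) → ∀ k → P k ≈ 𝟘
        all-zero (yes P₀≈0) _               = zero-first P₀≈0
        all-zero (no  _)    (yes (k , Pk≈0)) = zero-first (rest (suc k) Pk≈0 zero)
        all-zero (no  _)    (no  none)      = ⊥-elim (no-relation ι ι-inj
          (ih (ι ∘ suc) (λ eq → Fin.suc-injective (ι-inj eq))) P P-below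
          (λ k Pk≈0 → none (k , Pk≈0)) relation)

      independent : ∀ {m} (ι : Fin m → Fin K) → Injective _≡_ _≡_ ι → Independent ι
      independent {zero}        ι ι-inj P P-below relation ()
      independent {suc zero}    ι ι-inj P P-below relation zero =
        decidable-stable (≈𝟘? (P zero)) λ P≉0 →
          ⊗-nonzero {P zero} P≉0 (h≉𝟘 (ι zero)) (≈-trans (≈-sym (⊕-identityʳ (P zero ⊗ h (ι zero)))) relation)
      independent {suc (suc m)} = independent-step independent

      ⟦sum⟧ : ∀ {m x} (a b : Fin m → Poly) → (∀ k → ⟦ b k ⟧ x ≡ 1#) →
              ⟦ sum (λ k → a k ⊗ b k) ⟧ x ≡ ⟦ sum a ⟧ x
      ⟦sum⟧ {zero}  {x} a b h = refl
      ⟦sum⟧ {suc m} {x} a b h = trans (⟦⊕⟧ (a zero ⊗ b zero) (sum (λ k → a (suc k) ⊗ b (suc k))) x)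
        (trans (cong₂ _+_ (trans (⟦⊗⟧ (a zero) (b zero) x) (trans (cong (⟦ a zero ⟧ x *_) (h zero)) (*-identityʳ _)))
                          (⟦sum⟧ (a ∘ suc) (b ∘ suc) (h ∘ suc)))
               (sym (⟦⊕⟧ (a zero) (sum (a ∘ suc)) x)))

      -- At the points in question every `h k` equals 1, so Dʲ Ψ takes the same values there as Σ δʲ
      -- P. This sum has degree below A + M d, and making it zero identically costs a number of
      -- conditions that depends neither on the number of points nor on H.
      stepanov : ∀ M → M ≤ p → M ℕ.* (A ℕ.+ M ℕ.* d) < K ℕ.* A →
        (xs : List (Fin p)) → Unique xs →
        (∀ {x} → x List.∈ xs → x ≢ 0# × ⟦ g ⟧ x ≢ 0# × (∀ k → ⟦ h k ⟧ x ≡ 1#)) →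
        M ℕ.* length xs < A ℕ.+ H
      stepanov M M≤p count xs unique good = roots-bound M (A ℕ.+ H) xs Ψ unique
        (λ {x} x∈ → let (x≢0 , gx≢0 , hx≡1) = good x∈ in
          order g M Ψ x M≤p x≢0 gx≢0 (λ j j<M → vanishes x hx≡1 j j<M))
        Ψ≉0 (sum-below (A ℕ.+ H) (λ k → P k ⊗ h k) λ k → ⊗-below A H {P k} {h k} (proj₁ (proj₂ solution) k) (h-below k))
        where
        solution = siegel A (A ℕ.+ M ℕ.* d) count (λ k j a → iterate (δ (e k)) a (toℕ j))
          (λ k j → iterδ-⊝ (e k) (toℕ j))
        P : Fin K → Poly
        P = proj₁ solution
        Ψ : Poly
        Ψ = sum (λ k → P k ⊗ h k)
        Ψ≉0 : ¬ Ψ ≈ 𝟘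
        Ψ≉0 Ψ≈0 = let (k , Pk≉0) = proj₁ (proj₂ (proj₂ solution)) in
          Pk≉0 (independent id id P (proj₁ (proj₂ solution)) Ψ≈0 k)
        vanishes : ∀ x → (∀ k → ⟦ h k ⟧ x ≡ 1#) → ∀ j → j < M → ⟦ iterate D Ψ j ⟧ x ≡ 0#
        vanishes x hx≡1 j j<M = begin
          ⟦ iterate D Ψ j ⟧ x
            ≡⟨ ⟦⟧-cong (≈-trans (iterD-sum j (λ k → P k ⊗ h k)) (sum-cong-≋ (λ k → iterD-⊗ (eigen k) j (P k)))) x ⟩
          ⟦ sum (λ k → iterate (δ (e k)) (P k) j ⊗ h k) ⟧ x
            ≡⟨ ⟦sum⟧ (λ k → iterate (δ (e k)) (P k) j) h hx≡1 ⟩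
          ⟦ sum (λ k → iterate (δ (e k)) (P k) j) ⟧ x
            ≡⟨ ⟦⟧-cong {sum (λ k → iterate (δ (e k)) (P k) j)} {𝟘} Q≈0 x ⟩
          0# ∎
          where
          open ≡-Reasoning
          Q≈0 : sum (λ k → iterate (δ (e k)) (P k) j) ≈ 𝟘
          Q≈0 = below-zero (A ℕ.+ M ℕ.* d)
            (sum-below (A ℕ.+ M ℕ.* d) (λ k → iterate (δ (e k)) (P k) j) λ k →
              below-mono (iterate (δ (e k)) (P k) j) (ℕ.+-monoʳ-≤ A (ℕ.*-monoˡ-≤ d (ℕ.<⇒≤ j<M)))
                (iterδ-below {n = A} {e k} g-below (e-below k) j {P k} (proj₁ (proj₂ solution) k)))
            (λ i i<n → subst (λ j → coef (sum (λ k → iterate (δ (e k)) (P k) j)) i ≡ 0#) (Fin.toℕ-fromℕ< j<M)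
              (proj₂ (proj₂ (proj₂ solution)) (fromℕ< j<M) i i<n))

-- The field of residues modulo a prime

module Residues {p : ℕ} .{{_ : NonZero p}} where

  open import Data.Nat.Coprimality using (prime⇒coprime; coprime-Bézout)
  open import Data.Nat.DivMod
  open import Data.Nat.GCD using (module Bézout)
  open import Data.Nat.Primality using (prime⇒nonTrivial)

  residue : ℕ → Fin p
  residue n = n mod p

  toℕ-residue : ∀ n → toℕ (residue n) ≡ n % p
  toℕ-residue n = Fin.toℕ-fromℕ< (m%n<n n p)

  residue-≡ : ∀ {m n} → m % p ≡ n % p → residue m ≡ residue n
  residue-≡ {m} {n} eq = Fin.toℕ-injective (trans (toℕ-residue m) (trans eq (sym (toℕ-residue n))))

  residue-toℕ : ∀ a → residue (toℕ a) ≡ a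
  residue-toℕ a = Fin.toℕ-injective (trans (toℕ-residue (toℕ a)) (m<n⇒m%n≡m (Fin.toℕ<n a)))

  residue-+ : ∀ m n → residue m +ₚ residue n ≡ residue (m ℕ.+ n)
  residue-+ m n = residue-≡ (trans (cong₂ (λ x y → (x ℕ.+ y) % p) (toℕ-residue m) (toℕ-residue n))
    (sym (%-distribˡ-+ m n p)))

  residue-* : ∀ m n → residue m *ₚ residue n ≡ residue (m ℕ.* n)
  residue-* m n = residue-≡ (trans (cong₂ (λ x y → (x ℕ.* y) % p) (toℕ-residue m) (toℕ-residue n))
    (sym (%-distribˡ-* m n p)))

  -- Every element is a residue, so ring laws descend from ℕ.
  lift : {P : Fin p → Set} → (∀ n → P (residue n)) → ∀ a → P a
  lift {P} h a = subst P (residue-toℕ a) (h (toℕ a))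

  infix 8 -ₚ_
  -ₚ_ : Fin p → Fin p
  -ₚ a = residue (p ℕ.∸ toℕ a)

  +ₚ-comm : ∀ a b → a +ₚ b ≡ b +ₚ a
  +ₚ-comm a b = cong residue (ℕ.+-comm (toℕ a) (toℕ b))

  *ₚ-comm : ∀ a b → a *ₚ b ≡ b *ₚ a
  *ₚ-comm a b = cong residue (ℕ.*-comm (toℕ a) (toℕ b))

  +ₚ-assoc : ∀ a b c → (a +ₚ b) +ₚ c ≡ a +ₚ (b +ₚ c)
  +ₚ-assoc = lift λ l → lift λ m → lift λ n → begin
    (residue l +ₚ residue m) +ₚ residue n ≡⟨ cong (_+ₚ residue n) (residue-+ l m) ⟩
    residue (l ℕ.+ m) +ₚ residue n ≡⟨ residue-+ (l ℕ.+ m) n ⟩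
    residue (l ℕ.+ m ℕ.+ n) ≡⟨ cong residue (ℕ.+-assoc l m n) ⟩
    residue (l ℕ.+ (m ℕ.+ n)) ≡⟨ residue-+ l (m ℕ.+ n) ⟨
    residue l +ₚ residue (m ℕ.+ n) ≡⟨ cong (residue l +ₚ_) (residue-+ m n) ⟨
    residue l +ₚ (residue m +ₚ residue n) ∎
    where open ≡-Reasoning

  *ₚ-assoc : ∀ a b c → (a *ₚ b) *ₚ c ≡ a *ₚ (b *ₚ c)
  *ₚ-assoc = lift λ l → lift λ m → lift λ n → begin
    (residue l *ₚ residue m) *ₚ residue n ≡⟨ cong (_*ₚ residue n) (residue-* l m) ⟩
    residue (l ℕ.* m) *ₚ residue n ≡⟨ residue-* (l ℕ.* m) n ⟩
    residue (l ℕ.* m ℕ.* n) ≡⟨ cong residue (ℕ.*-assoc l m n) ⟩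
    residue (l ℕ.* (m ℕ.* n)) ≡⟨ residue-* l (m ℕ.* n) ⟨
    residue l *ₚ residue (m ℕ.* n) ≡⟨ cong (residue l *ₚ_) (residue-* m n) ⟨
    residue l *ₚ (residue m *ₚ residue n) ∎
    where open ≡-Reasoning

  *ₚ-distribˡ : ∀ a b c → a *ₚ (b +ₚ c) ≡ a *ₚ b +ₚ a *ₚ c
  *ₚ-distribˡ = lift λ l → lift λ m → lift λ n → begin
    residue l *ₚ (residue m +ₚ residue n) ≡⟨ cong (residue l *ₚ_) (residue-+ m n) ⟩
    residue l *ₚ residue (m ℕ.+ n) ≡⟨ residue-* l (m ℕ.+ n) ⟩
    residue (l ℕ.* (m ℕ.+ n)) ≡⟨ cong residue (ℕ.*-distribˡ-+ l m n) ⟩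
    residue (l ℕ.* m ℕ.+ l ℕ.* n) ≡⟨ residue-+ (l ℕ.* m) (l ℕ.* n) ⟨
    residue (l ℕ.* m) +ₚ residue (l ℕ.* n) ≡⟨ cong₂ _+ₚ_ (residue-* l m) (residue-* l n) ⟨
    residue l *ₚ residue m +ₚ residue l *ₚ residue n ∎
    where open ≡-Reasoning

  +ₚ-identityˡ : ∀ a → 0ₚ +ₚ a ≡ a
  +ₚ-identityˡ = lift (residue-+ 0)

  *ₚ-identityˡ : ∀ a → 1ₚ *ₚ a ≡ a
  *ₚ-identityˡ = lift λ n → trans (residue-* 1 n) (cong residue (ℕ.*-identityˡ n))

  +ₚ-inverseʳ : ∀ a → a +ₚ -ₚ a ≡ 0ₚ
  +ₚ-inverseʳ a = begin
    a +ₚ -ₚ a ≡⟨ cong (_+ₚ -ₚ a) (residue-toℕ a) ⟨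
    residue (toℕ a) +ₚ residue (p ℕ.∸ toℕ a) ≡⟨ residue-+ (toℕ a) (p ℕ.∸ toℕ a) ⟩
    residue (toℕ a ℕ.+ (p ℕ.∸ toℕ a)) ≡⟨ cong residue (ℕ.m+[n∸m]≡n (ℕ.<⇒≤ (Fin.toℕ<n a))) ⟩
    residue p ≡⟨ residue-≡ (trans (n%n≡0 p) (sym (m*n%n≡0 0 p))) ⟩
    0ₚ ∎
    where open ≡-Reasoning

  isCommutativeRing : IsCommutativeRing _≡_ _+ₚ_ _*ₚ_ -ₚ_ 0ₚ 1ₚ
  isCommutativeRing = record
    { isRing = record
      { +-isAbelianGroup = record
        { isGroup = record
          { isMonoid = record
            { isSemigroup = record
              { isMagma = record { isEquivalence = isEquivalence ; ∙-cong = cong₂ _+ₚ_ }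
              ; assoc = +ₚ-assoc
              }
            ; identity = +ₚ-identityˡ , λ a → trans (+ₚ-comm a 0ₚ) (+ₚ-identityˡ a)
            }
          ; inverse = (λ a → trans (+ₚ-comm (-ₚ a) a) (+ₚ-inverseʳ a)) , +ₚ-inverseʳ
          ; ⁻¹-cong = cong -ₚ_
          }
        ; comm = +ₚ-comm
        }
      ; *-cong = cong₂ _*ₚ_
      ; *-assoc = *ₚ-assoc
      ; *-identity = *ₚ-identityˡ , λ a → trans (*ₚ-comm a 1ₚ) (*ₚ-identityˡ a)
      ; distrib = *ₚ-distribˡ , λ a b c → trans (*ₚ-comm (b +ₚ c) a)
          (trans (*ₚ-distribˡ a b c) (cong₂ _+ₚ_ (*ₚ-comm a b) (*ₚ-comm a c)))
      }
    ; *-comm = *ₚ-comm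
    }

  residue≡0⇒≡0 : ∀ n → n < p → residue n ≡ 0ₚ → n ≡ 0
  residue≡0⇒≡0 n n<p eq = begin
    n ≡⟨ m<n⇒m%n≡m n<p ⟨
    n % p ≡⟨ toℕ-residue n ⟨
    toℕ (residue n) ≡⟨ cong toℕ eq ⟩
    toℕ 0ₚ ≡⟨ toℕ-residue 0 ⟩
    0 % p ≡⟨ m*n%n≡0 0 p ⟩
    0 ∎
    where open ≡-Reasoning

  residueRing : CommutativeRing 0ℓ 0ℓ
  residueRing = record { isCommutativeRing = isCommutativeRing }

  open import Algebra.Properties.Semiring.Mult (CommutativeRing.semiring residueRing)
    using () renaming (_×_ to _×ₚ_)

  ×1≡residue : ∀ n → n ×ₚ 1ₚ ≡ residue n
  ×1≡residue zero    = refl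
  ×1≡residue (suc n) = trans (cong (1ₚ +ₚ_) (×1≡residue n)) (residue-+ 1 n)

  module _ (p-prime : Prime p) where

    1<p : 1 < p
    1<p = ℕ.nonTrivial⇒n>1 p {{prime⇒nonTrivial p-prime}}

    0≢1 : 0ₚ ≢ 1ₚ
    0≢1 eq = ℕ.1+n≢0 (residue≡0⇒≡0 1 1<p (sym eq))

    char : ∀ n → 0 < n → n < p → n ×ₚ 1ₚ ≢ 0ₚ
    char n 0<n n<p eq = ℕ.>⇒≢ 0<n (residue≡0⇒≡0 n n<p (trans (sym (×1≡residue n)) eq))

    inverse : ∀ x → x ≢ 0ₚ → ∃[ y ] x *ₚ y ≡ 1ₚ
    inverse x x≢0 = go (coprime-Bézout (prime⇒coprime p-prime {{ℕ.≢-nonZero n≢0}} (Fin.toℕ<n x)))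
      where
      n : ℕ
      n = toℕ x
      n≢0 : n ≢ 0
      n≢0 eq = x≢0 (trans (sym (residue-toℕ x)) (cong residue eq))
      residue-multiple : ∀ a b → residue (a ℕ.+ b ℕ.* p) ≡ residue a
      residue-multiple a b = residue-≡ ([m+kn]%n≡m%n a b p)
      x*residue : ∀ b → x *ₚ residue b ≡ residue (b ℕ.* n)
      x*residue b = trans (cong (_*ₚ residue b) (sym (residue-toℕ x)))
        (trans (residue-* n b) (cong residue (ℕ.*-comm n b)))
      go : Bézout.Identity 1 p n → ∃[ y ] x *ₚ y ≡ 1ₚ
      go (Bézout.-+ a b 1+ap≡bn) = residue b , (begin
        x *ₚ residue b ≡⟨ x*residue b ⟩
        residue (b ℕ.* n) ≡⟨ cong residue 1+ap≡bn ⟨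
        residue (1 ℕ.+ a ℕ.* p) ≡⟨ residue-multiple 1 a ⟩
        1ₚ ∎)
        where open ≡-Reasoning
      go (Bézout.+- a b 1+bn≡ap) = -ₚ residue b , x-y≡0⇒x≡y (x *ₚ -ₚ residue b) 1ₚ (begin
        x *ₚ -ₚ residue b +ₚ -ₚ 1ₚ
          ≡⟨ cong (_+ₚ -ₚ 1ₚ) (-‿distribʳ-* x (residue b)) ⟨
        -ₚ (x *ₚ residue b) +ₚ -ₚ 1ₚ
          ≡⟨ ⁻¹-∙-comm (x *ₚ residue b) 1ₚ ⟩
        -ₚ (x *ₚ residue b +ₚ 1ₚ)
          ≡⟨ cong -ₚ_ (begin
            x *ₚ residue b +ₚ 1ₚ ≡⟨ cong (_+ₚ 1ₚ) (x*residue b) ⟩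
            residue (b ℕ.* n) +ₚ 1ₚ ≡⟨ trans (residue-+ (b ℕ.* n) 1) (cong residue (ℕ.+-comm (b ℕ.* n) 1)) ⟩
            residue (1 ℕ.+ b ℕ.* n) ≡⟨ cong residue 1+bn≡ap ⟩
            residue (a ℕ.* p) ≡⟨ residue-multiple 0 a ⟩
            0ₚ ∎) ⟩
        -ₚ 0ₚ
          ≡⟨ -0#≈0# ⟩
        0ₚ ∎)
        where
        open ≡-Reasoning
        open import Algebra.Properties.Ring (CommutativeRing.ring residueRing)
          using (-‿distribʳ-*; -0#≈0#) renaming (x∙y⁻¹≈ε⇒x≈y to x-y≡0⇒x≡y)
        open import Algebra.Properties.AbelianGroup (CommutativeRing.+-abelianGroup residueRing)
          using (⁻¹-∙-comm)

-- Composition, logarithmic derivatives of monomials, and separation by comaximality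

module Composition {p : ℕ} .{{_ : NonZero p}} (p-prime : Prime p) where

  open Residues {p} using (isCommutativeRing)
  open Exponentials isCommutativeRing (Residues.0≢1 p-prime) (Residues.inverse p-prime) public
  open import Algebra.Properties.CommutativeMonoid.Sum (CommutativeRing.*-commutativeMonoid polyRing)
    using () renaming (sum-remove to product-remove)
  open CommutativeRing baseRing using (+-identityˡ)

  compose : List (Fin p) → Poly → Poly
  compose f g = List.foldr (λ a y → C a ⊕ g ⊗ y) 𝟘 f

  ⟦compose⟧ : ∀ f g x → ⟦ compose f g ⟧ x ≡ eval f (⟦ g ⟧ x)
  ⟦compose⟧ []      g x = refl
  ⟦compose⟧ (a ∷ f) g x = trans (⟦⊕⟧ (C a) (g ⊗ compose f g) x) (cong₂ _+ₚ_ (⟦C⟧ a x)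
    (trans (⟦⊗⟧ g (compose f g) x) (cong (⟦ g ⟧ x *ₚ_) (⟦compose⟧ f g x))))

  compose-𝟘 : ∀ f g → (∀ i → coeff f i ≡ 0ₚ) → compose f g ≈ 𝟘
  compose-𝟘 []      g h = ≈-refl
  compose-𝟘 (a ∷ f) g h = ≈-trans (⊕-cong
    (≈-trans (C-cong (h 0)) (mk≈ λ { zero → refl ; (suc _) → refl }))
    (≈-trans (⊗-congˡ {g} (compose-𝟘 f g (h ∘ suc))) (⊗-zeroʳ g))) (⊕-identityˡ 𝟘)

  hasDeg-C⊕ : ∀ c {n a} → HasDeg (suc n) a → HasDeg (suc n) (C c ⊕ a)
  hasDeg-C⊕ c {n} (an , below) = (λ eq → an (trans (sym (+-identityˡ _)) eq)) ,
    λ { (suc i) h → trans (+-identityˡ _) (below (suc i) h) }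

  -- The inner degree is positive, so adding the constant coefficient at each Horner step cannot
  -- disturb the leading one.
  compose-hasDeg : ∀ f d {e g} → HasDegree f d → HasDeg (suc e) g → HasDeg (d ℕ.* suc e) (compose f g)
  compose-hasDeg []      d       (lead , _) g-deg = ⊥-elim (lead refl)
  compose-hasDeg (a ∷ f) zero {g = g} (lead , rest) g-deg = hasDeg-≈ {a = C a}
    (≈-sym (≈-trans (⊕-congˡ {C a} (≈-trans (⊗-congˡ {g} (compose-𝟘 f g (λ i → rest (suc i) (s≤s z≤n)))) (⊗-zeroʳ g)))
      (⊕-identityʳ (C a))))
    (lead , finite (C a))
  compose-hasDeg (a ∷ f) (suc d) {e} {g} (lead , rest) g-deg =
    hasDeg-C⊕ a {a = g ⊗ compose f g} (hasDeg-⊗ {a = g} {compose f g} g-deg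
      (compose-hasDeg f d (lead , λ i d<i → rest (suc i) (s≤s d<i)) g-deg))

  -- Horner's scheme for `f`, run modulo `a`, where `b` becomes the constant `c`.
  compose-mod : ∀ f {a b q c} → b ≈ a ⊗ q ⊕ C c → ∃[ r ] compose f b ≈ a ⊗ r ⊕ C (eval f c)
  compose-mod []      {a} _ = 𝟘 , ≈-sym (≈-trans (⊕-cong (⊗-zeroʳ a) (mk≈ λ { zero → refl ; (suc _) → refl })) (⊕-identityˡ 𝟘))
  compose-mod (v ∷ f) {a} {b} {q} {c} b≈ = let (r , fb≈) = compose-mod f b≈ ; w = eval f c in
    q ⊗ (a ⊗ r ⊕ C w) ⊕ C c ⊗ r , (let open PR in begin
      C v ⊕ b ⊗ compose f b
        ≈⟨ ⊕-congˡ {C v} (⊗-cong b≈ fb≈) ⟩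
      C v ⊕ (a ⊗ q ⊕ C c) ⊗ (a ⊗ r ⊕ C w)
        ≈⟨ solve 6 (λ v a q c r w → v :+ (a :* q :+ c) :* (a :* r :+ w)
             := a :* (q :* (a :* r :+ w) :+ c :* r) :+ (v :+ c :* w))
             ≈-refl (C v) a q (C c) r (C w) ⟩
      a ⊗ (q ⊗ (a ⊗ r ⊕ C w) ⊕ C c ⊗ r) ⊕ (C v ⊕ C c ⊗ C w)
        ≈⟨ ⊕-congˡ {a ⊗ (q ⊗ (a ⊗ r ⊕ C w) ⊕ C c ⊗ r)} (≈-sym (≈-trans (C-⊕ v (c *ₚ w)) (⊕-congˡ {C v} (C-⊗ c w)))) ⟩
      a ⊗ (q ⊗ (a ⊗ r ⊕ C w) ⊕ C c ⊗ r) ⊕ C (v +ₚ c *ₚ w) ∎)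

  unit-remainder⇒comaximal : ∀ {a b q c} → c ≢ 0ₚ → b ≈ a ⊗ q ⊕ C c → Comaximal a b
  unit-remainder⇒comaximal {a} {b} {q} {c} c≢0 b≈ =
    let (z , cz≡1) = Residues.inverse p-prime c c≢0 in ⊝ (C z ⊗ q) , C z , (let open PR in begin
      (⊝ (C z ⊗ q)) ⊗ a ⊕ C z ⊗ b
        ≈⟨ ⊕-congˡ {(⊝ (C z ⊗ q)) ⊗ a} (⊗-congˡ {C z} b≈) ⟩
      (⊝ (C z ⊗ q)) ⊗ a ⊕ C z ⊗ (a ⊗ q ⊕ C c)
        ≈⟨ solve 5 (λ n z q a c → n :* a :+ z :* (a :* q :+ c)
             := (n :+ z :* q) :* a :+ c :* z) ≈-refl (⊝ (C z ⊗ q)) (C z) q a (C c) ⟩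
      (⊝ (C z ⊗ q) ⊕ C z ⊗ q) ⊗ a ⊕ C c ⊗ C z
        ≈⟨ ⊕-cong (≈-trans (⊗-congʳ {a} (⊝-inverseˡ (C z ⊗ q))) (⊗-zeroˡ a)) (≈-trans (≈-sym (C-⊗ c z)) (C-cong cz≡1)) ⟩
      𝟘 ⊕ 𝟙
        ≈⟨ ⊕-identityˡ 𝟙 ⟩
      𝟙 ∎)

  -- Multiplication by `γ` avoids the exponent a - 1, so that a = 0 is no exception.
  Θ-power : ∀ γ a → γ ⊗ Θ (γ ^ a) ≈ (a · Θ γ) ⊗ γ ^ a
  Θ-power γ zero    = ≈-trans (⊗-congˡ {γ} (Θ-C 1ₚ)) (≈-trans (⊗-zeroʳ γ) (≈-sym (⊗-zeroˡ 𝟙)))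
  Θ-power γ (suc a) = ≈-trans (⊗-congˡ {γ} (Θ-^ γ a))
    (solve 3 (λ x n y → x :* (n :* y) := n :* (x :* y)) ≈-refl γ (suc a · Θ γ) (γ ^ a))

  monomial : ∀ {n} → (Fin n → Poly) → (Fin n → ℕ) → Poly
  monomial γ a = product (λ i → γ i ^ a i)

  ·-below : ∀ n k {a} → Below n a → Below n (k · a)
  ·-below n zero    h i _ = refl
  ·-below n (suc k) {a} h = ⊕-below n {a} {k · a} h (·-below n k {a} h)

  ⊗-below′ : ∀ n m {a b} → Below (suc n) a → Below (suc m) b → Below (suc (m ℕ.+ n)) (a ⊗ b)
  ⊗-below′ n m {a} {b} ha hb = subst (λ k → Below (suc k) (a ⊗ b)) (ℕ.+-comm n m) (⊗-below (suc n) m {a} {b} ha hb)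

  -- The logarithmic derivative Σ aᵢ Θ γᵢ / γᵢ of `monomial γ a`, cleared of denominators by
  -- `product γ`.
  eigenvalue : ∀ {n} → (Fin n → Poly) → (Fin n → ℕ) → Poly
  eigenvalue {zero}  γ a = 𝟘
  eigenvalue {suc n} γ a =
    product (γ ∘ suc) ⊗ (a zero · Θ (γ zero)) ⊕ γ zero ⊗ eigenvalue (γ ∘ suc) (a ∘ suc)

  monomial-eigen : ∀ {n} (γ : Fin n → Poly) a →
                   product γ ⊗ Θ (monomial γ a) ≈ eigenvalue γ a ⊗ monomial γ a
  monomial-eigen {zero}  γ a = ≈-trans (⊗-congˡ {𝟙} (Θ-C 1ₚ)) (≈-trans (⊗-zeroʳ 𝟙) (≈-sym (⊗-zeroˡ 𝟙)))
  monomial-eigen {suc n} γ a = begin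
    γ₀ ⊗ G ⊗ Θ (γ₀ ^ a zero ⊗ h)
      ≈⟨ ⊗-congˡ {γ₀ ⊗ G} (Θ-⊗ (γ₀ ^ a zero) h) ⟩
    γ₀ ⊗ G ⊗ (Θ (γ₀ ^ a zero) ⊗ h ⊕ γ₀ ^ a zero ⊗ Θ h)
      ≈⟨ solve 6 (λ y g t h u v → y :* g :* (t :* h :+ u :* v)
           := g :* (y :* t) :* h :+ y :* u :* (g :* v))
           ≈-refl γ₀ G (Θ (γ₀ ^ a zero)) h (γ₀ ^ a zero) (Θ h) ⟩
    G ⊗ (γ₀ ⊗ Θ (γ₀ ^ a zero)) ⊗ h ⊕ γ₀ ⊗ γ₀ ^ a zero ⊗ (G ⊗ Θ h)
      ≈⟨ ⊕-cong (⊗-congʳ {h} (⊗-congˡ {G} (Θ-power γ₀ (a zero))))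
           (⊗-congˡ {γ₀ ⊗ γ₀ ^ a zero} (monomial-eigen (γ ∘ suc) (a ∘ suc))) ⟩
    G ⊗ ((a zero · Θ γ₀) ⊗ γ₀ ^ a zero) ⊗ h ⊕ γ₀ ⊗ γ₀ ^ a zero ⊗ (e ⊗ h)
      ≈⟨ solve 6 (λ g t u h y e → g :* (t :* u) :* h :+ y :* u :* (e :* h)
           := (g :* t :+ y :* e) :* (u :* h))
           ≈-refl G (a zero · Θ γ₀) (γ₀ ^ a zero) h γ₀ e ⟩
    (G ⊗ (a zero · Θ γ₀) ⊕ γ₀ ⊗ e) ⊗ (γ₀ ^ a zero ⊗ h) ∎
    where
    open PR
    γ₀ G h e : Poly
    γ₀ = γ zero
    G = product (γ ∘ suc)
    h = monomial (γ ∘ suc) (a ∘ suc)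
    e = eigenvalue (γ ∘ suc) (a ∘ suc)

  eigenvalue-below : ∀ {n} c (γ : Fin n → Poly) a → (∀ i → Below (suc c) (γ i)) →
                     Below (suc (n ℕ.* c)) (eigenvalue γ a)
  eigenvalue-below {zero}  c γ a h = λ _ _ → refl
  eigenvalue-below {suc n} c γ a h = ⊕-below (suc (c ℕ.+ n ℕ.* c))
    {product (γ ∘ suc) ⊗ (a zero · Θ (γ zero))} {γ zero ⊗ eigenvalue (γ ∘ suc) (a ∘ suc)}
    (⊗-below′ (n ℕ.* c) c {product (γ ∘ suc)} {a zero · Θ (γ zero)} (product-below c (γ ∘ suc) (h ∘ suc))
      (·-below (suc c) (a zero) {Θ (γ zero)} (θ-below (suc c) (h zero))))
    (⊗-below (suc c) (n ℕ.* c) {γ zero} {eigenvalue (γ ∘ suc) (a ∘ suc)} (h zero)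
      (eigenvalue-below c (γ ∘ suc) (a ∘ suc) (h ∘ suc)))

  module Separation (t : ℕ) {n : ℕ} (γ : Fin n → Poly)
    (comaximal : ∀ {i j} → i ≢ j → Comaximal (γ i) (γ j))
    (γ-deg : ∀ i → ∃[ e ] HasDeg (suc e) (γ i)) where

    γ≉𝟘 : ∀ i → ¬ γ i ≈ 𝟘
    γ≉𝟘 i = hasDeg≉𝟘 {a = γ i} (proj₂ (γ-deg i))

    monomial≉𝟘 : ∀ a → ¬ monomial γ a ≈ 𝟘
    monomial≉𝟘 a = product-nonzero (λ i → γ i ^ a i) (λ i → ^-nonzero (γ≉𝟘 i) (a i))

    low-degree : ∀ i R → Below t R → γ i ^ t ∣ R → R ≈ 𝟘
    low-degree i R R-below (q , q⊗γᵗ≈R) with degree q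
    ... | inj₁ q≈0     = ≈-trans (≈-sym q⊗γᵗ≈R) (≈-trans (⊗-congʳ {γ i ^ t} q≈0) (⊗-zeroˡ (γ i ^ t)))
    ... | inj₂ (k , d) = ⊥-elim (ℕ.<⇒≱ (hasDeg-below {a = R}
      (hasDeg-≈ {a = q ⊗ γ i ^ t} q⊗γᵗ≈R (hasDeg-⊗ {a = q} {γ i ^ t} d (hasDeg-^ {a = γ i} (proj₂ (γ-deg i)) t)))
      R-below) (ℕ.≤-trans (ℕ.≤-trans (ℕ.≤-reflexive (sym (ℕ.*-identityʳ t)))
        (ℕ.*-monoʳ-≤ t (s≤s z≤n))) (ℕ.m≤n+m _ k)))

  module _ (t : ℕ) {n : ℕ} (γ : Fin (suc n) → Poly)
    (comaximal : ∀ {i j} → i ≢ j → Comaximal (γ i) (γ j))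
    (γ-deg : ∀ i → ∃[ e ] HasDeg (suc e) (γ i)) where
    open Separation t γ comaximal γ-deg

    -- After cancelling γᵢ ^ (t aᵢ), the right side still contains γᵢ ^ t because the exponents
    -- differ by a multiple of t. It is comaximal to the remaining factors on the left, so it
    -- divides R, whose degree is below t.
    smaller-exponent : ∀ (a b : Fin (suc n) → ℕ) i → a i < b i → ∀ R S → Below t R →
      R ⊗ monomial γ (λ j → t ℕ.* a j) ≈ S ⊗ monomial γ (λ j → t ℕ.* b j) → R ≈ 𝟘
    smaller-exponent a b i ai<bi R S R-below eq = low-degree i R R-below
      (comaximal-∣ (comaximal-product U-factor λ j →
          comaximal-^^ (comaximal (λ i≡ → Fin.punchInᵢ≢i i j (sym i≡))) t (t ℕ.* a (punchIn i j)))
        (S ⊗ (γ i ^ k ⊗ U b) , ≈-sym cancelled))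
      where
      k : ℕ
      k = t ℕ.* (b i ℕ.∸ suc (a i))
      U : (Fin (suc n) → ℕ) → Poly
      U c = product (λ j → γ (punchIn i j) ^ (t ℕ.* c (punchIn i j)))
      U-factor : Fin n → Poly
      U-factor j = γ (punchIn i j) ^ (t ℕ.* a (punchIn i j))
      split : ∀ c → monomial γ (λ j → t ℕ.* c j) ≈ γ i ^ (t ℕ.* c i) ⊗ U c
      split c = product-remove {i = i} (λ j → γ j ^ (t ℕ.* c j))
      exponent : t ℕ.* b i ≡ t ℕ.* a i ℕ.+ (t ℕ.+ k)
      exponent = begin
        t ℕ.* b i ≡⟨ cong (t ℕ.*_) (ℕ.m+[n∸m]≡n ai<bi) ⟨
        t ℕ.* (suc (a i) ℕ.+ (b i ℕ.∸ suc (a i))) ≡⟨ ℕ.*-distribˡ-+ t (suc (a i)) _ ⟩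
        t ℕ.* suc (a i) ℕ.+ k ≡⟨ cong (ℕ._+ k) (trans (ℕ.*-suc t (a i)) (ℕ.+-comm t _)) ⟩
        t ℕ.* a i ℕ.+ t ℕ.+ k ≡⟨ ℕ.+-assoc (t ℕ.* a i) t k ⟩
        t ℕ.* a i ℕ.+ (t ℕ.+ k) ∎
        where open ≡-Reasoning
      powers : γ i ^ (t ℕ.* b i) ≈ γ i ^ (t ℕ.* a i) ⊗ (γ i ^ t ⊗ γ i ^ k)
      powers = ≈-trans (≈-reflexive (cong (γ i ^_) exponent)) (≈-trans (^-homo-* (γ i) (t ℕ.* a i) (t ℕ.+ k))
        (⊗-congˡ {γ i ^ (t ℕ.* a i)} (^-homo-* (γ i) t k)))
      cancelled : R ⊗ U a ≈ S ⊗ (γ i ^ k ⊗ U b) ⊗ γ i ^ t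
      cancelled = ⊗-cancelˡ {γ i ^ (t ℕ.* a i)} (^-nonzero (γ≉𝟘 i) (t ℕ.* a i)) (let open PR in begin
        γ i ^ (t ℕ.* a i) ⊗ (R ⊗ U a)
          ≈⟨ solve 3 (λ x r u → x :* (r :* u) := r :* (x :* u)) ≈-refl (γ i ^ (t ℕ.* a i)) R (U a) ⟩
        R ⊗ (γ i ^ (t ℕ.* a i) ⊗ U a)
          ≈⟨ ⊗-congˡ {R} (≈-sym (split a)) ⟩
        R ⊗ monomial γ (λ j → t ℕ.* a j)
          ≈⟨ eq ⟩
        S ⊗ monomial γ (λ j → t ℕ.* b j)
          ≈⟨ ⊗-congˡ {S} (≈-trans (split b) (⊗-congʳ {U b} powers)) ⟩
        S ⊗ (γ i ^ (t ℕ.* a i) ⊗ (γ i ^ t ⊗ γ i ^ k) ⊗ U b)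
          ≈⟨ solve 5 (λ s x y z u → s :* (x :* (y :* z) :* u)
               := x :* (s :* (z :* u) :* y)) ≈-refl S (γ i ^ (t ℕ.* a i)) (γ i ^ t) (γ i ^ k) (U b) ⟩
        γ i ^ (t ℕ.* a i) ⊗ (S ⊗ (γ i ^ k ⊗ U b) ⊗ γ i ^ t) ∎)

    separated : ∀ (a b : Fin (suc n) → ℕ) i → a i ≢ b i → ∀ R S → Below t R → Below t S →
      R ⊗ monomial γ (λ j → t ℕ.* a j) ≈ S ⊗ monomial γ (λ j → t ℕ.* b j) → R ≈ 𝟘
    separated a b i ai≢bi R S R-below S-below eq with ℕ.<-cmp (a i) (b i)
    ... | tri< ai<bi _ _ = smaller-exponent a b i ai<bi R S R-below eq
    ... | tri≈ _ ai≡bi _ = ⊥-elim (ai≢bi ai≡bi)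
    ... | tri> _ _ bi<ai = decidable-stable (≈𝟘? R) λ R≉0 →
      ⊗-nonzero {R} R≉0 (monomial≉𝟘 (λ j → t ℕ.* a j))
        (≈-trans eq (≈-trans (⊗-congʳ {monomial γ (λ j → t ℕ.* b j)}
          (smaller-exponent b a i bi<ai S R S-below (≈-sym eq))) (⊗-zeroˡ _)))

-- Lagrange's theorem for a subgroup of the multiplicative group

module Lagrange {p : ℕ} .{{_ : NonZero p}} (p-prime : Prime p) where

  open Composition p-prime public
  open import Data.Fin.Subset using (_∈_; inside; outside)
  open import Data.Vec.Base using ([]; _∷_; lookup)
  open CommutativeRing baseRing
    using (*-commutativeMonoid; *-assoc; *-comm; *-identityˡ; *-identityʳ; semiring)
  open import Algebra.Properties.Semiring.Exp semiring public using () renaming (_^_ to _^ᶠ_)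
  open import Algebra.Properties.CommutativeMonoid.Sum *-commutativeMonoid
    using () renaming (sum to ∏; sum-permute to ∏-permute; ∑-distrib-+ to ∏-distrib-*; sum-cong-≗ to ∏-cong)

  ∏-constant-on : ∀ {n} (G : Subset n) x → ∏ (λ a → if lookup G a then x else 1ₚ) ≡ x ^ᶠ ∣ G ∣
  ∏-constant-on []             x = refl
  ∏-constant-on (inside  ∷ G)  x = cong (x *ₚ_) (∏-constant-on G x)
  ∏-constant-on (outside ∷ G)  x = trans (*-identityˡ _) (∏-constant-on G x)

  ∏-nonzero : ∀ {n} (v : Fin n → Fin p) → (∀ i → v i ≢ 0ₚ) → ∏ v ≢ 0ₚ
  ∏-nonzero {zero}  v h eq = Residues.0≢1 p-prime (sym eq)
  ∏-nonzero {suc n} v h = *-nonzero (h zero) (∏-nonzero (v ∘ suc) (h ∘ suc))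

  module _ {G : Subset p} (subgroup : IsSubgroup G) where
    open IsSubgroup subgroup

    -- Multiplication by x permutes the elements of G, so it preserves their product.
    ^-order : ∀ {x} → x ∈ G → x ^ᶠ ∣ G ∣ ≡ 1ₚ
    ^-order {x} x∈G = *-cancelʳ (∏-nonzero χ χ≢0) (begin
      x ^ᶠ ∣ G ∣ *ₚ ∏ χ ≡⟨ cong (_*ₚ ∏ χ) (∏-constant-on G x) ⟨
      ∏ (λ a → if lookup G a then x else 1ₚ) *ₚ ∏ χ ≡⟨ ∏-distrib-* (λ a → if lookup G a then x else 1ₚ) χ ⟨
      ∏ (λ a → (if lookup G a then x else 1ₚ) *ₚ χ a) ≡⟨ ∏-cong translated ⟨
      ∏ (λ a → χ (x *ₚ a)) ≡⟨ ∏-permute χ (permutation (x *ₚ_) (y *ₚ_) (inverseˡ x y xy≡1) (inverseˡ y x (trans (*-comm y x) xy≡1))) ⟨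
      ∏ χ ≡⟨ *-identityˡ (∏ χ) ⟨
      1ₚ *ₚ ∏ χ ∎)
      where
      open ≡-Reasoning
      y : Fin p
      y = proj₁ (⁻¹-closed x∈G)
      y∈G : y ∈ G
      y∈G = proj₁ (proj₂ (⁻¹-closed x∈G))
      xy≡1 : x *ₚ y ≡ 1ₚ
      xy≡1 = proj₂ (proj₂ (⁻¹-closed x∈G))
      inverseˡ : ∀ x y → x *ₚ y ≡ 1ₚ → ∀ a → x *ₚ (y *ₚ a) ≡ a
      inverseˡ x y xy≡1 a = trans (sym (*-assoc x y a)) (trans (cong (_*ₚ a) xy≡1) (*-identityˡ a))
      χ : Fin p → Fin p
      χ a = if lookup G a then a else 1ₚ
      χ≢0 : ∀ a → χ a ≢ 0ₚ
      χ≢0 a with lookup G a in eq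
      ... | true  = nonzero (lookup⇒[]= a G eq)
      ... | false = λ 1≡0 → Residues.0≢1 p-prime (sym 1≡0)
      translated : ∀ a → χ (x *ₚ a) ≡ (if lookup G a then x else 1ₚ) *ₚ χ a
      translated a with lookup G a in eq | lookup G (x *ₚ a) in eq′
      ... | true  | true  = refl
      ... | false | false = sym (*-identityˡ 1ₚ)
      ... | true  | false = case (trans (sym eq′) ([]=⇒lookup (*-closed x∈G (lookup⇒[]= a G eq)))) of λ ()
      ... | false | true  = case (trans (sym eq) ([]=⇒lookup (subst (_∈ G) (inverseˡ y x (trans (*-comm y x) xy≡1) a)
              (*-closed y∈G (lookup⇒[]= (x *ₚ a) G eq′))))) of λ ()
      *-cancelʳ : ∀ {a b c} → c ≢ 0ₚ → a *ₚ c ≡ b *ₚ c → a ≡ b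
      *-cancelʳ {a} {b} {c} c≢0 eq = let (z , cz≡1) = Residues.inverse p-prime c c≢0 in begin
        a ≡⟨ *-identityʳ a ⟨
        a *ₚ 1ₚ ≡⟨ cong (a *ₚ_) cz≡1 ⟨
        a *ₚ (c *ₚ z) ≡⟨ *-assoc a c z ⟨
        (a *ₚ c) *ₚ z ≡⟨ cong (_*ₚ z) eq ⟩
        (b *ₚ c) *ₚ z ≡⟨ *-assoc b c z ⟩
        b *ₚ (c *ₚ z) ≡⟨ cong (b *ₚ_) cz≡1 ⟩
        b *ₚ 1ₚ ≡⟨ *-identityʳ b ⟩
        b ∎

-- The iterates of f, and the points with prescribed shifts in G

module OrbitCount {p : ℕ} .{{_ : NonZero p}} (p-prime : Prime p)
  (f : List (Fin p)) (d : ℕ) (1≤d : 1 ≤ d) (f-deg : HasDegree f d) where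

  open Lagrange p-prime
  open import Data.Fin.Subset using (_∈_)
  open CommutativeRing baseRing
    using (+-identityʳ; zeroˡ)

  iter : ℕ → Poly
  iter zero    = X
  iter (suc k) = compose f (iter k)

  ⟦iter⟧ : ∀ k x → ⟦ iter k ⟧ x ≡ orbit f x k
  ⟦iter⟧ zero    x = ⟦X⟧ x
  ⟦iter⟧ (suc k) x = trans (⟦compose⟧ f (iter k) x) (cong (eval f) (⟦iter⟧ k x))

  iter-hasDeg : ∀ k → ∃[ e ] d ℕ.^ k ≡ suc e × HasDeg (suc e) (iter k)
  iter-hasDeg zero    = 0 , refl , (λ eq → Residues.0≢1 p-prime (sym eq)) , λ i h → finite X i h
  iter-hasDeg (suc k) = let (e , dᵏ≡ , deg) = iter-hasDeg k
                            e′ = ℕ.pred (d ℕ.* suc e)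
                            instance
                              d≢0 : NonZero d
                              d≢0 = ℕ.>-nonZero 1≤d
                              d*e≢0 : NonZero (d ℕ.* suc e)
                              d*e≢0 = ℕ.m*n≢0 d (suc e)
                            eq = sym (ℕ.suc-pred (d ℕ.* suc e))
                        in e′ , trans (cong (d ℕ.*_) dᵏ≡) eq ,
                           subst (λ n → HasDeg n (iter (suc k))) eq (compose-hasDeg f d {g = iter k} f-deg deg)

  iter-mod : ∀ k m → ∃[ q ] iter (m ℕ.+ k) ≈ iter k ⊗ q ⊕ C (orbit f 0ₚ m)
  iter-mod k zero    = 𝟙 , ≈-sym (≈-trans (⊕-cong (⊗-identityʳ (iter k)) (mk≈ λ { zero → refl ; (suc _) → refl })) (⊕-identityʳ (iter k)))
  iter-mod k (suc m) = compose-mod f (proj₂ (iter-mod k m))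

  iter-comaximal : ∀ {L} → (∀ m → 0 < m → m < L → orbit f 0ₚ m ≢ 0ₚ) →
    ∀ {i j} → i < L → j < L → i ≢ j → Comaximal (iter i) (iter j)
  iter-comaximal {L} nonzero {i} {j} i<L j<L i≢j with ℕ.<-cmp i j
  ... | tri< i<j _ _ = ordered i j i<j j<L
    where
    ordered : ∀ i j → i < j → j < L → Comaximal (iter i) (iter j)
    ordered i j i<j j<L = unit-remainder⇒comaximal
      (nonzero (j ℕ.∸ i) (ℕ.m<n⇒0<n∸m i<j) (ℕ.≤-<-trans (ℕ.m∸n≤m j i) j<L))
      (subst (λ k → iter k ≈ iter i ⊗ proj₁ (iter-mod i (j ℕ.∸ i)) ⊕ C (orbit f 0ₚ (j ℕ.∸ i)))
        (ℕ.m∸n+n≡m (ℕ.<⇒≤ i<j)) (proj₂ (iter-mod i (j ℕ.∸ i))))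
  ... | tri≈ _ i≡j _ = ⊥-elim (i≢j i≡j)
  ... | tri> _ _ j<i = comaximal-sym (unit-remainder⇒comaximal
      (nonzero (i ℕ.∸ j) (ℕ.m<n⇒0<n∸m j<i) (ℕ.≤-<-trans (ℕ.m∸n≤m i j) i<L))
      (subst (λ k → iter k ≈ iter j ⊗ proj₁ (iter-mod j (i ℕ.∸ j)) ⊕ C (orbit f 0ₚ (i ℕ.∸ j)))
        (ℕ.m∸n+n≡m (ℕ.<⇒≤ j<i)) (proj₂ (iter-mod j (i ℕ.∸ j)))))

  coef-0≡⟦⟧0 : ∀ a → coef a 0 ≡ ⟦ a ⟧ 0ₚ
  coef-0≡⟦⟧0 a = sym (trans (⟦⟧-below (suc (bound a)) a (λ i h → finite a i (ℕ.≤-trans (ℕ.n≤1+n _) h)) 0ₚ)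
    (trans (cong (coef a 0 +ₚ_) (zeroˡ _)) (+-identityʳ _)))

  ⟦^⟧-homo : ∀ a n x → ⟦ a ^ n ⟧ x ≡ ⟦ a ⟧ x ^ᶠ n
  ⟦^⟧-homo a zero    x = ⟦C⟧ 1ₚ x
  ⟦^⟧-homo a (suc n) x = trans (⟦⊗⟧ a (a ^ n) x) (cong (⟦ a ⟧ x *ₚ_) (⟦^⟧-homo a n x))

  Θ-X^ : ∀ n → Θ (X ^ n) ≈ (n · 𝟙) ⊗ X ^ n
  Θ-X^ zero    = ≈-trans (Θ-C 1ₚ) (≈-sym (⊗-zeroˡ 𝟙))
  Θ-X^ (suc n) = ≈-trans (Θ-⊗ X (X ^ n)) (≈-trans (⊕-cong (⊗-congʳ {X ^ n} Θ-X) (⊗-congˡ {X} (Θ-X^ n)))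
    (≈-trans (solve 3 (λ x n y → x :* y :+ x :* (n :* y)
        := x :* y :+ n :* (x :* y)) ≈-refl X (n · 𝟙) (X ^ n))
      (≈-trans (⊕-congʳ {(n · 𝟙) ⊗ (X ⊗ X ^ n)} (≈-sym (⊗-identityˡ (X ⊗ X ^ n)))) (≈-sym (⊗-distribʳ (X ⊗ X ^ n) 𝟙 (n · 𝟙))))))

  module _ {L : ℕ} (nonzero : ∀ m → 0 < m → m < L → orbit f 0ₚ m ≢ 0ₚ)
    {ν : ℕ} (κ : Fin ν → ℕ) (κ>0 : ∀ i → 0 < κ i) (κ<L : ∀ i → κ i < L)
    (κ-injective : ∀ {i j} → κ i ≡ κ j → i ≡ j)
    (c : ℕ) (degree≤c : ∀ k → k < L → d ℕ.^ k ≤ c) (0<L : 0 < L)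
    {G : Subset p} (subgroup : IsSubgroup G) (B : ℕ) where

    -- A monomial is indexed by k < B ^ s, whose s digits in base B, times t, are its exponents. W
    -- bounds the degrees of `g` and of the eigenvalues, H those of the monomials.
    t s K W H : ℕ
    t = ∣ G ∣
    s = suc ν
    K = B ℕ.^ s
    W = s ℕ.* c
    H = s ℕ.* (t ℕ.* B ℕ.* c)

    κ₀ : Fin s → ℕ
    κ₀ zero    = 0
    κ₀ (suc i) = κ i

    κ₀<L : ∀ i → κ₀ i < L
    κ₀<L zero    = 0<L
    κ₀<L (suc i) = κ<L i

    κ₀-injective : ∀ {i j} → κ₀ i ≡ κ₀ j → i ≡ j
    κ₀-injective {zero}  {zero}  eq = refl
    κ₀-injective {zero}  {suc j} eq = ⊥-elim (ℕ.<⇒≢ (κ>0 j) eq)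
    κ₀-injective {suc i} {zero}  eq = ⊥-elim (ℕ.<⇒≢ (κ>0 i) (sym eq))
    κ₀-injective {suc i} {suc j} eq = cong suc (κ-injective eq)

    γ : Fin s → Poly
    γ i = iter (κ₀ i)

    -- The iterate γ₀ = X is left out: Θ X / X = 1 has no denominator to clear, and the indicial
    -- argument needs g(0) ≠ 0, which a factor X would destroy.
    g : Poly
    g = product (γ ∘ suc)

    γ-below : ∀ i → Below (suc c) (γ i)
    γ-below i = let (e , dᵏ≡ , deg) = iter-hasDeg (κ₀ i) in
      below-mono (γ i) (s≤s (subst (_≤ c) dᵏ≡ (degree≤c (κ₀ i) (κ₀<L i)))) (proj₂ deg)

    γ-comaximal : ∀ {i j} → i ≢ j → Comaximal (γ i) (γ j)
    γ-comaximal {i} {j} i≢j = iter-comaximal nonzero (κ₀<L i) (κ₀<L j) (i≢j ∘ κ₀-injective)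

    γ-deg : ∀ i → ∃[ e ] HasDeg (suc e) (γ i)
    γ-deg i = let (e , _ , deg) = iter-hasDeg (κ₀ i) in e , deg

    g₀≢0 : coef g 0 ≢ 0ₚ
    g₀≢0 eq = ⟦product⟧-nonzero (γ ∘ suc)
      (λ i γ≡0 → nonzero (κ i) (κ>0 i) (κ<L i) (trans (sym (⟦iter⟧ (κ i) 0ₚ)) γ≡0))
      (trans (sym (coef-0≡⟦⟧0 g)) eq)

    exponent : Fin K → Fin s → ℕ
    exponent k i = t ℕ.* toℕ (finToFun {B} {s} k i)

    eigenvalue₀ : Fin K → Poly
    eigenvalue₀ k = (exponent k zero · 𝟙) ⊗ g ⊕ eigenvalue (γ ∘ suc) (exponent k ∘ suc)

    νc≤W : ν ℕ.* c ≤ W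
    νc≤W = ℕ.m≤n+m (ν ℕ.* c) c

    family : Family (Residues.char p-prime) g g₀≢0 K W H t
    family = record
      { h       = λ k → monomial γ (exponent k)
      ; e       = eigenvalue₀
      ; eigen   = eigen
      ; g-below = below-mono g (s≤s νc≤W) g-below
      ; e-below = λ k → below-mono (eigenvalue₀ k) (s≤s νc≤W)
          (⊕-below (suc (ν ℕ.* c)) {(exponent k zero · 𝟙) ⊗ g} {eigenvalue (γ ∘ suc) (exponent k ∘ suc)}
            (⊗-below 1 (ν ℕ.* c) {exponent k zero · 𝟙} {g} (·-below 1 (exponent k zero) {𝟙} (finite 𝟙)) g-below)
            (eigenvalue-below c (γ ∘ suc) (exponent k ∘ suc) (γ-below ∘ suc)))
      ; h-below = λ k → product-below (t ℕ.* B ℕ.* c) (λ i → γ i ^ exponent k i) λ i →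
          below-mono (γ i ^ exponent k i)
            (s≤s (ℕ.*-monoˡ-≤ c (ℕ.*-monoʳ-≤ t (ℕ.<⇒≤ (Fin.toℕ<n (finToFun {B} {s} k i))))))
            (^-below {a = γ i} (γ-below i) (exponent k i))
      ; h≉𝟘     = λ k → Separation.monomial≉𝟘 t γ γ-comaximal γ-deg (exponent k)
      ; separated = λ {k} {l} k≢l → let (i , differ) = finToFun-injective {B} {s} k l k≢l in
          separated t γ γ-comaximal γ-deg (λ j → toℕ (finToFun {B} {s} k j)) (λ j → toℕ (finToFun {B} {s} l j))
            i (λ eq → differ (Fin.toℕ-injective eq))
      }
      where
      g-below : Below (suc (ν ℕ.* c)) g
      g-below = product-below c (γ ∘ suc) (γ-below ∘ suc)
      eigen : ∀ k → g ⊗ Θ (monomial γ (exponent k)) ≈ eigenvalue₀ k ⊗ monomial γ (exponent k)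
      eigen k = begin
        g ⊗ Θ (X ^ a ⊗ h)
          ≈⟨ ⊗-congˡ {g} (≈-trans (Θ-⊗ (X ^ a) h) (⊕-congʳ {X ^ a ⊗ Θ h} (⊗-congʳ {h} (Θ-X^ a)))) ⟩
        g ⊗ ((a · 𝟙) ⊗ X ^ a ⊗ h ⊕ X ^ a ⊗ Θ h)
          ≈⟨ solve 5 (λ g n x h v → g :* (n :* x :* h :+ x :* v)
               := n :* g :* (x :* h) :+ x :* (g :* v)) ≈-refl g (a · 𝟙) (X ^ a) h (Θ h) ⟩
        (a · 𝟙) ⊗ g ⊗ (X ^ a ⊗ h) ⊕ X ^ a ⊗ (g ⊗ Θ h)
          ≈⟨ ⊕-congˡ {(a · 𝟙) ⊗ g ⊗ (X ^ a ⊗ h)} (⊗-congˡ {X ^ a} (monomial-eigen (γ ∘ suc) (exponent k ∘ suc))) ⟩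
        (a · 𝟙) ⊗ g ⊗ (X ^ a ⊗ h) ⊕ X ^ a ⊗ (e ⊗ h)
          ≈⟨ solve 4 (λ m x h e → m :* (x :* h) :+ x :* (e :* h)
               := (m :+ e) :* (x :* h)) ≈-refl ((a · 𝟙) ⊗ g) (X ^ a) h e ⟩
        eigenvalue₀ k ⊗ (X ^ a ⊗ h) ∎
        where
        open PR
        a : ℕ
        a = exponent k zero
        h e : Poly
        h = monomial (γ ∘ suc) (exponent k ∘ suc)
        e = eigenvalue (γ ∘ suc) (exponent k ∘ suc)

    -- Elements of G are nonzero, so neither x nor g x vanishes, and their t-th powers are 1, so
    -- every monomial takes the value 1 at x.
    orbit-count : ∀ A M → K ℕ.* (A ℕ.+ K ℕ.* W) < t → A ℕ.+ H ≤ p → M ≤ p →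
      M ℕ.* (A ℕ.+ M ℕ.* W) < K ℕ.* A →
      (xs : List (Fin p)) → Unique xs →
      (∀ {x} → x List.∈ xs → x ∈ G × (∀ i → orbit f x (κ i) ∈ G)) →
      M ℕ.* length xs < A ℕ.+ H
    orbit-count A M separation A+H≤p M≤p count xs unique good =
      stepanov (Residues.char p-prime) g g₀≢0 family A separation A+H≤p M M≤p count xs unique λ {x} x∈ →
        let (x∈G , fx∈G) = good x∈ in
        nonzero-G x∈G ,
        ⟦product⟧-nonzero (γ ∘ suc) (λ i eq → nonzero-G (fx∈G i) (trans (sym (⟦iter⟧ (κ i) x)) eq)) ,
        λ k → ⟦product⟧ (λ i → γ i ^ exponent k i) λ i →
          trans (⟦⟧-cong (≈-sym (^-assocʳ (γ i) t (toℕ (finToFun {B} {s} k i)))) x)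
            (⟦^⟧ {γ i ^ t} (trans (⟦^⟧-homo (γ i) t x)
              (trans (cong (_^ᶠ t) (⟦iter⟧ (κ₀ i) x)) (^-order subgroup (orbit∈G x∈G fx∈G i)))) (toℕ (finToFun {B} {s} k i)))
      where
      nonzero-G : ∀ {x} → x ∈ G → x ≢ 0ₚ
      nonzero-G = IsSubgroup.nonzero subgroup
      orbit∈G : ∀ {x} → x ∈ G → (∀ i → orbit f x (κ i) ∈ G) → ∀ i → orbit f x (κ₀ i) ∈ G
      orbit∈G x∈G fx∈G zero    = x∈G
      orbit∈G x∈G fx∈G (suc i) = fx∈G i

-- Elementary inequalities and the choice of the parameters

module Frequencies where

  open import Data.Bool.Base using (Bool; T; _∧_)
  open import Data.Bool.Properties using (T-∧; T-≡)
  open import Data.Fin.Subset using (_∈_; _∩_; _∪_; ⋃; ⁅_⁆)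
  open import Data.Fin.Subset.Properties
  open import Data.Nat.Base
  open import Data.Nat.DivMod using (_/_; _%_; m/n*n≤m; m*n/n≡m; /-monoˡ-≤; /-mono-≤; m≡m%n+[m/n]*n; m%n<n)
  open import Data.Nat.Properties
  open import Data.Nat.Solver using (module +-*-Solver)
  import Data.List.Relation.Unary.Unique.Propositional.Properties as Unique
  open import Data.Sum.Base using ([_,_]′)
  open import Data.Unit.Base using (tt)
  open import Data.Vec.Base using ([]; _∷_; lookup)
  open import Function.Bundles using (Equivalence)
  open ≤-Reasoning
  open +-*-Solver using (solve; _:+_; _:*_; _:=_; con)

  last-below : ∀ (f : ℕ → ℕ) m n → f 0 ≤ m → m < f n → ∃[ k ] f k ≤ m × m < f (suc k)
  last-below f m zero    f0≤m m<f0 = ⊥-elim (<⇒≱ m<f0 f0≤m)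
  last-below f m (suc n) f0≤m m<fn with f n ≤? m
  ... | yes fn≤m = n , fn≤m , m<fn
  ... | no  fn≰m = last-below f m n f0≤m (≰⇒> fn≰m)

  ^-cancelʳ-≤ : ∀ r {m n} → m ^ suc r ≤ n ^ suc r → m ≤ n
  ^-cancelʳ-≤ r {m} {n} h with m ≤? n
  ... | yes m≤n = m≤n
  ... | no  m≰n = ⊥-elim (<⇒≱ (^-monoˡ-< (suc r) (≰⇒> m≰n)) h)

  ^-distribʳ-* : ∀ o m n → (m * n) ^ o ≡ m ^ o * n ^ o
  ^-distribʳ-* zero    m n = refl
  ^-distribʳ-* (suc o) m n = trans (cong (m * n *_) (^-distribʳ-* o m n))
    (solve 4 (λ m n x y → m :* n :* (x :* y) := m :* x :* (n :* y)) refl m n (m ^ o) (n ^ o))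

  n<2^n : ∀ n → n < 2 ^ n
  n<2^n zero    = s≤s z≤n
  n<2^n (suc n) = begin-strict
    suc n ≡⟨ +-comm 1 n ⟩
    n + 1 <⟨ +-mono-<-≤ (n<2^n n) (m^n>0 2 n) ⟩
    2 ^ n + 2 ^ n ≡⟨ cong (2 ^ n +_) (+-identityʳ (2 ^ n)) ⟨
    2 ^ suc n ∎

  -- In the application c = dᴸ bounds the degrees of the iterates, and Y = c² is about
  -- N ^ (1 / J). The number K = Bˢ of monomials is maximal such that K² Y² ≤ t.
  module Parameters (r′ J : ℕ) (11r≤J : 11 * suc r′ ≤ J) {c L N t p : ℕ}
    (L<c : L < c) (16s≤L : 16 * suc J ≤ L) (2^L≤c : 2 ^ L ≤ c)
    (Yᴶ≤N : (c * c) ^ J ≤ N) (N<Yᴶ⁺¹ : N < (c * c) ^ suc J) (N≤p : N ≤ p)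
    (N<tʳ : N < t ^ suc r′) (tʳ<N²ʳ⁻¹ : t ^ suc r′ < N ^ (r′ + suc r′))
    (tʳ<pʳ⁻¹ : t ^ suc r′ < p ^ r′) where

    r s Y W : ℕ
    r = suc r′
    s = suc J
    Y = c * c
    W = s * c

    private
      instance
        c≢0 : NonZero c
        c≢0 = >-nonZero (≤-trans (s≤s z≤n) L<c)
        Y≢0 : NonZero Y
        Y≢0 = m*n≢0 c c
        N≢0 : NonZero N
        N≢0 = >-nonZero (≤-trans (m^n>0 Y J) Yᴶ≤N)

    16W≤Y : 16 * W ≤ Y
    16W≤Y = begin
      16 * (s * c) ≡⟨ *-assoc 16 s c ⟨
      16 * s * c ≤⟨ *-monoˡ-≤ c (≤-trans 16s≤L (<⇒≤ L<c)) ⟩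
      c * c ∎

    2^2s≤Y : 2 ^ (s + s) ≤ Y
    2^2s≤Y = begin
      2 ^ (s + s) ≤⟨ ^-monoʳ-≤ 2 (≤-trans (+-monoʳ-≤ s (m≤m+n s (14 * s))) 16s≤L) ⟩
      2 ^ L ≤⟨ 2^L≤c ⟩
      c ≤⟨ m≤m*n c c ⟩
      Y ∎

    -- In terms of exponents: Y ≤ N ^ (1 / J) and 11 r ≤ J, so up to eleven factors Y fit into the
    -- margin N ^ (1 / r) that ε provides.
    Y^kr≤N : ∀ k → k ≤ 11 → Y ^ (k * r) ≤ N
    Y^kr≤N k k≤11 = ≤-trans (^-monoʳ-≤ Y (≤-trans (*-monoˡ-≤ r k≤11) 11r≤J)) Yᴶ≤N

    power : ∀ k → (Y ^ k) ^ r ≡ Y ^ (k * r)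
    power k = ^-*-assoc Y k r

    Y³<t : Y ^ 3 < t
    Y³<t = ≰⇒> λ t≤Y³ → <⇒≱ N<tʳ (begin
      t ^ r ≤⟨ ^-monoˡ-≤ r t≤Y³ ⟩
      (Y ^ 3) ^ r ≡⟨ power 3 ⟩
      Y ^ (3 * r) ≤⟨ Y^kr≤N 3 (s≤s (s≤s (s≤s z≤n))) ⟩
      N ∎)

    private
      -- This is K² Y² for the base B = 2 + k. The offset guarantees B ≥ 2, hence K ≥ 4 and M ≥ 1;
      -- the search can start there because Y ^ 3 < t.
      F : ℕ → ℕ
      F k = (2 + k) ^ (s + s) * Y ^ 2

      F0≤t : F 0 ≤ t
      F0≤t = begin
        2 ^ (s + s) * Y ^ 2 ≤⟨ *-monoˡ-≤ (Y ^ 2) 2^2s≤Y ⟩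
        Y ^ 3 ≤⟨ <⇒≤ Y³<t ⟩
        t ∎

      t<Ft : t < F t
      t<Ft = begin-strict
        t <⟨ m<n+m t {2} (s≤s z≤n) ⟩
        2 + t ≤⟨ m≤m*n (2 + t) ((2 + t) ^ (J + s)) {{m^n≢0 (2 + t) (J + s)}} ⟩
        (2 + t) ^ (s + s) ≤⟨ m≤m*n ((2 + t) ^ (s + s)) (Y ^ 2) {{m^n≢0 Y 2}} ⟩
        F t ∎

      searched = last-below F t t F0≤t t<Ft

    -- With A = M W the number M (A + M W) of conditions is 2 M A, whereas M = K / 4 makes the
    -- number K A of unknowns at least 4 M A.
    B K M A H : ℕ
    B = 2 + proj₁ searched
    K = B ^ s
    M = K / 4
    A = M * W
    H = s * (t * B * c)

    private
      instance
        K≢0 : NonZero K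
        K≢0 = m^n≢0 B s

      K²≡ : K * K ≡ B ^ (s + s)
      K²≡ = sym (^-distribˡ-+-* B s s)

    K²Y²≤t : K * K * Y ^ 2 ≤ t
    K²Y²≤t = subst (λ x → x * Y ^ 2 ≤ t) (sym K²≡) (proj₁ (proj₂ searched))

    -- B + 1 already fails the search condition, and replacing it by 2 B costs a factor 2 ^ (2 s),
    -- which is at most Y.
    t≤K²Y³ : t ≤ K * K * Y ^ 3
    t≤K²Y³ = begin
      t ≤⟨ <⇒≤ (proj₂ (proj₂ searched)) ⟩
      suc B ^ (s + s) * Y ^ 2 ≤⟨ *-monoˡ-≤ (Y ^ 2) (^-monoˡ-≤ (s + s) 1+B≤2B) ⟩
      (2 * B) ^ (s + s) * Y ^ 2 ≡⟨ cong (_* Y ^ 2) (^-distribʳ-* (s + s) 2 B) ⟩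
      2 ^ (s + s) * B ^ (s + s) * Y ^ 2 ≤⟨ *-monoˡ-≤ (Y ^ 2) (*-monoˡ-≤ (B ^ (s + s)) 2^2s≤Y) ⟩
      Y * B ^ (s + s) * Y ^ 2 ≡⟨ cong (λ x → Y * x * Y ^ 2) K²≡ ⟨
      Y * (K * K) * Y ^ 2 ≡⟨ solve 3 (λ y k z → y :* k :* z := k :* (y :* z)) refl Y (K * K) (Y ^ 2) ⟩
      K * K * Y ^ 3 ∎
      where
      1+B≤2B : suc B ≤ 2 * B
      1+B≤2B = begin
        1 + B ≤⟨ +-monoˡ-≤ B {1} {B} (s≤s z≤n) ⟩
        B + B ≡⟨ cong (B +_) (+-identityʳ B) ⟨
        2 * B ∎

    -- B ^ (2 s) = K² ≤ t < N² < Y ^ (2 s), the last step because N < Y ^ s. So one digit of the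
    -- exponents raises degrees only by a factor Y.
    B≤Y : B ≤ Y
    B≤Y = ≮⇒≥ λ Y<B → <⇒≱ (begin-strict
      t ^ r <⟨ tʳ<N²ʳ⁻¹ ⟩
      N ^ (r′ + r) ≤⟨ ^-monoʳ-≤ N {r′ + r} {r + r} (n≤1+n _) ⟩
      N ^ (r + r) ≤⟨ ^-monoˡ-≤ (r + r) (<⇒≤ N<Yᴶ⁺¹) ⟩
      (Y ^ s) ^ (r + r) ≡⟨ ^-*-assoc Y s (r + r) ⟩
      Y ^ (s * (r + r)) ≡⟨ cong (Y ^_) (solve 2 (λ s r → s :* (r :+ r) := (s :+ s) :* r) refl s r) ⟩
      Y ^ ((s + s) * r) ≡⟨ power (s + s) ⟨
      (Y ^ (s + s)) ^ r ∎)
      (^-monoˡ-≤ r (begin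
        Y ^ (s + s) ≤⟨ ^-monoˡ-≤ (s + s) (<⇒≤ Y<B) ⟩
        B ^ (s + s) ≡⟨ K²≡ ⟨
        K * K ≤⟨ m≤m*n (K * K) (Y ^ 2) {{m^n≢0 Y 2}} ⟩
        K * K * Y ^ 2 ≤⟨ K²Y²≤t ⟩
        t ∎))

    4≤K : 4 ≤ K
    4≤K = begin
      2 * 2 ≤⟨ *-mono-≤ 2≤B (≤-trans 2≤B (m≤m*n B (B ^ (J ∸ 1)) {{m^n≢0 B (J ∸ 1)}})) ⟩
      B * B ^ suc (J ∸ 1) ≡⟨ cong (λ j → B * B ^ j) (m+[n∸m]≡n {1} {J} (≤-trans (s≤s z≤n) 11r≤J)) ⟩
      K ∎
      where
      2≤B : 2 ≤ B
      2≤B = s≤s (s≤s z≤n)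

    1≤M : 1 ≤ M
    1≤M = /-mono-≤ {o = 4} {p = 4} 4≤K ≤-refl

    4M≤K : 4 * M ≤ K
    4M≤K = ≤-trans (≤-reflexive (*-comm 4 M)) (m/n*n≤m K 4)

    K≤8M : K ≤ 8 * M
    K≤8M = begin
      K ≡⟨ m≡m%n+[m/n]*n K 4 ⟩
      K % 4 + M * 4 ≤⟨ +-monoˡ-≤ (M * 4) (≤-trans (<⇒≤ (m%n<n K 4)) (*-monoˡ-≤ 4 1≤M)) ⟩
      M * 4 + M * 4 ≡⟨ solve 1 (λ m → m :* con 4 :+ m :* con 4 := con 8 :* m) refl M ⟩
      8 * M ∎

    1≤W : 1 ≤ W
    1≤W = *-mono-≤ {1} {s} {1} {c} (s≤s z≤n) (>-nonZero⁻¹ c)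

    M≤K : M ≤ K
    M≤K = ≤-trans (m≤n*m M 4) 4M≤K

    K≤t : K ≤ t
    K≤t = begin
      K ≤⟨ m≤m*n K K ⟩
      K * K ≤⟨ m≤m*n (K * K) (Y ^ 2) {{m^n≢0 Y 2}} ⟩
      K * K * Y ^ 2 ≤⟨ K²Y²≤t ⟩
      t ∎

    separation : K * (A + K * W) < t
    separation = begin-strict
      K * (M * W + K * W) ≤⟨ *-monoʳ-≤ K (+-monoˡ-≤ (K * W) (*-monoˡ-≤ W M≤K)) ⟩
      K * (K * W + K * W) ≡⟨ solve 2 (λ k w → k :* (k :* w :+ k :* w) := k :* k :* (con 2 :* w)) refl K W ⟩
      K * K * (2 * W) <⟨ *-monoʳ-< (K * K) {{m*n≢0 K K}} 2W<Y² ⟩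
      K * K * Y ^ 2 ≤⟨ K²Y²≤t ⟩
      t ∎
      where
      2W<Y² : 2 * W < Y ^ 2
      2W<Y² = begin-strict
        2 * W <⟨ *-monoˡ-< W {{>-nonZero 1≤W}} {2} {16} (s≤s (s≤s (s≤s z≤n))) ⟩
        16 * W ≤⟨ 16W≤Y ⟩
        Y ≤⟨ m≤m*n Y (Y ^ 1) {{m^n≢0 Y 1}} ⟩
        Y ^ 2 ∎

    A+H≤2tBW : A + H ≤ t * B * (2 * W)
    A+H≤2tBW = begin
      M * W + s * (t * B * c) ≤⟨ +-monoˡ-≤ (s * (t * B * c)) (*-monoˡ-≤ W (≤-trans M≤K (≤-trans K≤t (m≤m*n t B)))) ⟩
      t * B * W + s * (t * B * c) ≡⟨ solve 3 (λ x s c → x :* (s :* c) :+ s :* (x :* c) := x :* (con 2 :* (s :* c))) refl (t * B) s c ⟩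
      t * B * (2 * W) ∎

    -- Here t < p ^ (1 - 1 / r) enters, together with Y ^ 2 ≤ N ^ (1 / r) ≤ p ^ (1 / r).
    tY²≤p : t * Y ^ 2 ≤ p
    tY²≤p = ^-cancelʳ-≤ r′ (begin
      (t * Y ^ 2) ^ r ≡⟨ ^-distribʳ-* r t (Y ^ 2) ⟩
      t ^ r * (Y ^ 2) ^ r ≤⟨ *-mono-≤ (<⇒≤ tʳ<pʳ⁻¹) (≤-trans (≤-reflexive (power 2)) (≤-trans (Y^kr≤N 2 (s≤s (s≤s z≤n))) N≤p)) ⟩
      p ^ r′ * p ≡⟨ *-comm (p ^ r′) p ⟩
      p ^ r ∎)

    A+H≤p : A + H ≤ p
    A+H≤p = begin
      A + H ≤⟨ A+H≤2tBW ⟩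
      t * B * (2 * W) ≤⟨ *-mono-≤ (*-monoʳ-≤ t B≤Y) (≤-trans (*-monoˡ-≤ W {2} {16} (s≤s (s≤s z≤n))) 16W≤Y) ⟩
      t * Y * Y ≡⟨ solve 2 (λ t y → t :* y :* y := t :* (y :* (y :* con 1))) refl t Y ⟩
      t * Y ^ 2 ≤⟨ tY²≤p ⟩
      p ∎

    M≤p : M ≤ p
    M≤p = ≤-trans M≤K (≤-trans K≤t (≤-trans (m≤m*n t (Y ^ 2) {{m^n≢0 Y 2}}) tY²≤p))

    unknowns : M * (A + M * W) < K * A
    unknowns = begin-strict
      M * (A + A) ≡⟨ solve 2 (λ m a → m :* (a :+ a) := con 2 :* m :* a) refl M A ⟩
      2 * M * A <⟨ *-monoˡ-< A {{>-nonZero (*-mono-≤ {1} {M} {1} {W} 1≤M 1≤W)}} {2 * M} {4 * M} (*-monoˡ-< M {{>-nonZero 1≤M}} {2} {4} (s≤s (s≤s (s≤s z≤n)))) ⟩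
      4 * M * A ≤⟨ *-monoˡ-≤ A 4M≤K ⟩
      K * A ∎

    -- K z ≤ 8 M z is at most t Y ^ 2, and t ≤ K² Y³ eliminates K to give z² ≤ t Y ^ 7. Squaring the
    -- target adds Y ^ 4, so Y ^ 11 has to fit into N ^ (1 / r): this is the origin of 11. The power
    -- 2 r, the successor of `r′ + r`, clears both the square root and 1 / r.
    few-points : ∀ z → M * z < A + H → z * Y ^ 2 ≤ N
    few-points z Mz<A+H = ^-cancelʳ-≤ (r′ + r) (begin
      (z * Y ^ 2) ^ (r + r) ≡⟨ ^-distribˡ-+-* (z * Y ^ 2) r r ⟩
      (z * Y ^ 2) ^ r * (z * Y ^ 2) ^ r ≡⟨ ^-distribʳ-* r (z * Y ^ 2) (z * Y ^ 2) ⟨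
      (z * Y ^ 2 * (z * Y ^ 2)) ^ r ≡⟨ cong (_^ r) (solve 2 (λ z y → z :* y :* (z :* y) := z :* z :* (y :* y)) refl z (Y ^ 2)) ⟩
      (z * z * (Y ^ 2 * Y ^ 2)) ^ r ≤⟨ ^-monoˡ-≤ r (*-monoˡ-≤ (Y ^ 2 * Y ^ 2) z²≤tY⁷) ⟩
      (t * Y ^ 7 * (Y ^ 2 * Y ^ 2)) ^ r ≡⟨ cong (_^ r) (trans (*-assoc t (Y ^ 7) _) (cong (t *_)
                                                (trans (cong (Y ^ 7 *_) (sym (^-distribˡ-+-* Y 2 2))) (sym (^-distribˡ-+-* Y 7 4))))) ⟩
      (t * Y ^ 11) ^ r ≡⟨ ^-distribʳ-* r t (Y ^ 11) ⟩
      t ^ r * (Y ^ 11) ^ r ≤⟨ *-mono-≤ (<⇒≤ tʳ<N²ʳ⁻¹) (≤-trans (≤-reflexive (power 11)) (Y^kr≤N 11 ≤-refl)) ⟩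
      N ^ (r′ + r) * N ≡⟨ *-comm (N ^ (r′ + r)) N ⟩
      N ^ (r + r) ∎)
      where
      Kz≤tY² : K * z ≤ t * Y ^ 2
      Kz≤tY² = begin
        K * z ≤⟨ *-monoˡ-≤ z K≤8M ⟩
        8 * M * z ≡⟨ *-assoc 8 M z ⟩
        8 * (M * z) ≤⟨ *-monoʳ-≤ 8 (≤-trans (<⇒≤ Mz<A+H) A+H≤2tBW) ⟩
        8 * (t * B * (2 * W)) ≡⟨ solve 2 (λ x w → con 8 :* (x :* (con 2 :* w)) := x :* (con 16 :* w)) refl (t * B) W ⟩
        t * B * (16 * W) ≤⟨ *-mono-≤ (*-monoʳ-≤ t B≤Y) 16W≤Y ⟩
        t * Y * Y ≡⟨ solve 2 (λ t y → t :* y :* y := t :* (y :* (y :* con 1))) refl t Y ⟩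
        t * Y ^ 2 ∎
      z²≤tY⁷ : z * z ≤ t * Y ^ 7
      z²≤tY⁷ = *-cancelˡ-≤ (K * K) {{m*n≢0 K K}} (begin
        K * K * (z * z) ≡⟨ solve 2 (λ k z → k :* k :* (z :* z) := k :* z :* (k :* z)) refl K z ⟩
        K * z * (K * z) ≤⟨ *-mono-≤ Kz≤tY² Kz≤tY² ⟩
        t * Y ^ 2 * (t * Y ^ 2) ≤⟨ *-monoʳ-≤ (t * Y ^ 2) (*-monoˡ-≤ (Y ^ 2) t≤K²Y³) ⟩
        t * Y ^ 2 * (K * K * Y ^ 3 * Y ^ 2) ≡⟨ solve 5 (λ t y k z u → t :* y :* (k :* z :* u) := k :* (t :* (y :* (z :* u)))) refl t (Y ^ 2) (K * K) (Y ^ 3) (Y ^ 2) ⟩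
        K * K * (t * (Y ^ 2 * (Y ^ 3 * Y ^ 2))) ≡⟨ cong (λ x → K * K * (t * x)) (trans (cong (Y ^ 2 *_) (sym (^-distribˡ-+-* Y 3 2))) (sym (^-distribˡ-+-* Y 2 5))) ⟩
        K * K * (t * Y ^ 7) ∎)

  -- Counting by blocks and patterns, and the size of the set of orbit values

  count : (ℕ → Bool) → ℕ → ℕ
  count b zero    = 0
  count b (suc n) = (if b 0 then 1 else 0) + count (b ∘ suc) n

  count-cong : ∀ {b b′} → b ≗ b′ → ∀ n → count b n ≡ count b′ n
  count-cong h zero    = refl
  count-cong h (suc n) = cong₂ (λ x y → (if x then 1 else 0) + y) (h 0) (count-cong (h ∘ suc) n)

  count≤ : ∀ b n → count b n ≤ n
  count≤ b zero    = z≤n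
  count≤ b (suc n) with b 0
  ... | true  = s≤s (count≤ (b ∘ suc) n)
  ... | false = m≤n⇒m≤1+n (count≤ (b ∘ suc) n)

  count-⊎ : ∀ {b b₁ b₂} → (∀ i → T (b i) → T (b₁ i) ⊎ T (b₂ i)) →
            ∀ n → count b n ≤ count b₁ n + count b₂ n
  count-⊎ h zero = z≤n
  count-⊎ {b} {b₁} {b₂} h (suc n) = begin
    ⌊ b 0 ⌋ + count (b ∘ suc) n
      ≤⟨ +-mono-≤ (one (b 0) (b₁ 0) (b₂ 0) (h 0)) (count-⊎ (h ∘ suc) n) ⟩
    (⌊ b₁ 0 ⌋ + ⌊ b₂ 0 ⌋) + (count (b₁ ∘ suc) n + count (b₂ ∘ suc) n)
      ≡⟨ interchange ⌊ b₁ 0 ⌋ ⌊ b₂ 0 ⌋ (count (b₁ ∘ suc) n) (count (b₂ ∘ suc) n) ⟩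
    (⌊ b₁ 0 ⌋ + count (b₁ ∘ suc) n) + (⌊ b₂ 0 ⌋ + count (b₂ ∘ suc) n) ∎
    where
    open import Algebra.Properties.CommutativeSemigroup +-commutativeSemigroup using (interchange)
    ⌊_⌋ : Bool → ℕ
    ⌊ x ⌋ = if x then 1 else 0
    one : ∀ x y z → (T x → T y ⊎ T z) → ⌊ x ⌋ ≤ ⌊ y ⌋ + ⌊ z ⌋
    one false y     z     h = z≤n
    one true  true  z     h = s≤s z≤n
    one true  false true  h = s≤s z≤n
    one true  false false h = ⊥-elim ([ id , id ]′ (h tt))

  count-none : ∀ {b} → (∀ i → ¬ T (b i)) → ∀ n → count b n ≡ 0
  count-none {b} h zero = refl
  count-none {b} h (suc n) with b 0 | h 0
  ... | true  | ¬t = ⊥-elim (¬t tt)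
  ... | false | _  = count-none (h ∘ suc) n

  count-restrict : ∀ {b b′} n → (∀ i → i < n → T (b i) → T (b′ i)) → count b n ≤ count b′ n
  count-restrict {b} {b′} zero    h = z≤n
  count-restrict {b} {b′} (suc n) h with b 0 | b′ 0 | h 0 (s≤s z≤n)
  ... | true  | true  | _ = s≤s (count-restrict n (λ i i<n → h (suc i) (s≤s i<n)))
  ... | true  | false | t = ⊥-elim (t tt)
  ... | false | true  | _ = m≤n⇒m≤1+n (count-restrict n (λ i i<n → h (suc i) (s≤s i<n)))
  ... | false | false | _ = count-restrict n (λ i i<n → h (suc i) (s≤s i<n))

  count-+ : ∀ b m n → count b (m + n) ≡ count b m + count (λ i → b (m + i)) n
  count-+ b zero    n = refl
  count-+ b (suc m) n = trans (cong ((if b 0 then 1 else 0) +_) (count-+ (b ∘ suc) m n))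
    (sym (+-assoc (if b 0 then 1 else 0) (count (b ∘ suc) m) _))

  block : (ℕ → Bool) → ℕ → ℕ → ℕ → Bool
  block b L j i = b (j * L + i)

  rich : (ℕ → Bool) → ℕ → ℕ → ℕ → Bool
  rich b L ν j = ν <ᵇ count (block b L j) L

  count-blocks : ∀ b L ν q → count b (q * L) ≤ q * ν + L * count (rich b L ν) q
  count-blocks b L ν zero    = z≤n
  count-blocks b L ν (suc q) = begin
    count b (L + q * L)
      ≡⟨ count-+ b L (q * L) ⟩
    count b L + count b′ (q * L)
      ≤⟨ +-mono-≤ first (count-blocks b′ L ν q) ⟩
    (ν + L * ⌊r⌋) + (q * ν + L * count (rich b′ L ν) q)
      ≡⟨ cong (λ x → (ν + L * ⌊r⌋) + (q * ν + L * x)) (count-cong shifted q) ⟩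
    (ν + L * ⌊r⌋) + (q * ν + L * count (rich b L ν ∘ suc) q)
      ≡⟨ interchange ν (L * ⌊r⌋) (q * ν) _ ⟩
    suc q * ν + (L * ⌊r⌋ + L * count (rich b L ν ∘ suc) q)
      ≡⟨ cong (suc q * ν +_) (*-distribˡ-+ L ⌊r⌋ _) ⟨
    suc q * ν + L * count (rich b L ν) (suc q) ∎
    where
    open import Algebra.Properties.CommutativeSemigroup +-commutativeSemigroup using (interchange)
    b′ : ℕ → Bool
    b′ i = b (L + i)
    ⌊r⌋ : ℕ
    ⌊r⌋ = if rich b L ν 0 then 1 else 0
    first : count b L ≤ ν + L * ⌊r⌋
    first with ν <ᵇ count b L in eq
    ... | true  = ≤-trans (count≤ b L) (≤-trans (≤-reflexive (sym (*-identityʳ L))) (m≤n+m (L * 1) ν))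
    ... | false = ≤-trans (≮⇒≥ λ ν< → subst T eq (<⇒<ᵇ ν<)) (m≤m+n ν _)
    shifted : ∀ j → rich b′ L ν j ≡ rich b L ν (suc j)
    shifted j = cong (ν <ᵇ_) (count-cong (λ i → cong b (sym (+-assoc L (j * L) i))) L)

  count-fibres : ∀ m {n} {b : ℕ → Bool} (c : ℕ → ℕ) q →
    (∀ v → v < m → count (λ j → b j ∧ (c j ≡ᵇ v)) q ≤ n) →
    count (λ j → b j ∧ (c j <ᵇ m)) q ≤ m * n
  count-fibres zero    {n} {b} c q h = ≤-reflexive (count-none {λ j → b j ∧ (c j <ᵇ 0)} (λ j → proj₂ ∘ Equivalence.to (T-∧ {b j})) q)
  count-fibres (suc m) {n} {b} c q h = begin
    count (λ j → b j ∧ (c j <ᵇ suc m)) q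
      ≤⟨ count-⊎ {λ j → b j ∧ (c j <ᵇ suc m)} {λ j → b j ∧ (c j ≡ᵇ m)} {λ j → b j ∧ (c j <ᵇ m)} split q ⟩
    count (λ j → b j ∧ (c j ≡ᵇ m)) q + count (λ j → b j ∧ (c j <ᵇ m)) q
      ≤⟨ +-mono-≤ (h m (n<1+n m)) (count-fibres m {n} {b} c q (λ v v<m → h v (m<n⇒m<1+n v<m))) ⟩
    suc m * n ∎
    where
    split : ∀ j → T (b j ∧ (c j <ᵇ suc m)) → T (b j ∧ (c j ≡ᵇ m)) ⊎ T (b j ∧ (c j <ᵇ m))
    split j t with Equivalence.to (T-∧ {b j}) t
    ... | bj , c<1+m with m≤n⇒m<n∨m≡n (s≤s⁻¹ (<ᵇ⇒< (c j) (suc m) c<1+m))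
    ... | inj₁ c<m = inj₂ (Equivalence.from T-∧ (bj , <⇒<ᵇ c<m))
    ... | inj₂ c≡m = inj₁ (Equivalence.from T-∧ (bj , ≡⇒≡ᵇ (c j) m c≡m))

  indices : ∀ b n → Σ[ js ∈ List ℕ ] length js ≡ count b n × Unique js × All (λ j → T (b j)) js
  indices b zero    = [] , refl , [] , []
  indices b (suc n) with b 0 in b0 | indices (b ∘ suc) n
  ... | false | js , len , unique , good =
    List.map suc js , trans (length-map suc js) len , Unique.map⁺ suc-injective unique , All.map⁺ good
  ... | true  | js , len , unique , good =
    0 ∷ List.map suc js , cong suc (trans (length-map suc js) len) ,
    All.map⁺ (All.universal (λ _ ()) js) ∷ Unique.map⁺ suc-injective unique ,
    subst T (sym b0) tt ∷ All.map⁺ good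

  select : ∀ s b n → s ≤ count b n → Σ[ γ ∈ (Fin s → ℕ) ]
    (∀ i → γ i < n × T (b (γ i))) × (∀ {i j} → i Fin.< j → γ i < γ j)
  select zero    b n       h = (λ ()) , (λ ()) , λ { {()} }
  select (suc s) b (suc n) h with b 0 in b0
  ... | false = let (γ , good , mono) = select (suc s) (b ∘ suc) n h in
    suc ∘ γ , (λ i → s≤s (proj₁ (good i)) , proj₂ (good i)) , s≤s ∘ mono
  ... | true  = let (γ , good , mono) = select s (b ∘ suc) n (s≤s⁻¹ h) in
    (λ { zero → 0 ; (suc i) → suc (γ i) }) ,
    (λ { zero → s≤s z≤n , subst T (sym b0) tt ; (suc i) → s≤s (proj₁ (good i)) , proj₂ (good i) }) ,
    λ { {zero} {suc j} _ → s≤s z≤n ; {suc i} {suc j} (s≤s i<j) → s≤s (mono i<j) }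

  -- The rich blocks are classified by their pattern, one of 2 ^ L; the positions γ are the
  -- first ν + 1 elements of a pattern.
  module _ (ν L n : ℕ) (b : ℕ → Bool)
    (few : (γ : Fin (suc ν) → ℕ) → (∀ i → γ i < L) → (∀ {i j} → i Fin.< j → γ i < γ j) →
           (js : List ℕ) → Unique js → All (λ j → ∀ i → T (b (j * L + γ i))) js → length js ≤ n) where

    private
      bits : ℕ → Fin L → Fin 2
      bits j i = if b (j * L + toℕ i) then suc zero else zero

      pattern-code : ℕ → ℕ
      pattern-code j = toℕ (funToFin {L} {2} (bits j))

      same-pattern : ∀ j k → pattern-code j ≡ pattern-code k → ∀ i → i < L → T (b (j * L + i)) → T (b (k * L + i))
      same-pattern j k eq i i<L t = subst (λ i → T (b (k * L + i))) (Fin.toℕ-fromℕ< i<L)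
        (transfer (b (j * L + toℕ i′)) (b (k * L + toℕ i′)) bits≡ (subst (λ i → T (b (j * L + i))) (sym (Fin.toℕ-fromℕ< i<L)) t))
        where
        i′ : Fin L
        i′ = fromℕ< i<L
        bits≡ : bits j i′ ≡ bits k i′
        bits≡ = trans (sym (Fin.finToFun-funToFin (bits j) i′))
          (trans (cong (λ v → finToFun {2} {L} v i′) (Fin.toℕ-injective {i = funToFin (bits j)} {j = funToFin (bits k)} eq))
            (Fin.finToFun-funToFin (bits k) i′))
        transfer : ∀ x y → (if x then suc zero else zero {1}) ≡ (if y then suc zero else zero) → T x → T y
        transfer true  true  eq t = tt
        transfer true  false () t

      fibre : ∀ q v → count (λ j → rich b L ν j ∧ (pattern-code j ≡ᵇ v)) q ≤ n
      fibre q v with indices (λ j → rich b L ν j ∧ (pattern-code j ≡ᵇ v)) q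
      ... | []     , len , _      , _            = ≤-trans (≤-reflexive (sym len)) z≤n
      ... | k ∷ js , len , unique , k-ok ∷ good with Equivalence.to (T-∧ {rich b L ν k}) k-ok
      ... | k-rich , k-code with select (suc ν) (block b L k) L (<ᵇ⇒< ν _ k-rich)
      ... | γ , γ-good , mono = ≤-trans (≤-reflexive (sym len))
        (few γ (proj₁ ∘ γ-good) mono (k ∷ js) unique (All.map (λ {j} → transported {j}) (k-ok ∷ good)))
        where
        transported : ∀ {j} → T (rich b L ν j ∧ (pattern-code j ≡ᵇ v)) → ∀ i → T (b (j * L + γ i))
        transported {j} j-ok i = same-pattern k j
          (trans (≡ᵇ⇒≡ _ v k-code) (sym (≡ᵇ⇒≡ _ v (proj₂ (Equivalence.to (T-∧ {rich b L ν j}) j-ok)))))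
          (γ i) (proj₁ (γ-good i)) (proj₂ (γ-good i))

    count-by-blocks : ∀ q → count b (q * L) ≤ q * ν + L * (2 ^ L * n)
    count-by-blocks q = begin
      count b (q * L) ≤⟨ count-blocks b L ν q ⟩
      q * ν + L * count (rich b L ν) q ≤⟨ +-monoʳ-≤ (q * ν) (*-monoʳ-≤ L (count-restrict {rich b L ν} q
                                                 (λ j _ r → Equivalence.from T-∧ (r , <⇒<ᵇ (Fin.toℕ<n (funToFin {L} {2} (bits j))))))) ⟩
      q * ν + L * count (λ j → rich b L ν j ∧ (pattern-code j <ᵇ 2 ^ L)) q
                                            ≤⟨ +-monoʳ-≤ (q * ν) (*-monoʳ-≤ L (count-fibres (2 ^ L) {n} {rich b L ν} pattern-code q (λ v _ → fibre q v))) ⟩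
      q * ν + L * (2 ^ L * n) ∎

  unique-map : ∀ {A : Set} {P : ℕ → Set} (g : ℕ → A) → (∀ {i j} → P i → P j → g i ≡ g j → i ≡ j) →
               ∀ {js} → All P js → Unique js → Unique (List.map g js)
  unique-map g inj []         []           = []
  unique-map {P = P} g inj {j ∷ js} (pj ∷ pjs) (j∉ ∷ unique) =
    All.map⁺ (All.zipWith (λ (pi , j≢i) gj≡gi → j≢i (inj pj pi gj≡gi)) (pjs , j∉)) ∷ unique-map {P = P} g inj pjs unique

  ∣⁅x⁆∪R∩G∣≤ : ∀ {m} (x : Fin m) (R G : Subset m) →
    ∣ (⁅ x ⁆ ∪ R) ∩ G ∣ ≤ (if lookup G x then 1 else 0) + ∣ R ∩ G ∣
  ∣⁅x⁆∪R∩G∣≤ zero    (r ∷ R) (g ∷ G) rewrite ∪-identityˡ R = head r g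
    where
    head : ∀ r g → ∣ g ∷ (R ∩ G) ∣ ≤ (if g then 1 else 0) + ∣ (r ∧ g) ∷ (R ∩ G) ∣
    head true  true  = n≤1+n _
    head true  false = ≤-refl
    head false true  = ≤-refl
    head false false = ≤-refl
  ∣⁅x⁆∪R∩G∣≤ (suc x) (true  ∷ R) (true  ∷ G) = ≤-trans (s≤s (∣⁅x⁆∪R∩G∣≤ x R G)) (≤-reflexive (sym (+-suc _ _)))
  ∣⁅x⁆∪R∩G∣≤ (suc x) (true  ∷ R) (false ∷ G) = ∣⁅x⁆∪R∩G∣≤ x R G
  ∣⁅x⁆∪R∩G∣≤ (suc x) (false ∷ R) (_     ∷ G) = ∣⁅x⁆∪R∩G∣≤ x R G

  module _ {m : ℕ} (o : ℕ → Fin m) where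

    range : (ℕ → ℕ) → ℕ → Subset m
    range g n = ⋃ (List.map (λ i → ⁅ o i ⁆) (List.applyUpTo g n))

    ∣range∩G∣≤count : ∀ G g n → ∣ range g n ∩ G ∣ ≤ count (λ i → lookup G (o (g i))) n
    ∣range∩G∣≤count G g zero    = ≤-reflexive (trans (cong ∣_∣ (∩-zeroˡ G)) (∣⊥∣≡0 m))
    ∣range∩G∣≤count G g (suc n) = ≤-trans (∣⁅x⁆∪R∩G∣≤ (o (g 0)) (range (g ∘ suc) n) G)
      (+-monoʳ-≤ (if lookup G (o (g 0)) then 1 else 0) (∣range∩G∣≤count G (g ∘ suc) n))

    ∈range : ∀ g n {x} → x ∈ range g n → ∃[ i ] i < n × x ≡ o (g i)
    ∈range g zero    x∈ = ⊥-elim (∉⊥ x∈)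
    ∈range g (suc n) x∈ with x∈p∪q⁻ ⁅ o (g 0) ⁆ (range (g ∘ suc) n) x∈
    ... | inj₁ x∈⁅⁆ = 0 , s≤s z≤n , x∈⁅y⁆⇒x≡y (o (g 0)) x∈⁅⁆
    ... | inj₂ x∈R  = let (i , i<n , eq) = ∈range (g ∘ suc) n x∈R in suc i , s≤s i<n , eq

    n≤∣range∣ : ∀ g n → (∀ {i j} → i < j → j < n → o (g i) ≢ o (g j)) → n ≤ ∣ range g n ∣
    n≤∣range∣ g zero    distinct = z≤n
    n≤∣range∣ g (suc n) distinct = ≤-trans
      (s≤s (n≤∣range∣ (g ∘ suc) n (λ i<j j<n → distinct (s≤s i<j) (s≤s j<n))))
      (p⊂q⇒∣p∣<∣q∣ (q⊆p∪q ⁅ o (g 0) ⁆ (range (g ∘ suc) n) ,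
        o (g 0) , x∈p∪q⁺ (inj₁ (x∈⁅x⁆ (o (g 0)))) ,
        λ x∈R → let (i , i<n , eq) = ∈range (g ∘ suc) n x∈R in distinct (s≤s z≤n) (s≤s i<n) eq))

  orbit-+ : ∀ {p} .{{_ : NonZero p}} (f : List (Fin p)) u n k → orbit f (orbit f u n) k ≡ orbit f u (k + n)
  orbit-+ f u n zero    = refl
  orbit-+ f u n (suc k) = cong (eval f) (orbit-+ f u n k)

  -- The frequency bound in natural numbers

  module Frequency (r′ d : ℕ) (2≤d : 2 ≤ d) where

    -- L₀ is the block length from which 16 W ≤ Y holds. K₀ bounds the binary logarithm of N for
    -- shorter blocks. C₁ is the product of the constants in ∣V ∩ G∣ L ≤ (2 J + 1) N and K + 1 ≤ (4
    -- d J + 1) L.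
    r J s L₀ K₀ C₁ : ℕ
    r  = suc r′
    J  = 11 * r
    s  = suc J
    L₀ = 16 * s
    K₀ = d * ((L₀ + L₀) * J)
    C₁ = (2 * J + 1) * (4 * d * J + 1)

    private
      instance
        d≢0 : NonZero d
        d≢0 = >-nonZero (≤-trans (s≤s z≤n) 2≤d)

    module _ {p : ℕ} .{{_ : NonZero p}} (p-prime : Prime p) (f : List (Fin p)) (f-deg : HasDegree f d)
      (u : Fin p) (N : ℕ) {G : Subset p} (subgroup : IsSubgroup G)
      (zero-free : ∀ m → 0 < m → d ^ m ≤ N → orbit f 0ₚ m ≢ 0ₚ)
      (distinct : ∀ {i j} → i < j → j ≤ N → orbit f u i ≢ orbit f u j)
      (N<tʳ : N < ∣ G ∣ ^ r) (tʳ<N²ʳ⁻¹ : ∣ G ∣ ^ r < N ^ (r′ + r)) (tʳ<pʳ⁻¹ : ∣ G ∣ ^ r < p ^ r′)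
      (2≤N : 2 ≤ N) where

      V : Subset p
      V = values f u N

      N<∣V∣ : N < ∣ V ∣
      N<∣V∣ = n≤∣range∣ (orbit f u) id (suc N) (λ i<j j<1+N → distinct i<j (s≤s⁻¹ j<1+N))

      N≤p : N ≤ p
      N≤p = ≤-trans (<⇒≤ N<∣V∣) (∣p∣≤n V)

      private
        Z : ℕ → ℕ
        Z k = (d ^ k * d ^ k) ^ J

        Z0≤N : Z 0 ≤ N
        Z0≤N = ≤-trans (≤-reflexive (^-zeroˡ J)) (≤-trans (s≤s z≤n) 2≤N)

        N<ZN : N < Z N
        N<ZN = begin-strict
          N <⟨ n<2^n N ⟩
          2 ^ N ≤⟨ ^-monoˡ-≤ N 2≤d ⟩
          d ^ N ≤⟨ m≤m*n (d ^ N) (d ^ N) {{m^n≢0 d N}} ⟩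
          d ^ N * d ^ N ≤⟨ m≤m*n _ ((d ^ N * d ^ N) ^ pred J) {{m^n≢0 _ (pred J) {{m*n≢0 _ _ {{m^n≢0 d N}} {{m^n≢0 d N}}}}}} ⟩
          Z N ∎

        scale = last-below Z N N Z0≤N N<ZN

      -- `Z k` is d ^ (2 J k), so L is about log N / (2 J log d). K is an integer above the binary
      -- logarithm of N, obtained from the crude d < 2 ^ d so that it is linear in L + 1.
      L c Y K : ℕ
      L = proj₁ scale
      c = d ^ L
      Y = c * c
      K = d * ((suc L + suc L) * J)

      Yᴶ≤N : Y ^ J ≤ N
      Yᴶ≤N = proj₁ (proj₂ scale)

      N<2^K : N < 2 ^ K
      N<2^K = begin-strict
        N <⟨ proj₂ (proj₂ scale) ⟩
        (d ^ suc L * d ^ suc L) ^ J ≡⟨ cong (_^ J) (^-distribˡ-+-* d (suc L) (suc L)) ⟨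
        (d ^ (suc L + suc L)) ^ J ≡⟨ ^-*-assoc d (suc L + suc L) J ⟩
        d ^ ((suc L + suc L) * J) ≤⟨ ^-monoˡ-≤ ((suc L + suc L) * J) (<⇒≤ (n<2^n d)) ⟩
        (2 ^ d) ^ ((suc L + suc L) * J) ≡⟨ ^-*-assoc 2 d ((suc L + suc L) * J) ⟩
        2 ^ K ∎

      1≤K : 1 ≤ K
      1≤K = *-mono-≤ {1} {d} {1} {(suc L + suc L) * J} (≤-trans (s≤s z≤n) 2≤d) (*-mono-≤ {1} {suc L + suc L} {1} {J} (s≤s z≤n) (s≤s z≤n))

      -- Here N is bounded in terms of d and r, and the trivial bound ρ ≤ 1 suffices.
      short : L < L₀ → ∣ V ∩ G ∣ * suc K < (2 + K₀ + C₁) * ∣ V ∣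
      short L<L₀ = begin-strict
        ∣ V ∩ G ∣ * suc K ≤⟨ *-mono-≤ (∣p∩q∣≤∣p∣ V G) (s≤s (*-monoʳ-≤ d (*-monoˡ-≤ J (+-mono-≤ L<L₀ L<L₀)))) ⟩
        ∣ V ∣ * suc K₀ <⟨ *-monoʳ-< ∣ V ∣ {{>-nonZero (≤-<-trans z≤n N<∣V∣)}} (≤-trans (n<1+n (suc K₀)) (m≤m+n (2 + K₀) C₁)) ⟩
        ∣ V ∣ * (2 + K₀ + C₁) ≡⟨ *-comm ∣ V ∣ _ ⟩
        (2 + K₀ + C₁) * ∣ V ∣ ∎

      module Long (L₀≤L : L₀ ≤ L) where

        2^L≤c : 2 ^ L ≤ c
        2^L≤c = ^-monoˡ-≤ L 2≤d

        1≤L : 1 ≤ L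
        1≤L = ≤-trans (s≤s z≤n) L₀≤L

        private
          instance
            c≢0 : NonZero c
            c≢0 = m^n≢0 d L
            Y≢0 : NonZero Y
            Y≢0 = m*n≢0 c c
            L≢0 : NonZero L
            L≢0 = >-nonZero 1≤L
            Y²≢0 : NonZero (Y ^ 2)
            Y²≢0 = m^n≢0 Y 2

        -- Passing from L + 1 to L loses a factor d ^ (2 J), which is at most Y because J ≤ L.
        N<Yᴶ⁺¹ : N < Y ^ suc J
        N<Yᴶ⁺¹ = begin-strict
          N <⟨ proj₂ (proj₂ scale) ⟩
          (d ^ suc L * d ^ suc L) ^ J ≡⟨ cong (_^ J) (solve 2 (λ d c → d :* c :* (d :* c) := d :* d :* (c :* c)) refl d c) ⟩
          (d * d * Y) ^ J ≡⟨ ^-distribʳ-* J (d * d) Y ⟩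
          (d * d) ^ J * Y ^ J ≤⟨ *-monoˡ-≤ (Y ^ J) d²ᴶ≤Y ⟩
          Y ^ suc J ∎
          where
          d²ᴶ≤Y : (d * d) ^ J ≤ Y
          d²ᴶ≤Y = begin
            (d * d) ^ J ≡⟨ ^-distribʳ-* J d d ⟩
            d ^ J * d ^ J ≤⟨ *-mono-≤ dᴶ≤c dᴶ≤c ⟩
            c * c ∎
            where
            dᴶ≤c : d ^ J ≤ c
            dᴶ≤c = ^-monoʳ-≤ d (≤-trans (≤-trans (n≤1+n J) (m≤n*m s 16)) L₀≤L)

        L<c : L < c
        L<c = <-≤-trans (n<2^n L) 2^L≤c

        c≤N : c ≤ N
        c≤N = begin
          c ≤⟨ m≤m*n c c ⟩
          Y ≤⟨ m≤m*n Y (Y ^ pred J) {{m^n≢0 Y (pred J)}} ⟩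
          Y ^ J ≤⟨ Yᴶ≤N ⟩
          N ∎

        module P = Parameters r′ J ≤-refl {c} {L} {N} {∣ G ∣} {p} L<c L₀≤L 2^L≤c Yᴶ≤N N<Yᴶ⁺¹ N≤p N<tʳ tʳ<N²ʳ⁻¹ tʳ<pʳ⁻¹

        -- n₀ will bound the rich blocks of one pattern, by `few-points`; the successor in q makes
        -- the blocks cover the index N.
        n₀ q : ℕ
        n₀ = N / Y ^ 2
        q  = suc (N / L)

        -- The last block may run past N, where orbit values need no longer be distinct; the cutoff
        -- keeps the starting points of distinct blocks distinct.
        b : ℕ → Bool
        b i = (i ≤ᵇ N) ∧ lookup G (orbit f u i)

        b-≤ : ∀ i → T (b i) → i ≤ N
        b-≤ i t = ≤ᵇ⇒≤ i N (proj₁ (Equivalence.to (T-∧ {i ≤ᵇ N}) t))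

        b-∈ : ∀ i → T (b i) → orbit f u i ∈ G
        b-∈ i t = lookup⇒[]= (orbit f u i) G (Equivalence.to T-≡ (proj₂ (Equivalence.to (T-∧ {i ≤ᵇ N}) t)))

        orbit-injective : ∀ {i j} → i ≤ N → j ≤ N → orbit f u i ≡ orbit f u j → i ≡ j
        orbit-injective {i} {j} i≤N j≤N eq with <-cmp i j
        ... | tri< i<j _ _ = ⊥-elim (distinct i<j j≤N eq)
        ... | tri≈ _ i≡j _ = i≡j
        ... | tri> _ _ j<i = ⊥-elim (distinct j<i i≤N (sym eq))

        -- The first position yields the points x, one for each block, and the distances from it to
        -- the other J positions are the shifts. Since d ^ m ≤ c ≤ N for m < L, the hypothesis on
        -- the zeros of the orbit of 0 applies to all of them.
        few : (γ : Fin (suc J) → ℕ) → (∀ i → γ i < L) → (∀ {i j} → i Fin.< j → γ i < γ j) →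
              (js : List ℕ) → Unique js → All (λ j → ∀ i → T (b (j * L + γ i))) js → length js ≤ n₀
        few γ γ<L γ-mono js js-unique good = begin
          length js ≡⟨ length-map point js ⟨
          length xs ≡⟨ m*n/n≡m (length xs) (Y ^ 2) ⟨
          length xs * Y ^ 2 / Y ^ 2 ≤⟨ /-monoˡ-≤ (Y ^ 2) (P.few-points (length xs)
            (OrbitCount.orbit-count p-prime f d (≤-trans (s≤s z≤n) 2≤d) f-deg
              (λ m 0<m m<L → zero-free m 0<m (≤-trans (^-monoʳ-≤ d (<⇒≤ m<L)) c≤N))
              κ κ>0 (λ i → ≤-<-trans (m∸n≤m _ (γ zero)) (γ<L (suc i))) κ-injective
              c (λ k k<L → ^-monoʳ-≤ d (<⇒≤ k<L)) 1≤L subgroup P.B P.A P.M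
              P.separation P.A+H≤p P.M≤p P.unknowns xs xs-unique xs-good)) ⟩
          n₀ ∎
          where
          point : ℕ → Fin p
          point j = orbit f u (j * L + γ zero)
          xs : List (Fin p)
          xs = List.map point js
          κ : Fin J → ℕ
          κ i = γ (suc i) ∸ γ zero
          κ>0 : ∀ i → 0 < κ i
          κ>0 i = m<n⇒0<n∸m (γ-mono {zero} {suc i} (s≤s z≤n))
          γ₀≤ : ∀ i → γ zero ≤ γ (suc i)
          γ₀≤ i = <⇒≤ (γ-mono {zero} {suc i} (s≤s z≤n))
          κ-injective : ∀ {i j} → κ i ≡ κ j → i ≡ j
          κ-injective {i} {j} eq with Fin.<-cmp i j
          ... | tri< i<j _ _ = ⊥-elim (<⇒≢ (γ-mono {suc i} {suc j} (s≤s i<j)) (∸-cancelʳ-≡ (γ₀≤ i) (γ₀≤ j) eq))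
          ... | tri≈ _ i≡j _ = i≡j
          ... | tri> _ _ j<i = ⊥-elim (<⇒≢ (γ-mono {suc j} {suc i} (s≤s j<i)) (sym (∸-cancelʳ-≡ (γ₀≤ i) (γ₀≤ j) eq)))
          xs-unique : Unique xs
          xs-unique = unique-map {P = λ j → T (b (j * L + γ zero))} point
            (λ {i} {j} ti tj eq → *-cancelʳ-≡ i j L (+-cancelʳ-≡ (γ zero) (i * L) (j * L)
              (orbit-injective (b-≤ (i * L + γ zero) ti) (b-≤ (j * L + γ zero) tj) eq)))
            (All.map (λ h → h zero) good) js-unique
          xs-good : ∀ {x} → x List.∈ xs → x ∈ G × (∀ i → orbit f x (κ i) ∈ G)
          xs-good x∈ with ∈-map⁻ point x∈
          ... | j , j∈ , refl = b-∈ (j * L + γ zero) (All.lookup good j∈ zero) , λ i →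
            subst (_∈ G) (sym (trans (orbit-+ f u (j * L + γ zero) (κ i)) (cong (orbit f u) (shift j i))))
              (b-∈ (j * L + γ (suc i)) (All.lookup good j∈ (suc i)))
            where
            shift : ∀ j i → κ i + (j * L + γ zero) ≡ j * L + γ (suc i)
            shift j i = begin-equality
              κ i + (j * L + γ zero) ≡⟨ solve 3 (λ k x g → k :+ (x :+ g) := x :+ (k :+ g)) refl (κ i) (j * L) (γ zero) ⟩
              j * L + (κ i + γ zero) ≡⟨ cong (j * L +_) (m∸n+n≡m (γ₀≤ i)) ⟩
              j * L + γ (suc i) ∎

        N<qL : N < q * L
        N<qL = begin-strict
          N ≡⟨ m≡m%n+[m/n]*n N L ⟩
          N % L + N / L * L <⟨ +-monoˡ-< (N / L * L) (m%n<n N L) ⟩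
          q * L ∎

        ∣V∩G∣≤ : ∣ V ∩ G ∣ ≤ q * J + L * (2 ^ L * n₀)
        ∣V∩G∣≤ = begin
          ∣ V ∩ G ∣ ≤⟨ ∣range∩G∣≤count (orbit f u) G id (suc N) ⟩
          count (λ i → lookup G (orbit f u i)) (suc N) ≤⟨ count-restrict {λ i → lookup G (orbit f u i)} {b} (suc N) (λ i i≤N t → Equivalence.from (T-∧ {i ≤ᵇ N}) (≤⇒≤ᵇ (s≤s⁻¹ i≤N) , t)) ⟩
          count b (suc N) ≤⟨ m≤m+n _ _ ⟩
          count b (suc N) + count (λ i → b (suc N + i)) (q * L ∸ suc N) ≡⟨ count-+ b (suc N) (q * L ∸ suc N) ⟨
          count b (suc N + (q * L ∸ suc N)) ≡⟨ cong (count b) (m+[n∸m]≡n N<qL) ⟩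
          count b (q * L) ≤⟨ count-by-blocks J L n₀ b few q ⟩
          q * J + L * (2 ^ L * n₀) ∎

        -- The factor Y ^ 2 saved in n₀ pays for the number of patterns: L² 2 ^ L ≤ c³ ≤ Y ^ 2, so
        -- the rich blocks contribute at most N / L. The others contribute q J, where q L ≤ 2 N.
        ∣V∩G∣L≤ : ∣ V ∩ G ∣ * L ≤ (2 * J + 1) * N
        ∣V∩G∣L≤ = begin
          ∣ V ∩ G ∣ * L ≤⟨ *-monoˡ-≤ L ∣V∩G∣≤ ⟩
          (q * J + L * (2 ^ L * n₀)) * L ≡⟨ solve 5 (λ q J L e n → (q :* J :+ L :* (e :* n)) :* L := q :* L :* J :+ n :* (L :* (L :* e))) refl q J L (2 ^ L) n₀ ⟩
          q * L * J + n₀ * (L * (L * 2 ^ L)) ≤⟨ +-mono-≤ (*-monoˡ-≤ J qL≤2N) (≤-trans (*-monoʳ-≤ n₀ LL2^L≤Y²) (m/n*n≤m N (Y ^ 2))) ⟩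
          2 * N * J + N ≡⟨ solve 2 (λ N J → con 2 :* N :* J :+ N := (con 2 :* J :+ con 1) :* N) refl N J ⟩
          (2 * J + 1) * N ∎
          where
          L≤c : L ≤ c
          L≤c = <⇒≤ L<c
          qL≤2N : q * L ≤ 2 * N
          qL≤2N = begin
            L + N / L * L ≤⟨ +-mono-≤ (≤-trans L≤c c≤N) (m/n*n≤m N L) ⟩
            N + N ≡⟨ cong (N +_) (+-identityʳ N) ⟨
            2 * N ∎
          LL2^L≤Y² : L * (L * 2 ^ L) ≤ Y ^ 2
          LL2^L≤Y² = begin
            L * (L * 2 ^ L) ≤⟨ *-mono-≤ L≤c (*-mono-≤ L≤c 2^L≤c) ⟩
            c * (c * c) ≤⟨ m≤m*n (c * (c * c)) c ⟩
            c * (c * c) * c ≡⟨ solve 1 (λ c → c :* (c :* c) :* c := c :* c :* (c :* c :* con 1)) refl c ⟩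
            Y ^ 2 ∎

        long : ∣ V ∩ G ∣ * suc K < (2 + K₀ + C₁) * ∣ V ∣
        long = begin-strict
          ∣ V ∩ G ∣ * suc K ≤⟨ *-monoʳ-≤ ∣ V ∩ G ∣ 1+K≤ ⟩
          ∣ V ∩ G ∣ * (L * (4 * d * J + 1)) ≡⟨ *-assoc ∣ V ∩ G ∣ L _ ⟨
          ∣ V ∩ G ∣ * L * (4 * d * J + 1) ≤⟨ *-monoˡ-≤ (4 * d * J + 1) ∣V∩G∣L≤ ⟩
          (2 * J + 1) * N * (4 * d * J + 1) ≡⟨ solve 3 (λ x n y → x :* n :* y := x :* y :* n) refl (2 * J + 1) N (4 * d * J + 1) ⟩
          C₁ * N ≤⟨ *-monoʳ-≤ C₁ (<⇒≤ N<∣V∣) ⟩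
          C₁ * ∣ V ∣ <⟨ *-monoˡ-< ∣ V ∣ {{>-nonZero (≤-<-trans z≤n N<∣V∣)}} (m<n+m C₁ {2 + K₀} (s≤s z≤n)) ⟩
          (2 + K₀ + C₁) * ∣ V ∣ ∎
          where
          1+K≤ : suc K ≤ L * (4 * d * J + 1)
          1+K≤ = begin
            1 + d * ((suc L + suc L) * J) ≤⟨ +-mono-≤ 1≤L (*-monoʳ-≤ d (*-monoˡ-≤ J (+-mono-≤ 1+L≤2L 1+L≤2L))) ⟩
            L + d * ((L + L + (L + L)) * J) ≡⟨ solve 3 (λ l d j → l :+ d :* ((l :+ l :+ (l :+ l)) :* j) := l :* (con 4 :* d :* j :+ con 1)) refl L d J ⟩
            L * (4 * d * J + 1) ∎
            where
            1+L≤2L : suc L ≤ L + L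
            1+L≤2L = +-monoˡ-≤ L 1≤L

      -- `k` stands in for the logarithm, so that the combinatorial part stays in ℕ. The successor
      -- gives the strict gap 1 / (k + 1) < 1 / log N required by the cuts.
      frequency : ∃[ k ] 1 ≤ k × N < 2 ^ k × ∣ V ∩ G ∣ * suc k < (2 + K₀ + C₁) * ∣ V ∣
      frequency with L <? L₀
      ... | yes L<L₀ = K , 1≤K , N<2^K , short L<L₀
      ... | no  L≮L₀ = K , 1≤K , N<2^K , Long.long (≮⇒≥ L≮L₀)

-- From inequalities between cuts to inequalities between natural numbers

open import Algebra.Definitions.RawSemiring as RawSemiringDefs using ()
open import Data.Integer.Base as ℤ using (ℤ; +_; -[1+_])
import Data.Integer.Properties as ℤ
open import Data.Nat.Solver using () renaming (module +-*-Solver to ℕ-Solver)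
open import Data.Rational.Base as ℚ using (ℚ; 0ℚ; 1ℚ; mkℚ; toℚᵘ; nonNegative; positive; *<*; *≤*)
import Data.Rational.Properties as ℚ
open import Data.Rational.Solver using (module +-*-Solver)
open import Data.Rational.Unnormalised.Base as ℚᵘ using (mkℚᵘ; *≡*; *<*; *≤*)
import Data.Rational.Unnormalised.Properties as ℚᵘ
open Frequencies using (^-distribʳ-*; module Frequency; orbit-+)
open import Defs using () renaming (fromℕℚ to ι)
open +-*-Solver using (solve; _:+_; _:*_; _:=_; con; :-_)

open RawSemiringDefs ℚ.+-*-rawSemiring using () renaming (_^_ to _^ℚ_)

ℚ<⇒≱ : ∀ {x y} → x ℚ.< y → ¬ y ℚ.≤ x
ℚ<⇒≱ x<y y≤x = ℚ.<-irrefl refl (ℚ.<-≤-trans x<y y≤x)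

toℚᵘ-/ : ∀ i n → toℚᵘ (i ℚ./ suc n) ℚᵘ.≃ mkℚᵘ i n
toℚᵘ-/ i n = ℚ.toℚᵘ-fromℚᵘ (mkℚᵘ i n)

ι-+ : ∀ m n → ι (m ℕ.+ n) ≡ ι m ℚ.+ ι n
ι-+ m n = ℚ.toℚᵘ-injective (begin
  toℚᵘ (ι (m ℕ.+ n)) ≈⟨ toℚᵘ-/ (+ (m ℕ.+ n)) 0 ⟩
  mkℚᵘ (+ (m ℕ.+ n)) 0 ≈⟨ *≡* (cong (ℤ._* + 1) (trans (ℤ.pos-+ m n) (sym (cong₂ ℤ._+_ (ℤ.*-identityʳ (+ m)) (ℤ.*-identityʳ (+ n)))))) ⟩
  mkℚᵘ (+ m) 0 ℚᵘ.+ mkℚᵘ (+ n) 0 ≈⟨ ℚᵘ.+-cong (toℚᵘ-/ (+ m) 0) (toℚᵘ-/ (+ n) 0) ⟨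
  toℚᵘ (ι m) ℚᵘ.+ toℚᵘ (ι n) ≈⟨ ℚ.toℚᵘ-homo-+ (ι m) (ι n) ⟨
  toℚᵘ (ι m ℚ.+ ι n) ∎)
  where open import Relation.Binary.Reasoning.Setoid ℚᵘ.≃-setoid

ι-* : ∀ m n → ι (m ℕ.* n) ≡ ι m ℚ.* ι n
ι-* m n = ℚ.toℚᵘ-injective (begin
  toℚᵘ (ι (m ℕ.* n)) ≈⟨ toℚᵘ-/ (+ (m ℕ.* n)) 0 ⟩
  mkℚᵘ (+ (m ℕ.* n)) 0 ≈⟨ *≡* (cong (ℤ._* + 1) (ℤ.pos-* m n)) ⟩
  mkℚᵘ (+ m) 0 ℚᵘ.* mkℚᵘ (+ n) 0 ≈⟨ ℚᵘ.*-cong (toℚᵘ-/ (+ m) 0) (toℚᵘ-/ (+ n) 0) ⟨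
  toℚᵘ (ι m) ℚᵘ.* toℚᵘ (ι n) ≈⟨ ℚ.toℚᵘ-homo-* (ι m) (ι n) ⟨
  toℚᵘ (ι m ℚ.* ι n) ∎)
  where open import Relation.Binary.Reasoning.Setoid ℚᵘ.≃-setoid

ι-^ : ∀ m n → ι (m ℕ.^ n) ≡ ι m ^ℚ n
ι-^ m zero    = refl
ι-^ m (suc n) = trans (ι-* m (m ℕ.^ n)) (cong (ι m ℚ.*_) (ι-^ m n))

ι-mono-≤ : ∀ {m n} → m ℕ.≤ n → ι m ℚ.≤ ι n
ι-mono-≤ {m} {n} m≤n = ℚ.toℚᵘ-cancel-≤ (ℚᵘ.≤-respˡ-≃ (ℚᵘ.≃-sym (toℚᵘ-/ (+ m) 0))
  (ℚᵘ.≤-respʳ-≃ (ℚᵘ.≃-sym (toℚᵘ-/ (+ n) 0)) (*≤* (ℤ.*-monoʳ-≤-nonNeg (+ 1) (ℤ.+≤+ m≤n)))))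

ι-mono-< : ∀ {m n} → m ℕ.< n → ι m ℚ.< ι n
ι-mono-< {m} {n} m<n = ℚ.toℚᵘ-cancel-< (ℚᵘ.<-respˡ-≃ (ℚᵘ.≃-sym (toℚᵘ-/ (+ m) 0))
  (ℚᵘ.<-respʳ-≃ (ℚᵘ.≃-sym (toℚᵘ-/ (+ n) 0)) (*<* (ℤ.*-monoʳ-<-pos (+ 1) (ℤ.+<+ m<n)))))

ι-cancel-< : ∀ {m n} → ι m ℚ.< ι n → m ℕ.< n
ι-cancel-< {m} {n} h = ℕ.≰⇒> λ n≤m → ℚ<⇒≱ h (ι-mono-≤ {n} {m} n≤m)

0≤ι : ∀ n → 0ℚ ℚ.≤ ι n
0≤ι n = ι-mono-≤ {0} {n} z≤n

/-* : ∀ v w → (+ v) ℚ./ suc w ℚ.* ι (suc w) ≡ ι v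
/-* v w = ℚ.toℚᵘ-injective (begin
  toℚᵘ ((+ v) ℚ./ suc w ℚ.* ι (suc w)) ≈⟨ ℚ.toℚᵘ-homo-* ((+ v) ℚ./ suc w) (ι (suc w)) ⟩
  toℚᵘ ((+ v) ℚ./ suc w) ℚᵘ.* toℚᵘ (ι (suc w)) ≈⟨ ℚᵘ.*-cong (toℚᵘ-/ (+ v) w) (toℚᵘ-/ (+ suc w) 0) ⟩
  mkℚᵘ (+ v) w ℚᵘ.* mkℚᵘ (+ suc w) 0 ≈⟨ *≡* (trans (ℤ.*-identityʳ _) (cong (+ v ℤ.*_) (cong (λ x → + suc x) (sym (ℕ.*-identityʳ w))))) ⟩
  mkℚᵘ (+ v) 0 ≈⟨ toℚᵘ-/ (+ v) 0 ⟨
  toℚᵘ (ι v) ∎)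
  where open import Relation.Binary.Reasoning.Setoid ℚᵘ.≃-setoid

numerator-/ : ∀ a → a ℚ.* ι (ℚ.denominatorℕ a) ≡ ℚ.numerator a ℚ./ 1
numerator-/ a@(mkℚ i d _) = ℚ.toℚᵘ-injective (begin
  toℚᵘ (a ℚ.* ι (suc d)) ≈⟨ ℚ.toℚᵘ-homo-* a (ι (suc d)) ⟩
  mkℚᵘ i d ℚᵘ.* toℚᵘ (ι (suc d)) ≈⟨ ℚᵘ.*-congˡ {mkℚᵘ i d} (toℚᵘ-/ (+ suc d) 0) ⟩
  mkℚᵘ i d ℚᵘ.* mkℚᵘ (+ suc d) 0 ≈⟨ *≡* (trans (ℤ.*-identityʳ _) (cong (i ℤ.*_) (cong (λ x → + suc x) (sym (ℕ.*-identityʳ d))))) ⟩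
  mkℚᵘ i 0 ≈⟨ toℚᵘ-/ i 0 ⟨
  toℚᵘ (i ℚ./ 1) ∎)
  where open import Relation.Binary.Reasoning.Setoid ℚᵘ.≃-setoid

posPart-/ : ∀ i → ι (posPart i) ≡ i ℚ./ 1 ℚ.+ ι (negPart i)
posPart-/ (+ n)    = sym (ℚ.+-identityʳ (ι n))
posPart-/ -[1+ n ] = sym (ℚ.+-inverseˡ (ι (suc n)))

numerator-split : ∀ a → ι (posPart (ℚ.numerator a)) ≡
  a ℚ.* ι (ℚ.denominatorℕ a) ℚ.+ ι (negPart (ℚ.numerator a))
numerator-split a = trans (posPart-/ (ℚ.numerator a)) (cong (ℚ._+ ι (negPart (ℚ.numerator a))) (sym (numerator-/ a)))

*-mono-≤₀ : ∀ {x y u v} → 0ℚ ℚ.≤ u → 0ℚ ℚ.≤ y → x ℚ.≤ y → u ℚ.≤ v → x ℚ.* u ℚ.≤ y ℚ.* v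
*-mono-≤₀ {x} {y} {u} {v} 0≤u 0≤y x≤y u≤v = ℚ.≤-trans
  (ℚ.*-monoʳ-≤-nonNeg u {{nonNegative 0≤u}} x≤y) (ℚ.*-monoˡ-≤-nonNeg y {{nonNegative 0≤y}} u≤v)

^ℚ-nonNeg : ∀ {x} n → 0ℚ ℚ.≤ x → 0ℚ ℚ.≤ x ^ℚ n
^ℚ-nonNeg zero    0≤x = ι-mono-≤ {0} {1} z≤n
^ℚ-nonNeg {x} (suc n) 0≤x = ℚ.≤-trans (ℚ.≤-reflexive (sym (ℚ.*-zeroˡ 0ℚ))) (*-mono-≤₀ ℚ.≤-refl 0≤x 0≤x (^ℚ-nonNeg n 0≤x))

^ℚ-mono-≤ : ∀ {x y} n → 0ℚ ℚ.≤ x → x ℚ.≤ y → x ^ℚ n ℚ.≤ y ^ℚ n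
^ℚ-mono-≤ zero    0≤x x≤y = ℚ.≤-refl
^ℚ-mono-≤ (suc n) 0≤x x≤y = *-mono-≤₀ (^ℚ-nonNeg n 0≤x) (ℚ.≤-trans 0≤x x≤y) x≤y (^ℚ-mono-≤ n 0≤x x≤y)

module _ {n t : ℕ} {a q : ℚ} where

  private
    β P M : ℕ
    β = ℚ.denominatorℕ a
    P = posPart (ℚ.numerator a)
    M = negPart (ℚ.numerator a)

    ι-scaled : ι (t ℕ.^ β ℕ.* n ℕ.^ M) ≡ (ι t ^ℚ β) ℚ.* (ι n ^ℚ M)
    ι-scaled = trans (ι-* (t ℕ.^ β) (n ℕ.^ M)) (cong₂ ℚ._*_ (ι-^ t β) (ι-^ n M))

    0≤nᴹ : 0ℚ ℚ.≤ ι n ^ℚ M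
    0≤nᴹ = ^ℚ-nonNeg M (0≤ι n)

  -- With a = (P - M) / β the conclusion is t < n ^ a, raised to the power β and freed of the
  -- negative part of the exponent.
  below-power : BelowPower n a q → ι t ℚ.< q → t ℕ.^ β ℕ.* n ℕ.^ M ℕ.< n ℕ.^ P
  below-power (inj₁ q≤0) t<q = ⊥-elim (ℚ<⇒≱ t<q (ℚ.≤-trans q≤0 (0≤ι t)))
  below-power (inj₂ q^β<) t<q = ι-cancel-< {t ℕ.^ β ℕ.* n ℕ.^ M} {n ℕ.^ P} (subst₂ ℚ._<_ (sym ι-scaled) (sym (ι-^ n P))
    (ℚ.≤-<-trans (*-mono-≤₀ 0≤nᴹ (^ℚ-nonNeg β (ℚ.≤-trans (0≤ι t) (ℚ.<⇒≤ t<q)))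
      (^ℚ-mono-≤ β (0≤ι t) (ℚ.<⇒≤ t<q)) ℚ.≤-refl) q^β<))

  above-power : AbovePower n a q → q ℚ.< ι t → n ℕ.^ P ℕ.< t ℕ.^ β ℕ.* n ℕ.^ M
  above-power (0<q , <q^β) q<t = ι-cancel-< {n ℕ.^ P} {t ℕ.^ β ℕ.* n ℕ.^ M} (subst₂ ℚ._<_ (sym (ι-^ n P)) (sym ι-scaled)
    (ℚ.<-≤-trans <q^β (*-mono-≤₀ 0≤nᴹ (^ℚ-nonNeg β (0≤ι t))
      (^ℚ-mono-≤ β (ℚ.<⇒≤ 0<q) (ℚ.<⇒≤ q<t)) ℚ.≤-refl)))

^-cancelˡ-< : ∀ k {m n} → m ℕ.^ k ℕ.< n ℕ.^ k → m ℕ.< n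
^-cancelˡ-< k {m} {n} h = ℕ.≰⇒> λ n≤m → ℕ.<⇒≱ h (ℕ.^-monoˡ-≤ k n≤m)

fromℚ-isDedekind : ∀ a → IsDedekind (fromℚ a)
fromℚ-isDedekind a = record
  { lower-inhabited = a ℚ.- 1ℚ , subst (a ℚ.- 1ℚ ℚ.<_) (ℚ.+-identityʳ a) (ℚ.+-monoʳ-< a (ℚ.negative⁻¹ (ℚ.- 1ℚ)))
  ; upper-inhabited = a ℚ.+ 1ℚ , subst (ℚ._< a ℚ.+ 1ℚ) (ℚ.+-identityʳ a) (ℚ.+-monoʳ-< a (ℚ.positive⁻¹ 1ℚ))
  ; lower-closed    = ℚ.<-trans
  ; upper-closed    = λ q<r a<q → ℚ.<-trans a<q q<r
  ; lower-open      = λ q<a → let (m , q<m , m<a) = ℚ.<-dense q<a in m , q<m , m<a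
  ; upper-open      = λ a<r → let (m , a<m , m<r) = ℚ.<-dense a<r in m , m<r , a<m
  ; disjoint        = λ (q<a , a<q) → ℚ.<-asym q<a a<q
  ; located         = located
  }
  where
  located : ∀ {q r} → q ℚ.< r → q ℚ.< a ⊎ a ℚ.< r
  located {q} q<r with q ℚ.<? a
  ... | yes q<a = inj₁ q<a
  ... | no  q≮a = inj₂ (ℚ.≤-<-trans (ℚ.≮⇒≥ q≮a) q<r)

fromℕᵣ : ℕ → ℝ
fromℕᵣ n = record { cut = fromℕ n ; isDedekind = fromℚ-isDedekind (ι n) }

-- A positive real ε exceeds 1 / r with r the denominator of a rational in (0, ε).
module Exponent {ε : Cut} (ε-dedekind : IsDedekind ε) {q₀ : ℚ} (0<q₀ : 0ℚ ℚ.< q₀) (q₀<ε : Lower ε q₀) where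

  r : ℕ
  r = ℚ.denominatorℕ q₀

  1≤q₀r : 1ℚ ℚ.≤ q₀ ℚ.* ι r
  1≤q₀r = subst (1ℚ ℚ.≤_) (sym (numerator-/ q₀)) (numerator≥1 q₀ 0<q₀)
    where
    numerator≥1 : ∀ q → 0ℚ ℚ.< q → 1ℚ ℚ.≤ ℚ.numerator q ℚ./ 1
    numerator≥1 (mkℚ (+ suc n) d _) _ = ι-mono-≤ {1} {suc n} (s≤s z≤n)
    numerator≥1 (mkℚ (+ zero)  d _) (*<* 0<0) = ⊥-elim (ℤ.<-irrefl (sym (ℤ.*-zeroˡ (+ 1))) 0<0)
    numerator≥1 (mkℚ -[1+ n ]  d _) (*<* ())

  ε<⇒q₀< : ∀ {a} → Upper ε a → q₀ ℚ.< a
  ε<⇒q₀< {a} ε<a with ℚ.<-cmp q₀ a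
  ... | tri< q₀<a _ _ = q₀<a
  ... | tri≈ _ refl _ = ⊥-elim (IsDedekind.disjoint ε-dedekind (q₀<ε , ε<a))
  ... | tri> _ _ a<q₀ = ⊥-elim (IsDedekind.disjoint ε-dedekind (IsDedekind.lower-closed ε-dedekind a<q₀ q₀<ε , ε<a))

  -- This is 1 / r ≤ q₀ < a for a = (P - M) / β, cleared of denominators and of subtraction.
  β<rP : ∀ a → q₀ ℚ.< a → ℚ.denominatorℕ a ℕ.+ negPart (ℚ.numerator a) ℕ.* r ℕ.≤ posPart (ℚ.numerator a) ℕ.* r
  β<rP a q₀<a = ℕ.<⇒≤ (ι-cancel-< {β ℕ.+ M ℕ.* r} {P ℕ.* r} (begin-strict
    ι (β ℕ.+ M ℕ.* r)
      ≡⟨ trans (ι-+ β (M ℕ.* r)) (cong (ι β ℚ.+_) (ι-* M r)) ⟩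
    ι β ℚ.+ ι M ℚ.* ι r
      ≡⟨ cong (ℚ._+ ι M ℚ.* ι r) (ℚ.*-identityˡ (ι β)) ⟨
    1ℚ ℚ.* ι β ℚ.+ ι M ℚ.* ι r
      ≤⟨ ℚ.+-monoˡ-≤ (ι M ℚ.* ι r) (ℚ.*-monoʳ-≤-nonNeg (ι β) {{nonNegative (0≤ι β)}} 1≤q₀r) ⟩
    q₀ ℚ.* ι r ℚ.* ι β ℚ.+ ι M ℚ.* ι r
      <⟨ ℚ.+-monoˡ-< (ι M ℚ.* ι r) (ℚ.*-monoˡ-<-pos (ι β) {{positive (ι-mono-< {0} {β} (s≤s z≤n))}}
           (ℚ.*-monoˡ-<-pos (ι r) {{positive (ι-mono-< {0} {r} (s≤s z≤n))}} q₀<a)) ⟩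
    a ℚ.* ι r ℚ.* ι β ℚ.+ ι M ℚ.* ι r
      ≡⟨ solve 4 (λ a r b m → a :* r :* b :+ m :* r := (a :* b :+ m) :* r) refl a (ι r) (ι β) (ι M) ⟩
    (a ℚ.* ι β ℚ.+ ι M) ℚ.* ι r
      ≡⟨ cong (ℚ._* ι r) (numerator-split a) ⟨
    ι P ℚ.* ι r
      ≡⟨ ι-* P r ⟨
    ι (P ℕ.* r) ∎))
    where
    open ℚ.≤-Reasoning
    β P M : ℕ
    β = ℚ.denominatorℕ a
    P = posPart (ℚ.numerator a)
    M = negPart (ℚ.numerator a)

0<ι : ∀ n .{{_ : NonZero n}} → 0ℚ ℚ.< ι n
0<ι n = ι-mono-< {0} {n} (ℕ.>-nonZero⁻¹ n)

module Bounds {ε : Cut} (ε-dedekind : IsDedekind ε) {q₀ : ℚ} (0<q₀ : 0ℚ ℚ.< q₀) (q₀<ε : Lower ε q₀) where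
  open Exponent ε-dedekind 0<q₀ q₀<ε public

  -- Every rational a > ε exceeds 1 / r, so N ^ (1 / r) ≤ N ^ a < t. Raising to the power r β keeps
  -- this in ℕ.
  power-lower-bound : ∀ N t → 1 ℕ.≤ N → N ^ᶜ ε <ᶜ fromℕ t → N ℕ.< t ℕ.^ r
  power-lower-bound N t 1≤N (q , (a , ε<a , above) , q<t) =
    ^-cancelˡ-< β (ℕ.*-cancelʳ-< (N ℕ.^ (M ℕ.* r)) (N ℕ.^ β) ((t ℕ.^ r) ℕ.^ β) (begin-strict
      N ℕ.^ β ℕ.* N ℕ.^ (M ℕ.* r) ≡⟨ ℕ.^-distribˡ-+-* N β (M ℕ.* r) ⟨
      N ℕ.^ (β ℕ.+ M ℕ.* r) ≤⟨ ℕ.^-monoʳ-≤ N {{ℕ.>-nonZero 1≤N}} (β<rP a (ε<⇒q₀< ε<a)) ⟩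
      N ℕ.^ (P ℕ.* r) ≡⟨ ℕ.^-*-assoc N P r ⟨
      (N ℕ.^ P) ℕ.^ r <⟨ ℕ.^-monoˡ-< r (above-power {N} {t} {a} above q<t) ⟩
      (t ℕ.^ β ℕ.* N ℕ.^ M) ℕ.^ r ≡⟨ ^-distribʳ-* r (t ℕ.^ β) (N ℕ.^ M) ⟩
      (t ℕ.^ β) ℕ.^ r ℕ.* (N ℕ.^ M) ℕ.^ r ≡⟨ cong₂ ℕ._*_ (trans (ℕ.^-*-assoc t β r) (trans (cong (t ℕ.^_) (ℕ.*-comm β r)) (sym (ℕ.^-*-assoc t r β)))) (ℕ.^-*-assoc N M r) ⟩
      (t ℕ.^ r) ℕ.^ β ℕ.* N ℕ.^ (M ℕ.* r) ∎))
    where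
    open ℕ.≤-Reasoning
    β P M : ℕ
    β = ℚ.denominatorℕ a
    P = posPart (ℚ.numerator a)
    M = negPart (ℚ.numerator a)

  -- A rational a < c - ε satisfies a < c - 1 / r, so t < n ^ a gives t ^ r < n ^ (c r - 1). The
  -- factor n on the left avoids the subtraction.
  power-upper-bound : ∀ n t c {q} → 1 ℕ.≤ n → Lower (n ^ᶜ (fromℕ c -ᶜ ε)) q → ι t ℚ.< q →
                      t ℕ.^ r ℕ.* n ℕ.< n ℕ.^ (c ℕ.* r)
  power-upper-bound n t c {q} 1≤n (a , (b , b<c , ε<) , below) t<q =
    ^-cancelˡ-< β (ℕ.*-cancelʳ-< (n ℕ.^ (M ℕ.* r)) ((t ℕ.^ r ℕ.* n) ℕ.^ β) ((n ℕ.^ (c ℕ.* r)) ℕ.^ β) (begin-strict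
      (t ℕ.^ r ℕ.* n) ℕ.^ β ℕ.* n ℕ.^ (M ℕ.* r)
        ≡⟨ cong (ℕ._* n ℕ.^ (M ℕ.* r)) (trans (^-distribʳ-* β (t ℕ.^ r) n) (cong (ℕ._* n ℕ.^ β) (trans (ℕ.^-*-assoc t r β) (trans (cong (t ℕ.^_) (ℕ.*-comm r β)) (sym (ℕ.^-*-assoc t β r)))))) ⟩
      (t ℕ.^ β) ℕ.^ r ℕ.* n ℕ.^ β ℕ.* n ℕ.^ (M ℕ.* r)
        ≡⟨ cong ((t ℕ.^ β) ℕ.^ r ℕ.* n ℕ.^ β ℕ.*_) (ℕ.^-*-assoc n M r) ⟨
      (t ℕ.^ β) ℕ.^ r ℕ.* n ℕ.^ β ℕ.* (n ℕ.^ M) ℕ.^ r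
        ≡⟨ ℕ-Solver.solve 3 (λ x y z → x ℕ-Solver.:* y ℕ-Solver.:* z ℕ-Solver.:= x ℕ-Solver.:* z ℕ-Solver.:* y) refl ((t ℕ.^ β) ℕ.^ r) (n ℕ.^ β) ((n ℕ.^ M) ℕ.^ r) ⟩
      (t ℕ.^ β) ℕ.^ r ℕ.* (n ℕ.^ M) ℕ.^ r ℕ.* n ℕ.^ β
        ≡⟨ cong (ℕ._* n ℕ.^ β) (^-distribʳ-* r (t ℕ.^ β) (n ℕ.^ M)) ⟨
      (t ℕ.^ β ℕ.* n ℕ.^ M) ℕ.^ r ℕ.* n ℕ.^ β
        <⟨ ℕ.*-monoˡ-< (n ℕ.^ β) {{ℕ.m^n≢0 n β}} (ℕ.^-monoˡ-< r (below-power {n} {t} {a} below t<q)) ⟩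
      (n ℕ.^ P) ℕ.^ r ℕ.* n ℕ.^ β
        ≡⟨ trans (cong (ℕ._* n ℕ.^ β) (ℕ.^-*-assoc n P r)) (sym (ℕ.^-distribˡ-+-* n (P ℕ.* r) β)) ⟩
      n ℕ.^ (P ℕ.* r ℕ.+ β)
        ≤⟨ ℕ.^-monoʳ-≤ n exponents ⟩
      n ℕ.^ (c ℕ.* r ℕ.* β ℕ.+ M ℕ.* r)
        ≡⟨ trans (ℕ.^-distribˡ-+-* n (c ℕ.* r ℕ.* β) (M ℕ.* r)) (cong (ℕ._* n ℕ.^ (M ℕ.* r)) (sym (ℕ.^-*-assoc n (c ℕ.* r) β))) ⟩
      (n ℕ.^ (c ℕ.* r)) ℕ.^ β ℕ.* n ℕ.^ (M ℕ.* r) ∎))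
    where
    open ℕ.≤-Reasoning
    instance
      n≢0 : NonZero n
      n≢0 = ℕ.>-nonZero 1≤n
    β P M : ℕ
    β = ℚ.denominatorℕ a
    P = posPart (ℚ.numerator a)
    M = negPart (ℚ.numerator a)
    a+q₀<c : a ℚ.+ q₀ ℚ.< ι c
    a+q₀<c = ℚ.<-trans (subst (a ℚ.+ q₀ ℚ.<_) (solve 2 (λ a b → a :+ (:- (a :+ (:- b))) := b) refl a b)
      (ℚ.+-monoʳ-< a (ε<⇒q₀< ε<))) b<c
    exponents : P ℕ.* r ℕ.+ β ℕ.≤ c ℕ.* r ℕ.* β ℕ.+ M ℕ.* r
    exponents = ℕ.<⇒≤ (ι-cancel-< {P ℕ.* r ℕ.+ β} {c ℕ.* r ℕ.* β ℕ.+ M ℕ.* r} (ℚR.begin-strict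
      ι (P ℕ.* r ℕ.+ β)
        ℚR.≡⟨ trans (ι-+ (P ℕ.* r) β) (cong₂ ℚ._+_ (trans (ι-* P r) (cong (ℚ._* ι r) (numerator-split a))) (sym (ℚ.*-identityˡ (ι β)))) ⟩
      (a ℚ.* ι β ℚ.+ ι M) ℚ.* ι r ℚ.+ 1ℚ ℚ.* ι β
        ℚR.≤⟨ ℚ.+-monoʳ-≤ ((a ℚ.* ι β ℚ.+ ι M) ℚ.* ι r) (ℚ.*-monoʳ-≤-nonNeg (ι β) {{nonNegative (0≤ι β)}} 1≤q₀r) ⟩
      (a ℚ.* ι β ℚ.+ ι M) ℚ.* ι r ℚ.+ q₀ ℚ.* ι r ℚ.* ι β
        ℚR.≡⟨ solve 5 (λ a b m r q → (a :* b :+ m) :* r :+ q :* r :* b := (a :+ q) :* r :* b :+ m :* r) refl a (ι β) (ι M) (ι r) q₀ ⟩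
      (a ℚ.+ q₀) ℚ.* ι r ℚ.* ι β ℚ.+ ι M ℚ.* ι r
        ℚR.<⟨ ℚ.+-monoˡ-< (ι M ℚ.* ι r) (ℚ.*-monoˡ-<-pos (ι β) {{positive (0<ι β)}}
                (ℚ.*-monoˡ-<-pos (ι r) {{positive (0<ι r)}} a+q₀<c)) ⟩
      ι c ℚ.* ι r ℚ.* ι β ℚ.+ ι M ℚ.* ι r
        ℚR.≡⟨ cong₂ ℚ._+_ (trans (cong (ℚ._* ι β) (sym (ι-* c r))) (sym (ι-* (c ℕ.* r) β))) (sym (ι-* M r)) ⟩
      ι (c ℕ.* r ℕ.* β) ℚ.+ ι (M ℕ.* r)
        ℚR.≡⟨ ι-+ (c ℕ.* r ℕ.* β) (M ℕ.* r) ⟨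
      ι (c ℕ.* r ℕ.* β ℕ.+ M ℕ.* r) ℚR.∎))
      where module ℚR = ℚ.≤-Reasoning

-- Every lower endpoint x < 1 of the factor 1 satisfies x m ≤ m. According to the sign of x, the
-- endpoint y below m or the endpoint z above m bounds `a` by x m.
one-times-lower : ∀ m {a} → Lower (fromℕ 1 *ᶜ fromℕ m) a → a ℚ.< ι m
one-times-lower m {a} (x , b , y , z , (x<1 , _) , (y<m , m<z) , a<xy , a<xz , _ , _) with 0ℚ ℚ.≤? x
... | yes 0≤x = ℚ.<-≤-trans a<xy (ℚ.≤-trans (ℚ.*-monoˡ-≤-nonNeg x {{nonNegative 0≤x}} (ℚ.<⇒≤ y<m)) xm≤m)
  where
  xm≤m : x ℚ.* ι m ℚ.≤ ι m
  xm≤m = ℚ.≤-trans (ℚ.*-monoʳ-≤-nonNeg (ι m) {{nonNegative (0≤ι m)}} (ℚ.<⇒≤ x<1)) (ℚ.≤-reflexive (ℚ.*-identityˡ (ι m)))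
... | no  0≰x = ℚ.<-≤-trans a<xz (ℚ.≤-trans (ℚ.*-monoˡ-≤-nonPos x {{ℚ.nonPositive (ℚ.<⇒≤ (ℚ.≰⇒> 0≰x))}} (ℚ.<⇒≤ m<z)) xm≤m)
  where
  xm≤m : x ℚ.* ι m ℚ.≤ ι m
  xm≤m = ℚ.≤-trans (ℚ.*-monoʳ-≤-nonNeg (ι m) {{nonNegative (0≤ι m)}} (ℚ.<⇒≤ x<1)) (ℚ.≤-reflexive (ℚ.*-identityˡ (ι m)))

period-power-bound : ∀ N d m {q} → 1 ℕ.≤ d → Lower (d ^[ fromℕ 1 · [ m ] ]) q → ι N ℚ.< q → N ℕ.< d ℕ.^ m
period-power-bound N d m {q} 1≤d (a , a<m′ , below) N<q =
  ^-cancelˡ-< β (ℕ.*-cancelʳ-< (d ℕ.^ M) (N ℕ.^ β) ((d ℕ.^ m) ℕ.^ β) (begin-strict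
    N ℕ.^ β ℕ.* d ℕ.^ M <⟨ below-power {d} {N} {a} below N<q ⟩
    d ℕ.^ P ≤⟨ ℕ.^-monoʳ-≤ d {{ℕ.>-nonZero 1≤d}} exponents ⟩
    d ℕ.^ (m ℕ.* β ℕ.+ M) ≡⟨ trans (ℕ.^-distribˡ-+-* d (m ℕ.* β) M) (cong (ℕ._* d ℕ.^ M) (sym (ℕ.^-*-assoc d m β))) ⟩
    (d ℕ.^ m) ℕ.^ β ℕ.* d ℕ.^ M ∎))
  where
  open ℕ.≤-Reasoning
  β P M : ℕ
  β = ℚ.denominatorℕ a
  P = posPart (ℚ.numerator a)
  M = negPart (ℚ.numerator a)
  exponents : P ℕ.≤ m ℕ.* β ℕ.+ M
  exponents = ℕ.<⇒≤ (ι-cancel-< {P} {m ℕ.* β ℕ.+ M} (subst₂ ℚ._<_ (sym (numerator-split a))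
    (sym (trans (ι-+ (m ℕ.* β) M) (cong (ℚ._+ ι M) (ι-* m β))))
    (ℚ.+-monoˡ-< (ι M) (ℚ.*-monoˡ-<-pos (ι β) {{positive (0<ι β)}} (one-times-lower m a<m′)))))

-- Bounds for the logarithm and the frequency as a cut

2^K≤y²ᴷ : ∀ {y} → ι 2 ℚ.≤ y ℚ.* y → ∀ K → ι (2 ℕ.^ K) ℚ.≤ (y ^ℚ K) ℚ.* (y ^ℚ K)
2^K≤y²ᴷ {y} 2≤y² zero    = ℚ.≤-refl
2^K≤y²ᴷ {y} 2≤y² (suc K) = begin
  ι (2 ℕ.* 2 ℕ.^ K) ≡⟨ ι-* 2 (2 ℕ.^ K) ⟩
  ι 2 ℚ.* ι (2 ℕ.^ K) ≤⟨ *-mono-≤₀ (0≤ι (2 ℕ.^ K)) (ℚ.≤-trans (0≤ι 2) 2≤y²) 2≤y² (2^K≤y²ᴷ {y} 2≤y² K) ⟩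
  y ℚ.* y ℚ.* ((y ^ℚ K) ℚ.* (y ^ℚ K)) ≡⟨ solve 2 (λ y z → y :* y :* (z :* z) := y :* z :* (y :* z)) refl y (y ^ℚ K) ⟩
  y ℚ.* (y ^ℚ K) ℚ.* (y ℚ.* (y ^ℚ K)) ∎
  where open ℚ.≤-Reasoning

-- The bound (1 + q / m)ᵐ with q = K + 1 and m = 2 q, since (1 + 1 / 2)² ≥ 2.
log-upper : ∀ N K → N ℕ.< 2 ℕ.^ suc K → Upper (log N) (ι (suc K))
log-upper N K N<2^K = k , abs< , ℚ.<-≤-trans (ι-mono-< {N} {2 ℕ.^ suc K} N<2^K)
    (ℚ.≤-trans (2^K≤y²ᴷ {y} 2≤y² (suc K)) (ℚ.≤-reflexive (sym (^-homo-* y (suc K) (suc K)))))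
  where
  open import Algebra.Bundles using (CommutativeRing)
  open import Algebra.Properties.Semiring.Exp (CommutativeRing.semiring ℚ.+-*-commutativeRing) using (^-homo-*)
  k : ℕ
  k = K ℕ.+ suc K
  abs< : ℚ.∣ ι (suc K) ∣ ℚ.< ι (suc k)
  abs< = subst (ℚ._< ι (suc k)) (sym (ℚ.0≤p⇒∣p∣≡p (0≤ι (suc K))))
    (ι-mono-< {suc K} {suc k} (ℕ.m<m+n (suc K) {suc K} (s≤s z≤n)))
  x y : ℚ
  x = ι (suc K) ℚ.* ((+ 1) ℚ./ suc k)
  y = 1ℚ ℚ.+ x
  x+x≡1 : x ℚ.+ x ≡ 1ℚ
  x+x≡1 = begin
    x ℚ.+ x ≡⟨ ℚ.*-distribʳ-+ ((+ 1) ℚ./ suc k) (ι (suc K)) (ι (suc K)) ⟨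
    (ι (suc K) ℚ.+ ι (suc K)) ℚ.* ((+ 1) ℚ./ suc k) ≡⟨ cong (ℚ._* ((+ 1) ℚ./ suc k)) (ι-+ (suc K) (suc K)) ⟨
    ι (suc k) ℚ.* ((+ 1) ℚ./ suc k) ≡⟨ ℚ.*-comm (ι (suc k)) ((+ 1) ℚ./ suc k) ⟩
    ((+ 1) ℚ./ suc k) ℚ.* ι (suc k) ≡⟨ /-* 1 k ⟩
    1ℚ ∎
    where open ≡-Reasoning
  0≤x : 0ℚ ℚ.≤ x
  0≤x = ℚ.≮⇒≥ λ x<0 → ℚ<⇒≱ (ℚ.<-trans (ℚ.+-mono-< x<0 x<0) (ι-mono-< {0} {1} (s≤s z≤n))) (ℚ.≤-reflexive (sym x+x≡1))
  2≤y² : ι 2 ℚ.≤ y ℚ.* y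
  2≤y² = begin
    ι 2 ≡⟨ ℚ.+-identityʳ (ι 2) ⟨
    ι 2 ℚ.+ 0ℚ ≤⟨ ℚ.+-monoʳ-≤ (ι 2) (subst (ℚ._≤ x ℚ.* x) (ℚ.*-zeroˡ 0ℚ) (*-mono-≤₀ ℚ.≤-refl 0≤x 0≤x 0≤x)) ⟩
    ι 2 ℚ.+ x ℚ.* x ≡⟨ cong (λ z → 1ℚ ℚ.+ z ℚ.+ x ℚ.* x) x+x≡1 ⟨
    1ℚ ℚ.+ (x ℚ.+ x) ℚ.+ x ℚ.* x ≡⟨ solve 1 (λ x → con 1ℚ :+ (x :+ x) :+ x :* x := (con 1ℚ :+ x) :* (con 1ℚ :+ x)) refl x ⟩
    y ℚ.* y ∎
    where open ℚ.≤-Reasoning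

-- A positive lower bound is what makes the reciprocal of the logarithm bounded above. With one
-- factor, 2 (1 - 1 / 4) > 1 is enough.
log-lower : ∀ N → 2 ℕ.≤ N → Lower (log N) ((+ 1) ℚ./ 4)
log-lower N 2≤N = 0 , from-yes (ℚ.∣ (+ 1) ℚ./ 4 ∣ ℚ.<? ι 1) ,
  ℚ.<-≤-trans (from-yes (1ℚ ℚ.<? ι 2 ℚ.* z))
    (ℚ.*-monoʳ-≤-nonNeg z {{nonNegative (from-yes (0ℚ ℚ.≤? z))}} (ι-mono-≤ {2} {N} 2≤N))
  where
  z : ℚ
  z = (1ℚ ℚ.- (+ 1) ℚ./ 4 ℚ.* ((+ 1) ℚ./ 1)) ^ℚ 1

-- A product of cuts needs an enclosure of both factors: C + 1 lies in (C, C + 2), and 1 / log N in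
-- (1 / (K + 1), 5), the 5 coming from log N > 1 / 4. The least of the four products of endpoints is
-- C / (K + 1), which exceeds v / w; this is why the constant is C + 1.
frequency-bound : ∀ v w .{{_ : NonZero w}} N K C → 2 ℕ.≤ N → 1 ℕ.≤ K → N ℕ.< 2 ℕ.^ K →
  v ℕ.* suc K ℕ.< C ℕ.* w → fromℚ ((+ v) ℚ./ w) <ᶜ fromℕ (suc C) *ᶜ recip⁺ (log N)
frequency-bound v zero    N K       C 2≤N 1≤K N<2^K h = ⊥-elim (ℕ.n≮0 (subst (v ℕ.* suc K ℕ.<_) (ℕ.*-zeroʳ C) h))
frequency-bound v (suc w) N (suc K) C 2≤N 1≤K N<2^K h = q , x<q ,
  (ι C , ι (2 ℕ.+ C) , c , ι 5 ,
   (ι-mono-< {C} {suc C} ℕ.≤-refl , ι-mono-< {suc C} {2 ℕ.+ C} ℕ.≤-refl) ,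
   ((ι (suc K) , log-upper N K N<2^K , cK<1) ,
    ((+ 1) ℚ./ 4 , from-yes (0ℚ ℚ.<? (+ 1) ℚ./ 4) , log-lower N 2≤N , from-yes (1ℚ ℚ.<? ι 5 ℚ.* ((+ 1) ℚ./ 4)))) ,
   q<Cc ,
   ℚ.<-≤-trans q<Cc (*-mono-≤₀ 0≤c (0≤ι C) ℚ.≤-refl c≤5) ,
   ℚ.<-≤-trans q<Cc (*-mono-≤₀ 0≤c (0≤ι (2 ℕ.+ C)) C≤2+C ℚ.≤-refl) ,
   ℚ.<-≤-trans q<Cc (*-mono-≤₀ 0≤c (0≤ι (2 ℕ.+ C)) C≤2+C c≤5))
  where
  s : ℕ
  s = suc (suc K)
  c : ℚ
  c = (+ 1) ℚ./ s
  instance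
    s-nonNeg = nonNegative (0≤ι s)
  C≤2+C : ι C ℚ.≤ ι (2 ℕ.+ C)
  C≤2+C = ι-mono-≤ {C} {2 ℕ.+ C} (ℕ.m≤n+m C 2)
  cs≡1 : c ℚ.* ι s ≡ 1ℚ
  cs≡1 = /-* 1 (suc K)
  0<c : 0ℚ ℚ.< c
  0<c = ℚ.*-cancelʳ-<-nonNeg (ι s) (subst₂ ℚ._<_ (sym (ℚ.*-zeroˡ (ι s))) (sym cs≡1) (ι-mono-< {0} {1} (s≤s z≤n)))
  0≤c : 0ℚ ℚ.≤ c
  0≤c = ℚ.<⇒≤ 0<c
  cK<1 : c ℚ.* ι (suc K) ℚ.< 1ℚ
  cK<1 = subst (c ℚ.* ι (suc K) ℚ.<_) cs≡1
    (ℚ.*-monoʳ-<-pos c {{positive 0<c}} (ι-mono-< {suc K} {s} ℕ.≤-refl))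
  c≤5 : c ℚ.≤ ι 5
  c≤5 = ℚ.≤-trans (ℚ.≤-trans (ℚ.≤-reflexive (sym (ℚ.*-identityʳ c)))
    (ℚ.≤-trans (ℚ.*-monoˡ-≤-nonNeg c {{nonNegative 0≤c}} (ι-mono-≤ {1} {s} (s≤s z≤n))) (ℚ.≤-reflexive cs≡1)))
    (ι-mono-≤ {1} {5} (s≤s z≤n))
  x : ℚ
  x = (+ v) ℚ./ suc w
  x<Cc : x ℚ.< ι C ℚ.* c
  x<Cc = ℚ.*-cancelʳ-<-nonNeg (ι (suc w)) {{nonNegative (0≤ι (suc w))}}
    (ℚ.*-cancelʳ-<-nonNeg (ι s) (begin-strict
      x ℚ.* ι (suc w) ℚ.* ι s ≡⟨ cong (ℚ._* ι s) (/-* v w) ⟩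
      ι v ℚ.* ι s ≡⟨ ι-* v s ⟨
      ι (v ℕ.* s) <⟨ ι-mono-< {v ℕ.* s} {C ℕ.* suc w} h ⟩
      ι (C ℕ.* suc w) ≡⟨ ι-* C (suc w) ⟩
      ι C ℚ.* ι (suc w) ≡⟨ ℚ.*-identityʳ _ ⟨
      ι C ℚ.* ι (suc w) ℚ.* 1ℚ ≡⟨ cong (ι C ℚ.* ι (suc w) ℚ.*_) cs≡1 ⟨
      ι C ℚ.* ι (suc w) ℚ.* (c ℚ.* ι s) ≡⟨ solve 4 (λ C w c s → C :* w :* (c :* s) := C :* c :* w :* s) refl (ι C) (ι (suc w)) c (ι s) ⟩
      ι C ℚ.* c ℚ.* ι (suc w) ℚ.* ι s ∎))
    where open ℚ.≤-Reasoning
  between = ℚ.<-dense x<Cc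
  q : ℚ
  q = proj₁ between
  x<q : x ℚ.< q
  x<q = proj₁ (proj₂ between)
  q<Cc : q ℚ.< ι C ℚ.* c
  q<Cc = proj₂ (proj₂ between)

-- Periodicity of 0 and the choice of the constants

import Data.Fin.Subset as Subset

-- A return of the orbit of 0 to 0 at time m makes m a period. So the period length is finite and at
-- most m, and N < d ^ m contradicts d ^ m ≤ N.
no-early-zero : ∀ {p : ℕ} .{{_ : NonZero p}} (f : List (Fin p)) d N → 1 ≤ d → ∀ P₀ → IsPeriodLength f 0ₚ P₀ →
  ∀ {q} → Lower (d ^[ fromℕ 1 · P₀ ]) q → ι N ℚ.< q →
  ∀ m → 0 < m → d ℕ.^ m ≤ N → orbit f 0ₚ m ≢ 0ₚ
no-early-zero f d N 1≤d P₀ P₀-length q<d^P₀ N<q m 0<m d^m≤N returns = contradict P₀ P₀-length q<d^P₀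
  where
  periodic : IsPeriod f 0ₚ m
  periodic = 0<m , λ n → sym (trans (sym (orbit-+ f 0ₚ m n)) (cong (λ v → orbit f v n) returns))
  contradict : ∀ P₀ → IsPeriodLength f 0ₚ P₀ → Lower (d ^[ fromℕ 1 · P₀ ]) _ → ⊥
  contradict ⊤⁺     none          _      = none m periodic
  contradict [ m₀ ] (_ , minimal) q<d^m₀ = ℕ.<⇒≱ (period-power-bound N d m₀ 1≤d q<d^m₀ N<q)
    (ℕ.≤-trans (ℕ.^-monoʳ-≤ d {{ℕ.>-nonZero 1≤d}} (minimal m periodic)) d^m≤N)

corollary1p4 : ∀ (ε : ℝ) → fromℕ 0 <ᶜ cut ε →
    ∀ (d : ℕ) → 2 ≤ d →
    Σ[ c₁ ∈ ℝ ] Σ[ c₂ ∈ ℝ ] (fromℕ 0 <ᶜ cut c₁ × fromℕ 0 <ᶜ cut c₂ ×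
    (∀ (p : ℕ) .{{_ : NonZero p}} → Prime p →
    ∀ (f : List (Fin p)) → HasDegree f d →
    ∀ (u : Fin p) (N : ℕ) (G : Subset p) → IsSubgroup G →
    ∀ (P₀ : ℕ ⁺) → IsPeriodLength f 0ₚ P₀ →
    ∀ (T : ℕ) → IsTrajectoryLength f u T →
    N ^ᶜ cut ε <ᶜ fromℕ ∣ G ∣ →
    fromℕ ∣ G ∣ <ᶜ (N ^ᶜ (fromℕ 2 -ᶜ cut ε)) ⊓ᶜ (p ^ᶜ (fromℕ 1 -ᶜ cut ε)) →
    2 ≤ N →
    fromℕ N <ᶜ (d ^[ cut c₁ · P₀ ]) ⊓ᶜ fromℕ T →
    fromℚ (ρ f u G N) <ᶜ cut c₂ *ᶜ recip⁺ (log N)))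
corollary1p4 ε (q₀ , 0<q₀ , q₀<ε) d 2≤d =
  -- c₁ = 1 suffices, since every iterate in use has an index m with d ^ m ≤ N. In c₂ the number ε
  -- enters only through the denominator r of the given rational in (0, ε).
  fromℕᵣ 1 , fromℕᵣ (suc C) , ℚ.<-dense (0<ι 1) , ℚ.<-dense (0<ι (suc C)) ,
  λ p p-prime f f-deg u N G subgroup P₀ P₀-length T T-length N^ε<t t< 2≤N N< →
    let (q₁ , t<q₁ , q₁<N^ , q₁<p^) = t<
        (q₂ , N<q₂ , q₂<d^ , q₂<T)  = N<
        1≤N  = ℕ.≤-trans (s≤s z≤n) 2≤N
        1≤p  = ℕ.>-nonZero⁻¹ p
        t    = ∣ G ∣
        distinct : ∀ {i j} → i < j → j ≤ N → orbit f u i ≢ orbit f u j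
        distinct i<j j≤N eq = ℕ.<⇒≱
          (ℕ.≤-<-trans j≤N (ι-cancel-< {N} {T} (ℚ.<-trans N<q₂ q₂<T))) (proj₂ T-length _ (_ , i<j , eq))
        t^r<N : t ℕ.^ r < N ℕ.^ (r′ ℕ.+ r)
        t^r<N = ℕ.*-cancelʳ-< N (t ℕ.^ r) (N ℕ.^ (r′ ℕ.+ r))
          (subst (t ℕ.^ r ℕ.* N <_) (trans (cong (N ℕ.^_) (cong (r ℕ.+_) (ℕ.+-identityʳ r))) (ℕ.*-comm N (N ℕ.^ (r′ ℕ.+ r))))
            (power-upper-bound N t 2 1≤N q₁<N^ t<q₁))
        t^r<p : t ℕ.^ r < p ℕ.^ r′
        t^r<p = ℕ.*-cancelʳ-< p (t ℕ.^ r) (p ℕ.^ r′)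
          (subst (t ℕ.^ r ℕ.* p <_) (trans (cong (p ℕ.^_) (ℕ.+-identityʳ r)) (ℕ.*-comm p (p ℕ.^ r′)))
            (power-upper-bound p t 1 1≤p q₁<p^ t<q₁))
        (k , 1≤k , N<2^k , few) = Frequency.frequency r′ d 2≤d p-prime f f-deg u N subgroup
          (no-early-zero f d N (ℕ.≤-trans (s≤s z≤n) 2≤d) P₀ P₀-length q₂<d^ N<q₂)
          distinct (power-lower-bound N t 1≤N N^ε<t) t^r<N t^r<p 2≤N
    in frequency-bound ∣ values f u N Subset.∩ G ∣ ∣ values f u N ∣ {{values-nonZero f u N}} N k C 2≤N 1≤k N<2^k few
  where
  open Bounds (isDedekind ε) 0<q₀ q₀<ε
  r′ C : ℕ
  r′ = ℕ.pred r
  C = 2 ℕ.+ Frequency.K₀ r′ d 2≤d ℕ.+ Frequency.C₁ r′ d 2≤d
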